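{- Let $\Sigma$ be a finite relational signature. Then $\mathcal P^\Sigma[\mathsf U](\mathcal{EL})$ is polynomially characterisable within $\mathcal Q_p^\Sigma[\mathsf U](\mathcal{EL})$, while $\mathcal P^\Sigma[\mathsf U](\mathcal{ELI})$ is exponentially, but not polynomially, characterisable within $\mathcal Q_p^\Sigma[\mathsf U](\mathcal{ELI})$.
   Context: **Data.** A relational signature $\Sigma$ is a finite nonempty set of unary and binary predicate symbols. A $\Sigma$-data instance $\mathcal A$ is a finite set of facts $A(a)$, $P(a,b)$ with $A,P\in\Sigma$ and individual names $a,b$; we write $P^-(a,b)\in\mathcal A$ iff $P(b,a)\in\mathcal A$. $\mathrm{ind}(\mathcal A)$ is the set of individual names in $\mathcal A$. A temporal $\Sigma$-data instance is a finite sequence $\mathcal D=\mathcal A_0,\dots,\mathcal A_n$ of $\Sigma$-data instances, with $\mathcal A_\ell=\emptyset$ for $\ell>n$; $\mathrm{ind}(\mathcal D)=\bigcup_{i=0}^n\mathrm{ind}(\mathcal A_i)$ and $|\mathcal D|=\sum_i|\mathcal A_i|$. **Queries.** $\mathcal{ELI}$-queries are built from $\top$ and unary symbols using $\wedge$ and $\exists S.r$, where $S$ is $P$ or $P^-$ for a binary symbol $P$; $\mathcal{EL}$-queries are those without inverses $P^-$. For $\mathcal L\in\{\mathcal{EL},\mathcal{ELI}\}$, $\mathcal Q_p^\Sigma[\mathsf U](\mathcal L)$ is the class of queries $$q=r_0\wedge(l_1\mathbin{\mathsf U}(r_1\wedge(l_2\mathbin{\mathsf U}(\dots(l_n\mathbin{\mathsf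 U}r_n)\dots)))),$$ where each $r_i$ is an $\mathcal L$-query and each $l_i$ is an $\mathcal L$-query or $\bot$, with all predicate symbols in $\Sigma$. Truth: $\mathcal D,a,\ell\models A$ iff $A(a)\in\mathcal A_\ell$; $\mathcal D,a,\ell\models\exists S.r$ iff there is $b\in\mathrm{ind}(\mathcal A_\ell)$ with $S(a,b)\in\mathcal A_\ell$ and $\mathcal D,b,\ell\models r$; $\mathcal D,a,\ell\models q_1\mathbin{\mathsf U}q_2$ iff there is $m>\ell$ with $\mathcal D,a,m\models q_2$ and $\mathcal D,a,k\models q_1$ for all $k$ with $\ell<k<m$; $\top$ is always true, $\bot$ is never true, and $\wedge$ is as usual. We write $q\models q'$ if $\mathcal D,a,\ell\models q$ implies $\mathcal D,a,\ell\models q'$ for all $\mathcal D,a,\ell$; $\equiv$ is mutual entailment. $|q|$ is the number of symbols in $q$. The class $\mathcal P^\Sigma[\mathsf U](\mathcal L)$ of peerless queries consists of those queries in $\mathcal Q_p^\Sigma[\mathsf U](\mathcal L)$ of the displayed form such that, for each $i\in\{1,\dots,n\}$, either $l_i=\bot$, or $l_i\not\models r_i$ and $r_i\not\models l_i$. **Characterisability.** An example set is a pair $E=(E^+,E^-)$ of finite sets of pointed temporal $\Sigma$-data instances $(\mathcal D,a)$ with $a\in\mathrm{ind}(\mathcal D)$; $|E|$ is the sum of the $|\mathcal D|$ over all its members. A query $q$ fits $E$ if $\mathcal D,a,0\models q$ for all $(\mathcal D,a)\in E^+$ and $\mathcal D,a,0\not\models q$ for all $(\mathcal D,a)\in E^-$.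 $E$ uniquely characterises $q$ within a class $\mathcal Q$ if $q$ fits $E$ and $q\equiv q'$ for all $q'\in\mathcal Q$ that fit $E$. A class $\mathcal Q$ is polynomially (exponentially) characterisable within $\mathcal Q'\supseteq\mathcal Q$ if there is a polynomial $f$ such that every $q\in\mathcal Q$ is uniquely characterised within $\mathcal Q'$ by some $E$ with $|E|\le f(|q|)$ (respectively, $|E|\le 2^{f(|q|)}$).
   Formalization: The claim that the ELI class is not polynomially characterisable is stated only for signatures with at least one binary symbol; with unary symbols only, ELI and EL queries coincide, so the literal claim contradicts the first clause. -}

module Defs where

open import Level using (0ℓ)
open import Data.Nat using (ℕ; zero; suc; _+_; _*_; _^_; _≤_; _<_)
open import Data.Fin using (Fin)
open import Data.List using (List; []; _∷_; length; map; sum; concatMap; foldr; _++_)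
open import Data.List.NonEmpty using (List⁺; toList)
open import Data.List.Membership.Propositional using (_∈_)
open import Data.List.Relation.Unary.All using (All)
open import Data.Product using (_×_; ∃-syntax)
open import Data.Unit using (⊤)
open import Data.Empty using (⊥)
open import Relation.Nullary using (¬_)
open import Relation.Unary using (Pred; U)

-- A finite nonempty set of unary and binary predicate symbols, the symbols
-- of each arity being named by the elements of a Fin.
record Signature : Set where
  field
    #unary   : ℕ
    #binary  : ℕ
    nonempty : 0 < #unary + #binary

  Unary : Set
  Unary = Fin #unary

  Binary : Set
  Binary = Fin #binary

open Signature public

Individual : Set
Individual = ℕ

data Fact (S : Signature) : Set where
  unary  : Unary S → Individual → Fact S
  binary : Binary S → Individual → Individual → Fact S

-- Finite sets (of facts, and of examples further below) are represented by
-- lists.  Only membership matters for truth and fitting.  Sizes count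
-- repetitions, but they are only ever bounded from above, for example sets
-- under an existential quantifier; repetition-free lists give the actual
-- cardinalities.
DataInstance : Signature → Set
DataInstance S = List (Fact S)

TemporalInstance : Signature → Set
TemporalInstance S = List⁺ (DataInstance S)

private
  variable
    S : Signature

at : List (DataInstance S) → ℕ → DataInstance S
at []       _       = []
at (A ∷ _)  zero    = A
at (_ ∷ As) (suc ℓ) = at As ℓ

_at-time_ : TemporalInstance S → ℕ → DataInstance S
D at-time ℓ = at (toList D) ℓ

factInd : Fact S → List Individual
factInd (unary _ a)    = a ∷ []
factInd (binary _ a b) = a ∷ b ∷ []

ind : DataInstance S → List Individual
ind = concatMap factInd

indT : TemporalInstance S → List Individual
indT D = concatMap ind (toList D)

sizeT : TemporalInstance S → ℕ
sizeT D = sum (map length (toList D))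

data Language : Set where
  EL ELI : Language

data Role (S : Signature) : Language → Set where
  name : ∀ {L} → Binary S → Role S L
  inv  : Binary S → Role S ELI

roleFact : ∀ {L} → Role S L → Individual → Individual → Fact S
roleFact (name P) a b = binary P a b
roleFact (inv P)  a b = binary P b a

infixr 6 _∧ᶜ_

data Concept (S : Signature) (L : Language) : Set where
  ⊤ᶜ   : Concept S L
  atom : Unary S → Concept S L
  _∧ᶜ_ : Concept S L → Concept S L → Concept S L
  ∃ᶜ   : Role S L → Concept S L → Concept S L

-- The left-hand side of an until: a concept or ⊥.
data Guard (S : Signature) (L : Language) : Set where
  ⊥ᵍ : Guard S L
  ⌜_⌝ : Concept S L → Guard S L

-- core r           is  r
-- until r l q      is  r ∧ (l U q)
data Query (S : Signature) (L : Language) : Set where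
  core  : Concept S L → Query S L
  until : Concept S L → Guard S L → Query S L → Query S L

private
  variable
    L : Language

-- D , a , ℓ ⊨ q  is written  query⊨ q D a ℓ, and similarly for the parts of q.
Truth : Signature → Set₁
Truth S = TemporalInstance S → Individual → ℕ → Set

concept⊨ : Concept S L → Truth S
concept⊨ ⊤ᶜ         D a ℓ = ⊤
concept⊨ (atom A)   D a ℓ = unary A a ∈ D at-time ℓ
concept⊨ (r ∧ᶜ r′)  D a ℓ = concept⊨ r D a ℓ × concept⊨ r′ D a ℓ
concept⊨ (∃ᶜ R r)   D a ℓ = ∃[ b ]
  (b ∈ ind (D at-time ℓ) × roleFact R a b ∈ D at-time ℓ × concept⊨ r D b ℓ)

guard⊨ : Guard S L → Truth S
guard⊨ ⊥ᵍ    D a ℓ = ⊥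
guard⊨ ⌜ r ⌝ D a ℓ = concept⊨ r D a ℓ

query⊨ : Query S L → Truth S
query⊨ (core r)      D a ℓ = concept⊨ r D a ℓ
query⊨ (until r l q) D a ℓ = concept⊨ r D a ℓ ×
  ∃[ m ] (ℓ < m × query⊨ q D a m × (∀ k → ℓ < k → k < m → guard⊨ l D a k))

infix 4 _⊨_ _≣_

_⊨_ : Query S L → Query S L → Set
q ⊨ q′ = ∀ D a ℓ → query⊨ q D a ℓ → query⊨ q′ D a ℓ

_≣_ : Query S L → Query S L → Set
q ≣ q′ = q ⊨ q′ × q′ ⊨ q

-- The number of symbols, parentheses not counted; ∃P and ∃P⁻ are two symbols.
conceptSize : Concept S L → ℕ
conceptSize ⊤ᶜ        = 1
conceptSize (atom _)  = 1
conceptSize (r ∧ᶜ r′) = 1 + conceptSize r + conceptSize r′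
conceptSize (∃ᶜ _ r)  = 2 + conceptSize r

guardSize : Guard S L → ℕ
guardSize ⊥ᵍ    = 1
guardSize ⌜ r ⌝ = conceptSize r

querySize : Query S L → ℕ
querySize (core r)      = conceptSize r
querySize (until r l q) = 2 + conceptSize r + guardSize l + querySize q

QueryClass : Signature → Language → Set₁
QueryClass S L = Pred (Query S L) 0ℓ

𝒬 : ∀ S L → QueryClass S L
𝒬 S L = U

-- The first conjunct: the r_i of a tail  r_i ∧ (l_{i+1} U …).
first : Query S L → Concept S L
first (core r)      = r
first (until r _ _) = r

PeerlessStep : Guard S L → Concept S L → Set
PeerlessStep ⊥ᵍ    r = ⊤
PeerlessStep ⌜ l ⌝ r = ¬ (core l ⊨ core r) × ¬ (core r ⊨ core l)

𝒫 : ∀ S L → QueryClass S L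
𝒫 S L (core _)      = ⊤
𝒫 S L (until _ l q) = PeerlessStep l (first q) × 𝒫 S L q

record Example (S : Signature) : Set where
  constructor example
  field
    instance-of : TemporalInstance S
    point       : Individual
    point∈      : point ∈ indT instance-of

open Example public

record ExampleSet (S : Signature) : Set where
  constructor examples
  field
    positive : List (Example S)
    negative : List (Example S)

open ExampleSet public

∣_∣ᴱ : ExampleSet S → ℕ
∣ E ∣ᴱ = sum (map (λ e → sizeT (instance-of e)) (positive E ++ negative E))

Satisfies : Query S L → Example S → Set
Satisfies q e = query⊨ q (instance-of e) (point e) 0

Fits : Query S L → ExampleSet S → Set
Fits q E = All (Satisfies q) (positive E) × All (λ e → ¬ Satisfies q e) (negative E)

UniquelyCharacterises : ExampleSet S → Query S L → QueryClass S L → Set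
UniquelyCharacterises E q Q = Fits q E × (∀ q′ → Q q′ → Fits q′ E → q ≣ q′)

-- Polynomials are lists of coefficients, constant term first.  Natural
-- coefficients suffice for upper bounds on ℕ.
Polynomial : Set
Polynomial = List ℕ

eval : Polynomial → ℕ → ℕ
eval cs x = foldr (λ c acc → c + x * acc) 0 cs

CharacterisableWithSize : (ℕ → ℕ) → QueryClass S L → QueryClass S L → Set
CharacterisableWithSize {S} bound Q Q′ =
  ∀ q → Q q → ∃[ E ] (UniquelyCharacterises {S} E q Q′ × ∣ E ∣ᴱ ≤ bound (querySize q))

PolynomiallyCharacterisable : QueryClass S L → QueryClass S L → Set
PolynomiallyCharacterisable Q Q′ =
  ∃[ f ] CharacterisableWithSize (eval f) Q Q′

ExponentiallyCharacterisable : QueryClass S L → QueryClass S L → Set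
ExponentiallyCharacterisable Q Q′ =
  ∃[ f ] CharacterisableWithSize (λ n → 2 ^ eval f n) Q Q′

-- Without binary symbols there are no roles, so the ELI-queries are exactly
-- the EL-queries and the two languages can only be separated over
-- signatures with at least one binary symbol.
HasBinary : Signature → Set
HasBinary S = 0 < #binary S

-- The examples are words of pointed data instances.  The words r₀ r₁ … rₙ, ⊤ⁿ
-- (all letters satisfying everything) and ⊤ⁱ F ⊤ⁿ⁻ⁱ with F in a split partner of
-- rᵢ force a fitting query q′ to have the length and, up to equivalence, the
-- cores rᵢ of q.  Peerlessness makes q deterministic on r₀ … rᵢ₋₁, so words
-- r₀ … rᵢ₋₁ F rᵢ … rₙ with F in a split partner of {lᵢ , rᵢ} show that each guard
-- lᵢ′ ≢ ⊥ of q′ entails lᵢ or rᵢ.  If it entails rᵢ but not lᵢ, further words of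
-- this kind show that lᵢ′ is as good as ⊥, and the single word
-- r₀ l₁ r₁ l₂ r₂ … lₙ rₙ shows that the remaining differences between q and q′
-- are shifts of the form  ρ U (ρ ∧ ○Q) ≡ ○(ρ ∧ (ρ U Q)).  Split partners have
-- polynomial size for EL and exponential size for ELI.
--
-- Conversely, the negative examples for ○r must contain, for every l that
-- does not entail r, one that satisfies l U r, hence one with l and not r at
-- time 1.  There are polynomial ELI-concepts r and a (large) l such that every
-- model of l and not r has 2ⁿ elements.

module Submission where

open import Defs
open import Data.Bool using (Bool; true; false; if_then_else_; T; T?)
open import Data.Empty using (⊥; ⊥-elim)
open import Data.Fin as Fin using (Fin; toℕ)
import Data.Fin.Properties as Fin
open import Data.List
  using (List; []; _∷_; _++_; map; concatMap; replicate; length; upTo; filter; cartesianProduct; allFin; lookup)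
open import Data.List.NonEmpty using (toList) renaming (_∷_ to _∷⁺_)
open import Data.List.Properties
  using (++-assoc; length-map; length-++; length-replicate; length-filter; length-tabulate; map-∘)
import Data.List.Membership.DecPropositional as DecMembership
open import Data.List.Membership.Propositional
open import Data.List.Membership.Propositional.Properties
open import Data.List.Relation.Unary.All as All using (All; []; _∷_)
import Data.List.Relation.Unary.All.Properties as All
open import Data.List.Relation.Unary.Any as Any using (Any; here; there)
import Data.List.Relation.Unary.Any.Properties as Any
open import Data.Maybe using (Maybe; just; nothing)
open import Data.Nat
open import Data.Nat.ListAction using (sum)
open import Data.Nat.Properties
open import Data.Nat.Solver using (module +-*-Solver)
open import Data.Product using (_×_; _,_; proj₁; proj₂; ∃-syntax)
open import Data.Sum using (_⊎_; inj₁; inj₂; [_,_]′)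
open import Data.Unit using (⊤; tt)
open import Function using (_∘_; id; case_of_)
open import Relation.Binary.Definitions using (DecidableEquality)
open import Relation.Binary.PropositionalEquality
open import Relation.Nullary
open import Relation.Nullary.Decidable
  using (_×-dec_; _⊎-dec_; _→-dec_; ¬?; map′; ⌊_⌋; toWitness; fromWitness; decidable-stable)

-- The temporal argument sees concepts only through this interface, so it is carried out once for
-- both languages; they differ only in how split partners are built. A split partner of a pair is
-- obtained from partners of its two members as a product, because a point of a product satisfies a
-- concept iff both coordinates do. No test is labelled by hand: truth on a word is decidable, so q
-- itself sorts the tests, and a fitting query has to agree with q on each of them. The delicate
-- rival guard c lies below the core r but not below the guard l. It is harmless if r ∧ ○s ⊨ s for
-- the rest s of q, because then c U (r ∧ ○s) already gives r ∧ ○s at the first position. A failure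
-- of this law yields a test, and pumping keeps that test short. In the lower bound, inverse roles
-- express the negation of a tag positively: a successor that has predecessors for all tags but one
-- turns into a witness of r as soon as the predecessor it was reached from carries the missing tag.

-- The letters stand for pointed data instances; dual a b is a split partner
-- of {a , b}.
record Alphabet : Set₁ where
  infix 4 _⊩_
  field
    C Letter      : Set
    _⊩_           : Letter → C → Set
    _⊩?_          : ∀ x c → Dec (x ⊩ c)
    can           : C → Letter
    can-⊩         : ∀ c → can c ⊩ c
    can-least     : ∀ {c d x} → x ⊩ c → can c ⊩ d → x ⊩ d
    ε             : Letter
    ε-least       : ∀ {c x} → ε ⊩ c → x ⊩ c
    full          : Letter
    full-⊩        : ∀ c → full ⊩ c
    nontrivial    : ∃[ c ] ¬ ε ⊩ c
    dual          : C → C → List Letter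
    dual-⊮ˡ       : ∀ {a b x} → x ∈ dual a b → ¬ x ⊩ a
    dual-⊮ʳ       : ∀ {a b x} → x ∈ dual a b → ¬ x ⊩ b
    dual-complete : ∀ {a b c} → ¬ can c ⊩ a → ¬ can c ⊩ b → ∃[ x ] (x ∈ dual a b × x ⊩ c)

-- Temporal queries read on words of letters.

module Temporal (𝔸 : Alphabet) where
  open Alphabet 𝔸

  infix 4 _≤ᶜ_ _⊩ᵍ_ _⊑_

  _≤ᶜ_ : C → C → Set
  c ≤ᶜ d = can c ⊩ d

  ≤ᶜ-refl : ∀ {c} → c ≤ᶜ c
  ≤ᶜ-refl = can-⊩ _

  ≤ᶜ-trans : ∀ {a b c} → a ≤ᶜ b → b ≤ᶜ c → a ≤ᶜ c
  ≤ᶜ-trans p q = can-least p q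

  -- The guard ⊥ is nothing.
  _⊩ᵍ_ : Letter → Maybe C → Set
  x ⊩ᵍ nothing = ⊥
  x ⊩ᵍ just c  = x ⊩ c

  _⊩ᵍ?_ : ∀ x g → Dec (x ⊩ᵍ g)
  x ⊩ᵍ? nothing = no λ ()
  x ⊩ᵍ? just c  = x ⊩? c

  _≤ᵍ_ : C → Maybe C → Set
  c ≤ᵍ g = can c ⊩ᵍ g

  ≤ᵍ-⊩ : ∀ {c x} g → x ⊩ c → c ≤ᵍ g → x ⊩ᵍ g
  ≤ᵍ-⊩ (just d) p q = can-least p q

  Step Word : Set
  Step = Maybe C × C
  Word = List Letter

  -- A word stands for its continuation by ε forever.
  hd : Word → Letter
  hd []      = ε
  hd (x ∷ _) = x

  tl : Word → Word
  tl []      = []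
  tl (_ ∷ w) = w

  -- The word starts at the first time point strictly after the current one. All suffixes of the
  -- empty word are empty, so there the target has to hold at once and the guard is no longer
  -- consulted.
  Until : Maybe C → (Word → Set) → Word → Set
  Until l Q []      = Q []
  Until l Q (y ∷ w) = Q (y ∷ w) ⊎ (y ⊩ᵍ l × Until l Q w)

  Tail : List Step → Word → Set
  Next : C → List Step → Word → Set
  Tail []            w = ⊤
  Tail ((l , r) ∷ s) w = Until l (Next r s) w
  Next r s w = hd w ⊩ r × Tail s (tl w)

  until? : ∀ l {Q} → (∀ w → Dec (Q w)) → ∀ w → Dec (Until l Q w)
  until? l Q? []      = Q? []
  until? l Q? (y ∷ w) = Q? (y ∷ w) ⊎-dec (y ⊩ᵍ? l ×-dec until? l Q? w)

  tail? : ∀ s w → Dec (Tail s w)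
  next? : ∀ r s w → Dec (Next r s w)
  tail? []            w = yes tt
  tail? ((l , r) ∷ s) w = until? l (next? r s) w
  next? r s w = hd w ⊩? r ×-dec tail? s (tl w)

  until-map : ∀ {l l′ Q Q′} → (∀ {x} → x ⊩ᵍ l → x ⊩ᵍ l′) → (∀ w → Q w → Q′ w) →
              ∀ w → Until l Q w → Until l′ Q′ w
  until-map f g []      p              = g [] p
  until-map f g (y ∷ w) (inj₁ p)       = inj₁ (g _ p)
  until-map f g (y ∷ w) (inj₂ (p , q)) = inj₂ (f p , until-map f g w q)

  until-now : ∀ {l Q} w → Q w → Until l Q w
  until-now []      p = p
  until-now (y ∷ w) p = inj₁ p

  until-next : ∀ {Q} w → Until nothing Q w → Q w
  until-next []      p        = p
  until-next (y ∷ w) (inj₁ p) = p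

  _⊑_ : Word → Word → Set
  []      ⊑ w = ⊤
  (x ∷ v) ⊑ w = (∀ c → x ⊩ c → hd w ⊩ c) × v ⊑ tl w

  ⊑-hd : ∀ {c} v w → v ⊑ w → hd v ⊩ c → hd w ⊩ c
  ⊑-hd []      w v⊑w p = ε-least p
  ⊑-hd (x ∷ v) w v⊑w p = v⊑w .proj₁ _ p

  ⊑-tl : ∀ v w → v ⊑ w → tl v ⊑ tl w
  ⊑-tl []      w v⊑w = tt
  ⊑-tl (x ∷ v) w v⊑w = v⊑w .proj₂

  ⊩ᵍ-mono : ∀ {x y} l → (∀ c → x ⊩ c → y ⊩ c) → x ⊩ᵍ l → y ⊩ᵍ l
  ⊩ᵍ-mono (just l) f p = f l p

  until-mono : ∀ {l Q} → (∀ v w → v ⊑ w → Q v → Q w) → ∀ v w → v ⊑ w → Until l Q v → Until l Q w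
  until-mono Q-mono [] w v⊑w p = until-now w (Q-mono [] w v⊑w p)
  until-mono Q-mono (x ∷ v) w v⊑w (inj₁ p) = until-now w (Q-mono (x ∷ v) w v⊑w p)
  until-mono Q-mono (x ∷ v) [] v⊑w (inj₂ (_ , q)) = until-mono Q-mono v [] (v⊑w .proj₂) q
  until-mono {l} Q-mono (x ∷ v) (y ∷ w) (x≤y , v⊑w) (inj₂ (p , q)) =
    inj₂ (⊩ᵍ-mono l x≤y p , until-mono Q-mono v w v⊑w q)

  tail-mono : ∀ s v w → v ⊑ w → Tail s v → Tail s w
  next-mono : ∀ r s v w → v ⊑ w → Next r s v → Next r s w
  tail-mono []            v w v⊑w p = tt
  tail-mono ((l , r) ∷ s) v w v⊑w p = until-mono (next-mono r s) v w v⊑w p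
  next-mono r s v w v⊑w (p , q) = ⊑-hd v w v⊑w p , tail-mono s (tl v) (tl w) (⊑-tl v w v⊑w) q

  -- Canonical words of a tail, and pumping.

  data Canon : List Step → Word → Set where
    []    : Canon [] []
    next  : ∀ {r s v} → Canon s v → Canon ((nothing , r) ∷ s) (can r ∷ v)
    block : ∀ {l r s v} k → Canon s v → Canon ((just l , r) ∷ s) (replicate k (can l) ++ can r ∷ v)

  until-canon : ∀ {l r s} → (∀ w → Tail s w → ∃[ v ] (Canon s v × v ⊑ w)) →
                ∀ w → Until l (Next r s) w → ∃[ v ] (Canon ((l , r) ∷ s) v × v ⊑ w)
  now-canon : ∀ {r s} l → (∀ w → Tail s w → ∃[ v ] (Canon s v × v ⊑ w)) →
                ∀ w → Next r s w → ∃[ v ] (Canon ((l , r) ∷ s) v × v ⊑ w)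
  now-canon nothing  f w (p , q) with f (tl w) q
  ... | v , cv , v⊑w = _ , next cv , (λ c → can-least p) , v⊑w
  now-canon (just l) f w (p , q) with f (tl w) q
  ... | v , cv , v⊑w = _ , block 0 cv , (λ c → can-least p) , v⊑w
  until-canon {l}      f []      p        = now-canon l f [] p
  until-canon {l}      f (y ∷ w) (inj₁ p) = now-canon l f (y ∷ w) p
  until-canon {just l} f (y ∷ w) (inj₂ (p , q)) with until-canon f w q
  ... | _ , block k cv , v⊑w = _ , block (suc k) cv , (λ c → can-least p) , v⊑w

  -- In an accepting run, each letter is replaced by the canonical letter of the guard that skips it
  -- or of the core that reads it. By monotonicity, whatever `s` entails can therefore be checked on
  -- canonical words alone.
  tail-canon : ∀ s w → Tail s w → ∃[ v ] (Canon s v × v ⊑ w)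
  tail-canon []            w p = [] , [] , tt
  tail-canon ((l , r) ∷ s) w p = until-canon (tail-canon s) w p

  -- Every letter read uses up a step. With fewer steps than letters, either `s` is exhausted inside
  -- the block or a guard skips one of its letters, and that letter may be repeated.
  pump-block : ∀ s K x β → length s < K → Tail s (replicate K x ++ β) → Tail s (replicate (suc K) x ++ β)
  pump-block []      K       x β lt p = tt
  pump-block (_ ∷ s) (suc K) x β (s≤s lt) (inj₁ (p , q)) = inj₁ (p , pump-block s K x β lt q)
  pump-block (_ ∷ s) (suc K) x β lt       (inj₂ (p , q)) = inj₂ (p , inj₂ (p , q))

  pump : ∀ s α K x β → length s < K → Tail s (α ++ replicate K x ++ β) → Tail s (α ++ replicate (suc K) x ++ β)
  pump []      α       K x β lt p = tt
  pump (st ∷ s) []     K x β lt p = pump-block (st ∷ s) K x β lt p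
  pump (_ ∷ s) (y ∷ α) K x β lt (inj₁ (p , q)) = inj₁ (p , pump s α K x β (<-trans (n<1+n _) lt) q)
  pump (st ∷ s) (y ∷ α) K x β lt (inj₂ (p , q)) = inj₂ (p , pump (st ∷ s) α K x β lt q)

  pump⁺ : ∀ s α K x β → length s < K → ∀ j → Tail s (α ++ replicate K x ++ β) →
          Tail s (α ++ replicate (j + K) x ++ β)
  pump⁺ s α K x β lt zero    p = p
  pump⁺ s α K x β lt (suc j) p =
    pump s α (j + K) x β (≤-trans lt (m≤n+m K j)) (pump⁺ s α K x β lt j p)

  canons : ℕ → List Step → List Word
  canons K []                   = [] ∷ []
  canons K ((nothing , r) ∷ s) = map (can r ∷_) (canons K s)
  canons K ((just l , r) ∷ s)  =
    concatMap (λ k → map (λ v → replicate k (can l) ++ can r ∷ v) (canons K s)) (upTo (suc K))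

  canons-block : ∀ {K l r s v k} → k ≤ K → v ∈ canons K s →
                 replicate k (can l) ++ can r ∷ v ∈ canons K ((just l , r) ∷ s)
  canons-block {K} {l} {r} {s} {v} {k} k≤K v∈ =
    ∈-concatMap⁺ (λ k → map (λ v → replicate k (can l) ++ can r ∷ v) (canons K s))
      (lose (∈-upTo⁺ (s≤s k≤K)) (∈-map⁺ (λ v → replicate k (can l) ++ can r ∷ v) v∈))

  -- Blocks are settled from left to right. A block of any length is obtained from one of length at
  -- most `K` by pumping and then becomes part of the prefix `α`.
  bounded-suffices : ∀ s₀ K → length s₀ < K → ∀ s α →
    (∀ {v} → v ∈ canons K s → Tail s₀ (α ++ v)) → ∀ {v} → Canon s v → Tail s₀ (α ++ v)
  bounded-suffices s₀ K lt [] α h [] = h (here refl)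
  bounded-suffices s₀ K lt ((nothing , r) ∷ s) α h (next {v = v} cv) =
    subst (Tail s₀) (++-assoc α (can r ∷ []) v)
      (bounded-suffices s₀ K lt s (α ++ can r ∷ [])
        (λ {v} v∈ → subst (Tail s₀) (sym (++-assoc α (can r ∷ []) v)) (h (∈-map⁺ (can r ∷_) v∈))) cv)
  bounded-suffices s₀ K lt ((just l , r) ∷ s) α h (block {v = v} k cv) =
    subst (Tail s₀) (shift v) (bounded-suffices s₀ K lt s (α ++ replicate k (can l) ++ can r ∷ [])
        (λ {v} v∈ → subst (Tail s₀) (sym (shift v)) (blocks v v∈ k)) cv)
    where
    shift : ∀ v → (α ++ replicate k (can l) ++ can r ∷ []) ++ v ≡ α ++ replicate k (can l) ++ can r ∷ v
    shift v = trans (++-assoc α _ v) (cong (α ++_) (++-assoc (replicate k (can l)) _ v))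
    blocks : ∀ v → v ∈ canons K s → ∀ k → Tail s₀ (α ++ replicate k (can l) ++ can r ∷ v)
    blocks v v∈ k with k ≤? K
    ... | yes k≤K = h (canons-block {s = s} k≤K v∈)
    ... | no k≰K = subst (λ k → Tail s₀ (α ++ replicate k (can l) ++ can r ∷ v))
                     (m∸n+n≡m (<⇒≤ (≰⇒> k≰K)))
                     (pump⁺ s₀ α K (can l) _ lt (k ∸ K) (h (canons-block {s = s} ≤-refl v∈)))

  -- The law r ∧ ○s ⊨ s. Under it, a guard below `r` in front of the step `r` behaves like ⊥.
  Absorbs : C → List Step → Set
  Absorbs r s = ∀ w → Next r s w → Tail s w

  -- Decided by a finite search: in a longer block some letter is skipped, so
  -- the block can be pumped.
  NonAbsorbing : C → List Step → Word → Set
  NonAbsorbing r s v = ¬ Tail s (can r ∷ v)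

  absorbs? : ∀ r s → Absorbs r s ⊎ ∃[ v ] (v ∈ canons (suc (length s)) s × NonAbsorbing r s v)
  absorbs? r s with Any.any? (λ v → ¬? (tail? s (can r ∷ v))) (canons (suc (length s)) s)
  ... | yes p = inj₂ (find p)
  ... | no ¬p = inj₁ absorb
    where
    absorb : Absorbs r s
    absorb w (p , q) with tail-canon s (tl w) q
    ... | v , cv , v⊑w = tail-mono s (can r ∷ v) w ((λ c → can-least p) , v⊑w)
      (bounded-suffices s (suc (length s)) (n<1+n _) s (can r ∷ [])
        (λ {v} v∈ → decidable-stable (tail? s (can r ∷ v)) λ ¬t → ¬p (lose v∈ ¬t)) cv)

  -- Tests for the guards.

  -- Every letter refutes ⊥; `full` alone is complete because it satisfies all concepts.
  dual¹ : Maybe C → List Letter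
  dual¹ nothing  = full ∷ []
  dual¹ (just l) = dual l l

  dual¹-⊮ : ∀ {x} l → x ∈ dual¹ l → ¬ x ⊩ᵍ l
  dual¹-⊮ (just l) x∈ = dual-⊮ˡ x∈

  dual¹-complete : ∀ {c} l → ¬ c ≤ᵍ l → ∃[ x ] (x ∈ dual¹ l × x ⊩ c)
  dual¹-complete nothing  n = full , here refl , full-⊩ _
  dual¹-complete (just l) n = dual-complete n n

  dual² : Maybe C → C → List Letter
  dual² nothing  r = dual r r
  dual² (just l) r = dual l r

  dual²-⊮ˡ : ∀ {r x} l → x ∈ dual² l r → ¬ x ⊩ᵍ l
  dual²-⊮ˡ nothing  x∈ = λ ()
  dual²-⊮ˡ (just l) x∈ = dual-⊮ˡ x∈

  dual²-⊮ʳ : ∀ {r x} l → x ∈ dual² l r → ¬ x ⊩ r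
  dual²-⊮ʳ nothing  x∈ = dual-⊮ˡ x∈
  dual²-⊮ʳ (just l) x∈ = dual-⊮ʳ x∈

  dual²-complete : ∀ {c r} l → ¬ c ≤ᵍ l → ¬ c ≤ᶜ r → ∃[ x ] (x ∈ dual² l r × x ⊩ c)
  dual²-complete nothing  m n = dual-complete n n
  dual²-complete (just l) m n = dual-complete m n

  cans : List Step → Word
  cans = map (can ∘ proj₂)

  -- l₁ r₁ l₂ r₂ …, the guards ⊥ omitted
  alternating : List Step → Word
  alternating []                   = []
  alternating ((nothing , r) ∷ s) = can r ∷ alternating s
  alternating ((just l , r) ∷ s)  = can l ∷ can r ∷ alternating s

  absorptionTests : Maybe C → C → List Step → List Word
  absorptionTests l r s with absorbs? r s
  ... | inj₁ _       = []
  ... | inj₂ (v , _) = map (λ x → x ∷ can r ∷ v) (dual¹ l)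

  separationTests : Maybe C → C → List Step → List Word
  separationTests l r s = map (λ x → x ∷ can r ∷ cans s) (dual² l r ++ dual¹ l)

  guardTests : List Step → List Word
  guardTests []            = []
  guardTests ((l , r) ∷ s) =
    separationTests l r s ++ absorptionTests l r s ++ map (can r ∷_) (guardTests s)

  Peer : Maybe C → C → Set
  Peer nothing  r = ⊤
  Peer (just l) r = ¬ l ≤ᶜ r × ¬ r ≤ᶜ l

  Peerless : List Step → Set
  Peerless = All (λ (l , r) → Peer l r)

  peer-≰ : ∀ {r} l → Peer l r → ¬ r ≤ᵍ l
  peer-≰ (just l) (_ , n) = n

  -- Two tails that differ in the guards only.
  Paired : Set
  Paired = List (Maybe C × Maybe C × C)

  left right : Paired → List Step
  left  = map λ (l , l′ , r) → l , r
  right = map λ (l , l′ , r) → l′ , r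

  PassesTests : Paired → Set
  PassesTests Z = ∀ {w} → w ∈ guardTests (left Z) → Tail (right Z) w → Tail (left Z) w

  Equivalent : Paired → Set
  Equivalent Z = ∀ w → (Tail (left Z) w → Tail (right Z) w) × (Tail (right Z) w → Tail (left Z) w)

  -- The right tail is free to read `can r` first, so it accepts the prefixed test; the left tail is
  -- forced to read it, as its guard cannot skip `can r`.
  passes-tail : ∀ {l l′ r Z} → Peer l r → PassesTests ((l , l′ , r) ∷ Z) → PassesTests Z
  passes-tail {l} {l′} {r} {Z} peer ok w∈ p
    with ok (∈-++⁺ʳ (separationTests l r (left Z)) (∈-++⁺ʳ (absorptionTests l r (left Z)) (∈-map⁺ (can r ∷_) w∈)))
            (inj₁ (can-⊩ r , p))
  ... | inj₁ (_ , q)   = q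
  ... | inj₂ (r≤l , _) = ⊥-elim (peer-≰ l peer r≤l)

  right-cans : ∀ Z → Tail (right Z) (cans (left Z))
  right-cans []                = tt
  right-cans ((l , l′ , r) ∷ Z) = inj₁ (can-⊩ r , right-cans Z)

  -- What acceptance of `cans s` with an extra letter `x` in front requires: every core is read as
  -- the next one, x ≤ r₁ ≤ r₂ ≤ ..., until a guard skips a letter and absorbs the surplus.
  Chain : C → List Step → Set
  Chain x []            = ⊤
  Chain x ((l , r) ∷ s) = x ≤ᵍ l ⊎ (x ≤ᶜ r × Chain r s)

  tail-chain : ∀ x s → Tail s (can x ∷ cans s) → Chain x s
  tail-chain x []            p              = tt
  tail-chain x ((l , r) ∷ s) (inj₁ (p , q)) = inj₂ (p , tail-chain r s q)
  tail-chain x ((l , r) ∷ s) (inj₂ (p , q)) = inj₁ p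

  chain-≤ : ∀ {x y} s → x ≤ᶜ y → Chain y s → Chain x s
  chain-≤ []            p c              = tt
  chain-≤ ((l , r) ∷ s) p (inj₁ y≤l)     = inj₁ (≤ᵍ-⊩ l p y≤l)
  chain-≤ ((l , r) ∷ s) p (inj₂ (q , c)) = inj₂ (≤ᶜ-trans p q , c)

  module _ {l r c} {Z : Paired} (ok : PassesTests ((l , just c , r) ∷ Z)) where

    -- Otherwise some letter of `dual² l r` satisfies `c`. The right tail skips it, whereas the left
    -- one can neither skip nor read it.
    guard-below : c ≤ᵍ l ⊎ c ≤ᶜ r
    guard-below with can c ⊩ᵍ? l | can c ⊩? r
    ... | yes p | _     = inj₁ p
    ... | no _  | yes p = inj₂ p
    ... | no m  | no n with dual²-complete l m n
    ...   | x , x∈ , x⊩c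
      with ok (∈-++⁺ˡ (∈-map⁺ (λ x → x ∷ can r ∷ cans (left Z)) (∈-++⁺ˡ x∈))) (inj₂ (x⊩c , inj₁ (can-⊩ r , right-cans Z)))
    ...     | inj₁ (p , _) = ⊥-elim (dual²-⊮ʳ l x∈ p)
    ...     | inj₂ (p , _) = ⊥-elim (dual²-⊮ˡ l x∈ p)

    -- A letter satisfying `c` but not `l` is skipped on the right. The left tail has to read it as
    -- `r`, and is then left with one letter `can r` too many.
    guard-chain : ¬ c ≤ᵍ l → Chain r (left Z)
    guard-chain n with dual¹-complete l n
    ... | x , x∈ , x⊩c
      with ok (∈-++⁺ˡ (∈-map⁺ (λ x → x ∷ can r ∷ cans (left Z)) (∈-++⁺ʳ (dual² l r) x∈)))
              (inj₂ (x⊩c , inj₁ (can-⊩ r , right-cans Z)))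
    ...   | inj₁ (_ , p) = tail-chain r (left Z) p
    ...   | inj₂ (p , _) = ⊥-elim (dual¹-⊮ l x∈ p)

    -- The letter is again one that only the right tail can skip, now followed by `can r` and a
    -- counterexample `v` to absorption. Having read the letter as `r`, the left tail would have to
    -- accept `can r ∷ v`, which `v` was chosen to prevent.
    guard-absorbs : ¬ c ≤ᵍ l → (∀ {v} → v ∈ canons (suc (length (left Z))) (left Z) → Tail (right Z) v) →
                    Absorbs r (left Z)
    guard-absorbs n accepts = absorb (λ {w} w∈ → ok (∈-++⁺ʳ (separationTests l r (left Z)) (∈-++⁺ˡ w∈)))
      where
      absorb : (∀ {w} → w ∈ absorptionTests l r (left Z) → Tail (right ((l , just c , r) ∷ Z)) w →
                Tail (left ((l , just c , r) ∷ Z)) w) →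
               Absorbs r (left Z)
      absorb ok′ with absorbs? r (left Z)
      ... | inj₁ a = a
      ... | inj₂ (v , v∈ , ¬q) with dual¹-complete l n
      ...   | x , x∈ , x⊩c
        with ok′ (∈-map⁺ (λ x → x ∷ can r ∷ v) x∈) (inj₂ (x⊩c , inj₁ (can-⊩ r , accepts v∈)))
      ...     | inj₁ (_ , q) = ⊥-elim (¬q q)
      ...     | inj₂ (p , _) = ⊥-elim (dual¹-⊮ l x∈ p)

  canons-accepted : ∀ K s {v} → v ∈ canons K s → Tail s v
  canons-accepted K [] v∈ = tt
  canons-accepted K ((nothing , r) ∷ s) v∈ with ∈-map⁻ (can r ∷_) v∈
  ... | v , v∈′ , refl = inj₁ (can-⊩ r , canons-accepted K s v∈′)
  canons-accepted K ((just l , r) ∷ s) v∈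
    with find (∈-concatMap⁻ (λ k → map (λ v → replicate k (can l) ++ can r ∷ v) (canons K s)) {xs = upTo (suc K)} v∈)
  ... | k , _ , v∈k with ∈-map⁻ (λ v → replicate k (can l) ++ can r ∷ v) v∈k
  ...   | v , v∈′ , refl = blocks k
    where
    blocks : ∀ k → Tail ((just l , r) ∷ s) (replicate k (can l) ++ can r ∷ v)
    blocks zero    = inj₁ (can-⊩ r , canons-accepted K s v∈′)
    blocks (suc k) = inj₂ (can-⊩ l , blocks k)

  -- Backwards from the position of the target: each skipped letter satisfies `r`, and absorption
  -- moves `s` one position to the left.
  absorb-until : ∀ {r c} s → Absorbs r s → c ≤ᶜ r → ∀ w → Until (just c) (Next r s) w → Next r s w
  absorb-until s a c≤r []      p              = p
  absorb-until s a c≤r (y ∷ w) (inj₁ p)       = p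
  absorb-until s a c≤r (y ∷ w) (inj₂ (p , q)) = can-least p c≤r , a w (absorb-until s a c≤r w q)

  -- The new target is the position just before that of `Q`; it satisfies `ρ` either as the starting
  -- point or as a skipped letter.
  shift-in : ∀ {ρ Q} w → hd w ⊩ ρ → Until (just ρ) Q (tl w) →
             Until (just ρ) (λ v → hd v ⊩ ρ × Q (tl v)) w
  shift-in []          p q              = p , q
  shift-in (y ∷ [])    p q              = inj₁ (p , q)
  shift-in (y ∷ z ∷ w) p (inj₁ q)       = inj₁ (p , q)
  shift-in (y ∷ z ∷ w) p (inj₂ (r , q)) = inj₂ (p , shift-in (z ∷ w) r q)

  shift-out : ∀ {ρ Q} w → Until (just ρ) (λ v → hd v ⊩ ρ × Until (just ρ) Q (tl v)) w →
              hd w ⊩ ρ × Until (just ρ) Q (tl w)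
  shift-out []      p              = p
  shift-out (y ∷ w) (inj₁ p)       = p
  shift-out (y ∷ w) (inj₂ (p , q)) = p , extend w (shift-out w q)
    where
    extend : ∀ {ρ Q} w → hd w ⊩ ρ × Until (just ρ) Q (tl w) → Until (just ρ) Q w
    extend []      (_ , q) = q
    extend (z ∷ w) (p , q) = inj₂ (p , q)

  -- Reading the word l₁ r₁ l₂ r₂ … from the left, the right query is either
  -- in step with the left one, or it lags behind: it has used a guard
  -- l′ ≡ r =: ρ to skip r and then, by guard-chain, every r up to the next
  -- guard l ≢ ⊥ is ≡ ρ, and so is that l, where both are in step again.  Such a
  -- lag is harmless because of  ρ ∧ (ρ U Q) ≡ ρ U (ρ ∧ ○Q)  (shift-in, shift-out).

  record InStep (l l′ : Maybe C) (r : C) (Z : Paired) : Set where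
    field
      enter : ∀ w → Next r (left Z) w → Until l′ (Next r (right Z)) w
      leave : ∀ w → Until l′ (Next r (right Z)) w → Until l (Next r (left Z)) w
      -- For `l` ≡ ⊥ the forward direction is `enter`. For a proper guard it needs `l` below `l′`,
      -- which is known once the right tail has skipped `can l`.
      match : ∀ {c} → l ≡ just c → c ≤ᵍ l′ → ∀ w → Until l (Next r (left Z)) w → Until l′ (Next r (right Z)) w

  open InStep

  -- The right side has a surplus guard `ρ`. The induction pushes it through the tail until a guard
  -- of the left tail takes it over or the tail ends.
  Shifted : C → Paired → Set
  Shifted ρ Z = ∀ w → (Next ρ (left Z) w → Until (just ρ) (Next ρ (right Z)) w) ×
                      (Until (just ρ) (Next ρ (right Z)) w → Next ρ (left Z) w)

  record Pending (ρ : C) (st : Step) : Set where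
    constructor pending
    field
      core-≤  : st .proj₂ ≤ᶜ ρ
      guard-≤ : ∀ {x} → x ⊩ᵍ st .proj₁ → x ⊩ ρ

  open Pending

  -- A nonempty queue of right steps that are overdue, in front of the steps `s` still shared with
  -- the left tail. At each further core the left tail hands over one step, so the queue grows if
  -- the right tail skips the letter and keeps its length if it reads it.
  record Lagging (ρ : C) (s : List Step) (w : Word) : Set where
    constructor lagging
    field
      {step}    : Step
      {steps}   : List Step
      pendings  : All (Pending ρ) (step ∷ steps)
      accepting : Tail (step ∷ steps ++ s) w

  push : ∀ {ρ P st s w} → All (Pending ρ) P → Pending ρ st → Tail (P ++ st ∷ s) w → Lagging ρ s w
  push []       o p = lagging (o ∷ []) p
  push {P = st ∷ P} {st′} {s} {w} (o′ ∷ os) o p =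
    lagging (o′ ∷ snoc os) (subst (λ s → Tail (st ∷ s) w) (sym (++-assoc P (st′ ∷ []) s)) p)
    where
    snoc : ∀ {P} → All (Pending _) P → All (Pending _) (P ++ st′ ∷ [])
    snoc []       = o ∷ []
    snoc (o ∷ os) = o ∷ snoc os

  -- Skipped or read, a letter met during the lag satisfies `ρ`. This is what places the letters of
  -- the alternating word below `ρ`.
  read : ∀ {ρ st x} s w → Pending ρ st → Tail (st ∷ s) (x ∷ w) → x ⊩ ρ × (Tail (st ∷ s) w ⊎ Tail s w)
  read s w o (inj₁ (p , q)) = can-least p (core-≤ o) , inj₂ q
  read s w o (inj₂ (p , q)) = guard-≤ o p , inj₁ q

  -- The three mutual inductions are steered by a single accepting run of the right tail on the
  -- alternating word: whether it skips or reads a letter decides which case applies.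
  equivalent : ∀ Z → Peerless (left Z) → PassesTests Z → Tail (right Z) (alternating (left Z)) → Equivalent Z

  in-step : ∀ {l l′ r} Z → Peer l r → Peerless (left Z) → PassesTests ((l , l′ , r) ∷ Z) →
            Tail (right ((l , l′ , r) ∷ Z)) (can r ∷ alternating (left Z)) → InStep l l′ r Z

  shifted : ∀ {ρ} Z → Peerless (left Z) → PassesTests Z → Chain ρ (left Z) →
            Lagging ρ (right Z) (alternating (left Z)) → Shifted ρ Z

  equivalent [] peers ok p w = id , id
  equivalent ((nothing , l′ , r) ∷ Z) (peer ∷ peers) ok p w =
    (λ q → enter i w (until-next w q)) , leave i w
    where i = in-step Z peer peers ok p
  equivalent ((just l , l′ , r) ∷ Z) (peer ∷ peers) ok (inj₁ (l≤r , _)) = ⊥-elim (peer .proj₁ l≤r)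
  equivalent ((just l , l′ , r) ∷ Z) (peer ∷ peers) ok (inj₂ (l≤l′ , p)) w = match i refl l≤l′ w , leave i w
    where i = in-step Z peer peers ok p

  in-step {l} {l′} {r} Z peer peers ok (inj₁ (_ , p)) = record
    { enter = λ w q → until-now w (to w q)
    ; leave = leaving l′ ok
    ; match = λ { refl l≤l′ → until-map (λ q → ≤ᵍ-⊩ l′ q l≤l′) to } }
    where
    eq = equivalent Z peers (passes-tail peer ok) p
    to : ∀ w → Next r (left Z) w → Next r (right Z) w
    to w (p , q) = p , eq (tl w) .proj₁ q
    from : ∀ w → Next r (right Z) w → Next r (left Z) w
    from w (p , q) = p , eq (tl w) .proj₂ q
    leaving : ∀ l′ → PassesTests ((l , l′ , r) ∷ Z) →
              ∀ w → Until l′ (Next r (right Z)) w → Until l (Next r (left Z)) w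
    leaving nothing  ok w q = until-map (λ ()) from w q
    leaving (just c) ok w q with can c ⊩ᵍ? l
    ... | yes c≤l = until-map (λ p → ≤ᵍ-⊩ l p c≤l) from w q
    ... | no  c≰l with guard-below ok
    ...   | inj₁ c≤l = ⊥-elim (c≰l c≤l)
    ...   | inj₂ c≤r = until-now w (absorb-until (left Z) absorbs c≤r w (until-map id from w q))
      where
      -- The rests are already known to be equivalent, so the canonical words of the left one are
      -- accepted on the right.
      absorbs = guard-absorbs ok c≰l λ v∈ → eq _ .proj₁ (canons-accepted _ (left Z) v∈)
  -- The right tail skips `can r`, hence `c` is equivalent to `r`. The lag begins here with `ρ` =
  -- `r` and this step as the only one in the queue.
  in-step {l} {just c} {r} Z peer peers ok (inj₂ (r≤c , p)) = record
    { enter = λ w q → until-map (λ x → can-least x r≤c) (λ _ → id) w (sh w .proj₁ q)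
    ; leave = λ w q → until-now w (sh w .proj₂ (until-map (λ x → can-least x c≤r) (λ _ → id) w q))
    ; match = λ { refl l≤c → ⊥-elim (peer .proj₁ (≤ᶜ-trans l≤c c≤r)) } }
    where
    c≰l : ¬ c ≤ᵍ l
    c≰l c≤l = peer-≰ l peer (≤ᵍ-⊩ l r≤c c≤l)
    c≤r : c ≤ᶜ r
    c≤r with guard-below ok
    ... | inj₁ c≤l = ⊥-elim (c≰l c≤l)
    ... | inj₂ c≤r = c≤r
    sh = shifted Z peers (passes-tail peer ok) (guard-chain ok c≰l)
           (lagging (pending ≤ᶜ-refl (λ x → can-least x c≤r) ∷ []) p)

  -- Skipped or read, the first letter satisfies `ρ`, and nothing follows.
  shifted {ρ} [] peers ok ch lg w = until-now w , λ q → until-hd w q , tt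
    where
    until-hd : ∀ w → Until (just ρ) (Next ρ []) w → hd w ⊩ ρ
    until-hd []      (p , _)        = p
    until-hd (y ∷ w) (inj₁ (p , _)) = p
    until-hd (y ∷ w) (inj₂ (p , _)) = p
  -- The lag gives `r ≤ ρ` and the chain gives `ρ ≤ r`. By `guard-below` the guard `l′` is below `r`
  -- too, so the step joins the queue.
  shifted {ρ} ((nothing , l′ , r) ∷ Z) (peer ∷ peers) ok (inj₂ (ρ≤r , ch)) (lagging {st} {P} (o ∷ os) p) w =
    (λ (q , q′) → until-map id (λ v (x , y) → x , until-now (tl v) (core→ (right Z) (tl v) y)) w
                    (shift-in w q (sh (tl w) .proj₁ (core← (left Z) (tl w) (until-next (tl w) q′))))) ,
    (λ q → let x , y = shift-out w (until-map id (λ v (x , y) →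
                         x , until-map (guard-≤ new) (core← (right Z)) (tl v) y) w q)
           in x , until-now (tl w) (core→ (left Z) (tl w) (sh (tl w) .proj₂ y)))
    where
    core→ : ∀ s w → Next ρ s w → Next r s w
    core→ s w (x , y) = can-least x ρ≤r , y
    r≤ρ : r ≤ᶜ ρ
    r≤ρ = read {st = st} (P ++ (l′ , r) ∷ right Z) _ o p .proj₁
    core← : ∀ s w → Next r s w → Next ρ s w
    core← s w (x , y) = can-least x r≤ρ , y
    guard : ∀ l′ → PassesTests ((nothing , l′ , r) ∷ Z) → ∀ {x} → x ⊩ᵍ l′ → x ⊩ ρ
    guard (just c) ok x with guard-below ok
    ... | inj₂ c≤r = can-least x (≤ᶜ-trans c≤r r≤ρ)
    new : Pending ρ (l′ , r)
    new = pending r≤ρ (guard l′ ok)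
    lag : Lagging ρ (right Z) (alternating (left Z))
    lag with read {st = st} (P ++ (l′ , r) ∷ right Z) _ o p .proj₂
    ... | inj₁ q = push (o ∷ os) new q
    ... | inj₂ q = push os new q
    sh = shifted Z peers (passes-tail peer ok) (chain-≤ (left Z) ρ≤r ch) lag
  -- The lag gives `l ≤ ρ`; the chain must stop at `l`, because `ρ ≤ r` would put `l` below `r`. A
  -- pending step that meets the next letter `can r` would put `r` below `l`, so the queue is empty
  -- by then.
  shifted {ρ} ((just l , l′ , r) ∷ Z) (peer ∷ peers) ok ch (lagging {st} {P} (o ∷ os) p) w =
    (λ (q , q′) → until-map id (λ v (x , y) → x , enter i (tl v) y) w
                    (shift-in w q (until-map (λ x → can-least x l≤ρ) (λ _ → id) (tl w) q′))) ,
    (λ q → let x , y = shift-out w (until-map id (λ v (x , y) →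
                         x , until-map (λ x → can-least x l≤ρ) (λ _ → id) (tl v) (leave i (tl v) y)) w q)
           in x , until-map (λ x → can-least x ρ≤l) (λ _ → id) (tl w) y)
    where
    l≤ρ : l ≤ᶜ ρ
    l≤ρ = read {st = st} (P ++ (l′ , r) ∷ right Z) _ o p .proj₁
    ρ≤l : ρ ≤ᶜ l
    ρ≤l = [ id , (λ (ρ≤r , _) → ⊥-elim (peer .proj₁ (≤ᶜ-trans l≤ρ ρ≤r))) ]′ ch
    caught-up : ∀ {P} → All (Pending ρ) P → Tail (P ++ (l′ , r) ∷ right Z) (can r ∷ alternating (left Z)) →
                Tail ((l′ , r) ∷ right Z) (can r ∷ alternating (left Z))
    caught-up []       q = q
    caught-up {st ∷ P} (o ∷ _) q = ⊥-elim (peer .proj₂ (≤ᶜ-trans (read {st = st} (P ++ (l′ , r) ∷ right Z) _ o q .proj₁) ρ≤l))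
    i : InStep (just l) l′ r Z
    i with read {st = st} (P ++ (l′ , r) ∷ right Z) _ o p .proj₂
    ... | inj₁ q = in-step Z peer peers ok (caught-up (o ∷ os) q)
    ... | inj₂ q = in-step Z peer peers ok (caught-up os q)

  -- Tests for the cores.

  -- No suffix is trivially true, that is, the last core is not trivial.
  Trimmed : List Step → Set
  Trimmed []       = ⊤
  Trimmed (st ∷ s) = ¬ Tail (st ∷ s) [] × Trimmed s

  record Trimming (s : List Step) : Set where
    field
      trim          : List Step
      trimmed       : Trimmed trim
      trim-from     : ∀ w → Tail trim w → Tail s w
      trim-to       : ∀ w → Tail s w → Tail trim w
      trim-⊆        : ∀ {st} → st ∈ trim → st ∈ s
      trim-length   : length trim ≤ length s

  -- A suffix that accepts the empty word accepts every word by monotonicity, so it can be cut off.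
  trimming : ∀ s → Trimming s
  trimming [] = record
    { trim = [] ; trimmed = tt ; trim-from = λ _ → id ; trim-to = λ _ → id ; trim-⊆ = id ; trim-length = z≤n }
  trimming (st@(l , r) ∷ s) with tail? (st ∷ s) []
  ... | yes p = record
    { trim = [] ; trimmed = tt ; trim-from = λ w _ → tail-mono (st ∷ s) [] w tt p ; trim-to = λ _ _ → tt
    ; trim-⊆ = λ () ; trim-length = z≤n }
  ... | no ¬p = record
    { trim = st ∷ trim
    ; trimmed = (λ p → ¬p (from [] p)) , trimmed
    ; trim-from = from
    ; trim-to = until-map id (λ w (p , q) → p , trim-to (tl w) q)
    ; trim-⊆ = λ { (here p) → here p ; (there p) → there (trim-⊆ p) }
    ; trim-length = s≤s trim-length }
    where
    open Trimming (trimming s)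
    from : ∀ w → Tail (st ∷ trim) w → Tail (st ∷ s) w
    from = until-map id (λ w (p , q) → p , trim-from (tl w) q)

  -- All steps have to be read before the word runs out, since no nonempty rest accepts the empty
  -- word.
  length-bound : ∀ s w → Trimmed s → Tail s w → length s ≤ length w
  length-bound []       w       t       p              = z≤n
  length-bound (_ ∷ s)  []      (n , _) p              = ⊥-elim (n p)
  length-bound (_ ∷ s)  (y ∷ w) (_ , t) (inj₁ (_ , p)) = s≤s (length-bound s w t p)
  length-bound (st ∷ s) (y ∷ w) t       (inj₂ (_ , p)) = m≤n⇒m≤1+n (length-bound (st ∷ s) w t p)

  fulls : ∀ {A : Set} → List A → Word
  fulls = map λ _ → full

  full-accepted : ∀ {A : Set} s (xs : List A) → length s ≤ length xs → Tail s (fulls xs)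
  full-accepted []            xs       le       = tt
  full-accepted ((l , r) ∷ s) (_ ∷ xs) (s≤s le) = inj₁ (full-⊩ r , full-accepted s xs le)

  Matches : List Step → Word → Set
  Matches ((l , r) ∷ s) (x ∷ w) = x ⊩ r × Matches s w
  Matches _             _       = ⊤

  -- A skip would leave fewer letters than steps, against `length-bound`.
  matches : ∀ s w → Trimmed s → length w ≤ length s → Tail s w → Matches s w
  matches []       w       t  le p = tt
  matches (_ ∷ s)  []      t  le p = tt
  matches (_ ∷ s)  (x ∷ w) t  (s≤s le) (inj₁ (p , q)) = p , matches s w (t .proj₂) le q
  matches (st ∷ s) (x ∷ w) t  (s≤s le) (inj₂ (_ , q)) =
    ⊥-elim (<-irrefl refl (≤-trans (length-bound (st ∷ s) w t q) le))

  letterTests : List Step → List Word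
  letterTests []            = []
  letterTests ((_ , r) ∷ s) = map (λ x → x ∷ fulls s) (dual r r) ++ map (full ∷_) (letterTests s)

  letterTests-length : ∀ s {w} → w ∈ letterTests s → length w ≡ length s
  letterTests-length ((_ , r) ∷ s) w∈ with ∈-++⁻ (map (λ x → x ∷ fulls s) (dual r r)) w∈
  ... | inj₁ w∈₁ with ∈-map⁻ (λ x → x ∷ fulls s) w∈₁
  ...   | _ , _ , refl = cong suc (length-map _ s)
  letterTests-length ((_ , r) ∷ s) w∈ | inj₂ w∈₂ with ∈-map⁻ (full ∷_) w∈₂
  ...   | _ , v∈ , refl = cong suc (letterTests-length s v∈)

  letterTests-unmatched : ∀ s {w} → w ∈ letterTests s → ¬ Matches s w
  letterTests-unmatched ((_ , r) ∷ s) w∈ m with ∈-++⁻ (map (λ x → x ∷ fulls s) (dual r r)) w∈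
  ... | inj₁ w∈₁ with ∈-map⁻ (λ x → x ∷ fulls s) w∈₁
  ...   | _ , x∈ , refl = dual-⊮ˡ x∈ (m .proj₁)
  letterTests-unmatched ((_ , r) ∷ s) w∈ m | inj₂ w∈₂ with ∈-map⁻ (full ∷_) w∈₂
  ...   | _ , v∈ , refl = letterTests-unmatched s v∈ (m .proj₂)

  letterTests-rejected : ∀ s {w} → Trimmed s → w ∈ letterTests s → ¬ Tail s w
  letterTests-rejected s {w} t w∈ p =
    letterTests-unmatched s w∈ (matches s w t (≤-reflexive (letterTests-length s w∈)) p)

  separated : ∀ {r r′} → (∀ {x} → x ∈ dual r r → ¬ x ⊩ r′) → r′ ≤ᶜ r
  separated {r} {r′} h with can r′ ⊩? r
  ... | yes p = p
  ... | no n with dual-complete n n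
  ...   | x , x∈ , x⊩r′ = ⊥-elim (h x∈ x⊩r′)

  -- On words of full length nothing is skipped, so a test that is `full` except at one position
  -- isolates one core of `s′`. Once the cores are known to be equivalent, those of `s` are used on
  -- both sides of `Z`.
  pair : ∀ s s′ → length s′ ≡ length s → Matches s′ (cans s) →
         (∀ {w} → w ∈ letterTests s → ¬ Tail s′ w) →
         ∃[ Z ] (left Z ≡ s × (∀ w → (Tail s′ w → Tail (right Z) w) × (Tail (right Z) w → Tail s′ w)))
  pair []            []              eq m h = [] , refl , λ w → id , id
  pair ((l , r) ∷ s) ((l′ , r′) ∷ s′) eq (r≤r′ , m) h
    with pair s s′ (suc-injective eq) m
           (λ w∈ p → h (∈-++⁺ʳ (map (λ x → x ∷ fulls s) (dual r r)) (∈-map⁺ (full ∷_) w∈)) (inj₁ (full-⊩ r′ , p)))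
  ... | Z , refl , e = (l , l′ , r) ∷ Z , refl , λ w →
      until-map id (λ w (p , q) → can-least p r′≤r , e (tl w) .proj₁ q) w ,
      until-map id (λ w (p , q) → can-least p r≤r′ , e (tl w) .proj₂ q) w
    where
    r′≤r : r′ ≤ᶜ r
    r′≤r = separated λ x∈ p → h (∈-++⁺ˡ (∈-map⁺ (λ x → x ∷ fulls s) x∈))
             (inj₁ (p , full-accepted s′ s (≤-reflexive (suc-injective eq))))

  alternating-accepted : ∀ s → Tail s (alternating s)
  alternating-accepted []                  = tt
  alternating-accepted ((nothing , r) ∷ s) = inj₁ (can-⊩ r , alternating-accepted s)
  alternating-accepted ((just l , r) ∷ s)  = inj₂ (can-⊩ l , inj₁ (can-⊩ r , alternating-accepted s))

  cans-accepted : ∀ s → Tail s (cans s)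
  cans-accepted []            = tt
  cans-accepted ((l , r) ∷ s) = inj₁ (can-⊩ r , cans-accepted s)

  -- A query r₀ ∧ (l₁ U …) is handled as the tail ⊥ U (r₀ ∧ (l₁ U …)), read
  -- from the time point -1.

  tests : C → List Step → List Word
  -- The one-letter word excludes longer queries. In the other words the final `full` makes the
  -- point occur in the example even when `r` is trivial.
  tests r [] = (full ∷ []) ∷ (can r ∷ full ∷ []) ∷ map (λ x → x ∷ full ∷ []) (dual r r)
  tests r s@(_ ∷ _) = let ŝ = (nothing , r) ∷ s in
    -- `fulls s` is one letter too short for q, which rejects it; every shorter query accepts it.
    cans ŝ ∷ alternating ŝ ∷ fulls s ∷ letterTests ŝ ++ guardTests ŝ

  AgreeOn : List Word → List Step → List Step → Set
  AgreeOn ws s s′ = ∀ {w} → w ∈ ws → (Tail s w → Tail s′ w) × (Tail s′ w → Tail s w)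

  -- The first core may be trivial; a nonempty trimmed `s` behind it still makes the empty word
  -- rejected.
  trimmed-cons : ∀ st s → 0 < length s → Trimmed s → Trimmed (st ∷ s)
  trimmed-cons _ (_ ∷ _) lt t = (λ (_ , p) → t .proj₁ p) , t

  characterised : ∀ r s r′ s′ → Peerless s → Trimmed s → Trimmed s′ →
    AgreeOn (tests r s) ((nothing , r) ∷ s) ((nothing , r′) ∷ s′) →
    ∀ w → (Next r s w → Next r′ s′ w) × (Next r′ s′ w → Next r s w)
  characterised r [] r′ (_ ∷ _) peers t t′ agree w with agree (here refl) .proj₁ (inj₁ (full-⊩ r , tt))
  ... | inj₁ (_ , p) = ⊥-elim (t′ .proj₁ p)
  characterised r [] r′ [] peers t t′ agree w =
    (λ (p , _) → can-least p r≤r′ , tt) , (λ (p , _) → can-least p r′≤r , tt)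
    where
    r≤r′ : r ≤ᶜ r′
    r≤r′ with agree (there (here refl)) .proj₁ (inj₁ (can-⊩ r , tt))
    ... | inj₁ (p , _) = p
    r′≤r : r′ ≤ᶜ r
    r′≤r = separated λ {x} x∈ p →
      case agree (there (there (∈-map⁺ (λ x → x ∷ full ∷ []) x∈))) .proj₂ (inj₁ (p , tt)) of λ
        { (inj₁ (q , _)) → dual-⊮ˡ x∈ q }
  characterised r s@(_ ∷ _) r′ s′ peers t t′ agree w =
    (λ p → until-next w (from w (eq w .proj₁ (until-now w p)))) ,
    (λ p → until-next w (eq w .proj₂ (to w (until-now w p))))
    where
    ŝ  = (nothing , r) ∷ s
    ŝ′ = (nothing , r′) ∷ s′
    t̂ : Trimmed ŝ
    t̂ = trimmed-cons (nothing , r) s (s≤s z≤n) t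
    longer : length s ≤ length s′
    longer with length s ≤? length s′
    ... | yes le = le
    ... | no nle = ⊥-elim (<-irrefl refl (≤-trans
      (length-bound ŝ (fulls s) t̂ (agree (there (there (here refl))) .proj₂ (full-accepted ŝ′ s (≰⇒> nle))))
      (≤-reflexive (length-map (λ _ → full) s))))
    t̂′ : Trimmed ŝ′
    t̂′ = trimmed-cons (nothing , r′) s′ (≤-trans (s≤s z≤n) longer) t′
    cans-accepted′ : Tail ŝ′ (cans ŝ)
    cans-accepted′ = agree (here refl) .proj₁ (cans-accepted ŝ)
    same-length : length ŝ′ ≡ length ŝ
    same-length = ≤-antisym
      (≤-trans (length-bound ŝ′ (cans ŝ) t̂′ cans-accepted′) (≤-reflexive (length-map (can ∘ proj₂) ŝ))) (s≤s longer)
    letters : ∀ {w} → w ∈ letterTests ŝ → ¬ Tail ŝ′ w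
    letters w∈ p = letterTests-rejected ŝ t̂ w∈ (agree (there (there (there (∈-++⁺ˡ w∈)))) .proj₂ p)
    paired = pair ŝ ŝ′ same-length
      (matches ŝ′ (cans ŝ) t̂′ (≤-reflexive (trans (length-map (can ∘ proj₂) ŝ) (sym same-length))) cans-accepted′) letters
    Z = paired .proj₁
    left≡ : left Z ≡ ŝ
    left≡ = paired .proj₂ .proj₁
    to : ∀ w → Tail ŝ′ w → Tail (right Z) w
    to w = paired .proj₂ .proj₂ w .proj₁
    from : ∀ w → Tail (right Z) w → Tail ŝ′ w
    from w = paired .proj₂ .proj₂ w .proj₂
    eq : ∀ w → (Tail ŝ w → Tail (right Z) w) × (Tail (right Z) w → Tail ŝ w)
    eq = subst (λ ŝ → ∀ w → (Tail ŝ w → Tail (right Z) w) × (Tail (right Z) w → Tail ŝ w)) left≡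
      (equivalent Z (subst Peerless (sym left≡) (tt ∷ peers))
        (λ {w} w∈ p → subst (λ ŝ → Tail ŝ w) (sym left≡)
          (agree (there (there (there (∈-++⁺ʳ (letterTests ŝ) (subst (λ ŝ → w ∈ guardTests ŝ) left≡ w∈))))) .proj₂
            (from w p)))
        (subst (λ ŝ → Tail (right Z) (alternating ŝ)) (sym left≡)
          (to (alternating ŝ) (agree (there (here refl)) .proj₁ (alternating-accepted ŝ)))))

  -- Size of the tests.

  -- The point of an example has to occur in its instance. A letter satisfying a concept that `ε`
  -- lacks contains a fact about its point (`sat-ind`).
  Visible : Word → Set
  Visible = Any λ x → ∃[ c ] (x ⊩ c × ¬ ε ⊩ c)

  cans∈ : ∀ K s → cans s ∈ canons K s
  cans∈ K []                   = here refl
  cans∈ K ((nothing , r) ∷ s) = ∈-map⁺ (can r ∷_) (cans∈ K s)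
  cans∈ K ((just l , r) ∷ s)  = canons-block {l = l} {s = s} {k = 0} z≤n (cans∈ K s)

  alternating∈ : ∀ s → alternating s ∈ canons 1 s
  alternating∈ []                   = here refl
  alternating∈ ((nothing , r) ∷ s) = ∈-map⁺ (can r ∷_) (alternating∈ s)
  alternating∈ ((just l , r) ∷ s)  = canons-block {l = l} {s = s} {k = 1} ≤-refl (alternating∈ s)

  data CanonView (K : ℕ) (l : Maybe C) (r : C) (s : List Step) : Word → Set where
    view : ∀ {v} k {u} → k ≤ K → All (λ x → ∃[ c ] (l ≡ just c × x ≡ can c)) u → length u ≡ k →
           v ∈ canons K s → CanonView K l r s (u ++ can r ∷ v)

  canon-view : ∀ K l r s {v} → v ∈ canons K ((l , r) ∷ s) → CanonView K l r s v
  canon-view K nothing r s v∈ with ∈-map⁻ (can r ∷_) v∈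
  ... | v , v∈′ , refl = view 0 z≤n [] refl v∈′
  canon-view K (just l) r s v∈
    with find (∈-concatMap⁻ (λ k → map (λ v → replicate k (can l) ++ can r ∷ v) (canons K s)) {xs = upTo (suc K)} v∈)
  ... | k , k∈ , v∈k with ∈-map⁻ (λ v → replicate k (can l) ++ can r ∷ v) v∈k
  ...   | v , v∈′ , refl =
    view k (≤-pred (∈-upTo⁻ k∈)) (All.replicate⁺ k (l , refl , refl)) (length-replicate k) v∈′

  -- The last core of a trimmed tail is nontrivial, and its canonical letter occurs in every
  -- canonical word.
  canons-visible : ∀ K l r s → ¬ Tail ((l , r) ∷ s) [] → Trimmed s → ∀ {v} → v ∈ canons K s → Visible (can r ∷ v)
  canons-visible K l r []             n t v∈ = here (r , can-⊩ r , λ p → n (p , tt))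
  canons-visible K l r ((l′ , r′) ∷ s) n t v∈ with canon-view K l′ r′ s v∈
  ... | view k {u} _ _ _ v∈′ = there (Any.++⁺ʳ u (canons-visible K l′ r′ s (t .proj₁) (t .proj₂) v∈′))

  canons-visible⁺ : ∀ K s → 0 < length s → Trimmed s → ∀ {v} → v ∈ canons K s → Visible v
  canons-visible⁺ K ((l , r) ∷ s) lt t v∈ with canon-view K l r s v∈
  ... | view k {u} _ _ _ v∈′ = Any.++⁺ʳ u (canons-visible K l r s (t .proj₁) (t .proj₂) v∈′)

  canons-length : ∀ K s {v} → v ∈ canons K s → length v ≤ length s * suc K
  canons-length K []            (here refl) = z≤n
  canons-length K ((l , r) ∷ s) v∈ with canon-view K l r s v∈
  ... | view {v} k {u} k≤K _ refl v∈′ = begin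
    length (u ++ can r ∷ v)        ≡⟨ length-++ u ⟩
    length u + suc (length v)      ≡⟨ +-suc (length u) (length v) ⟩
    suc (length u) + length v      ≤⟨ +-mono-≤ (s≤s k≤K) (canons-length K s v∈′) ⟩
    suc K + length s * suc K       ∎
    where open ≤-Reasoning

  full-visible : ∀ {w} → Visible (full ∷ w)
  full-visible = here (nontrivial .proj₁ , full-⊩ _ , nontrivial .proj₂)

  module Size (Small : Letter → Set) (small-full : Small full) (Δ : ℕ) (Δ≥1 : 1 ≤ Δ) where

    record Sized (st : Step) : Set where
      field
        core-small  : Small (can (st .proj₂))
        guard-small : ∀ {l} → st .proj₁ ≡ just l → Small (can l)
        dual-small  : ∀ {x} → x ∈ dual (st .proj₂) (st .proj₂) → Small x
        dual¹-small : ∀ {x} → x ∈ dual¹ (st .proj₁) → Small x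
        dual²-small : ∀ {x} → x ∈ dual² (st .proj₁) (st .proj₂) → Small x
        dual-few    : length (dual (st .proj₂) (st .proj₂)) ≤ Δ
        dual¹-few   : length (dual¹ (st .proj₁)) ≤ Δ
        dual²-few   : length (dual² (st .proj₁) (st .proj₂)) ≤ Δ

    open Sized

    canons-small : ∀ K s → All Sized s → ∀ {v} → v ∈ canons K s → All Small v
    canons-small K []            []       (here refl) = []
    canons-small K ((l , r) ∷ s) (z ∷ zs) v∈ with canon-view K l r s v∈
    ... | view k _ us _ v∈′ =
      All.++⁺ (All.map (λ { (_ , eq , refl) → guard-small z eq }) us) (core-small z ∷ canons-small K s zs v∈′)

    -- The square comes from the absorption tests: up to `m` blocks, each of length linear in `m`.
    Moderate : ℕ → Word → Set
    Moderate m w = length w ≤ suc m * suc m × All Small w × Visible w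

    fulls-small : ∀ {A : Set} (xs : List A) → All Small (fulls xs)
    fulls-small []       = []
    fulls-small (_ ∷ xs) = small-full ∷ fulls-small xs

    m≤square : ∀ m → m ≤ suc m * suc m
    m≤square m = ≤-trans (n≤1+n m) (m≤m*n (suc m) (suc m))

    letterTests-moderate : ∀ s {w} → All Sized s → w ∈ letterTests s → 1 < length s → Moderate (length s) w
    letterTests-moderate s zs w∈ lt =
      ≤-trans (≤-reflexive (letterTests-length s w∈)) (m≤square (length s)) , small s zs w∈ , visible s lt w∈
      where
      small : ∀ s {w} → All Sized s → w ∈ letterTests s → All Small w
      small ((_ , r) ∷ s) (z ∷ zs) w∈ with ∈-++⁻ (map (λ x → x ∷ fulls s) (dual r r)) w∈
      ... | inj₁ w∈₁ with ∈-map⁻ (λ x → x ∷ fulls s) w∈₁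
      ...   | _ , x∈ , refl = dual-small z x∈ ∷ fulls-small s
      small ((_ , r) ∷ s) (z ∷ zs) w∈ | inj₂ w∈₂ with ∈-map⁻ (full ∷_) w∈₂
      ...   | _ , v∈ , refl = small-full ∷ small s zs v∈
      visible : ∀ s {w} → 1 < length s → w ∈ letterTests s → Visible w
      visible (_ ∷ []) (s≤s ()) w∈
      visible ((_ , r) ∷ st ∷ s) lt w∈ with ∈-++⁻ (map (λ x → x ∷ fulls (st ∷ s)) (dual r r)) w∈
      ... | inj₁ w∈₁ with ∈-map⁻ (λ x → x ∷ fulls (st ∷ s)) w∈₁
      ...   | _ , x∈ , refl = there (full-visible)
      visible ((_ , r) ∷ st ∷ s) lt w∈ | inj₂ w∈₂ with ∈-map⁻ (full ∷_) w∈₂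
      ...   | _ , v∈ , refl = full-visible

    square-step : ∀ m → suc (suc m * suc m) ≤ suc (suc m) * suc (suc m)
    square-step m = *-mono-< (n<1+n (suc m)) (n<1+n (suc m))

    canonical-length : ∀ m n → n ≤ m * suc (suc m) → 2 + n ≤ suc (suc m) * suc (suc m)
    canonical-length m n le = begin
      2 + n                                      ≤⟨ +-mono-≤ {2} {suc (suc m)} (s≤s (s≤s z≤n)) (≤-trans le (m≤n+m _ (suc (suc m)))) ⟩
      suc (suc m) + (suc (suc m) + m * suc (suc m)) ∎
      where open ≤-Reasoning

    small-prefix : ∀ m {x r v} → Small x → Small (can r) → All Small v → length v ≤ m * suc (suc m) →
                   Visible (can r ∷ v) → Moderate (suc m) (x ∷ can r ∷ v)
    small-prefix m {v = v} zx zr zv le vis = canonical-length m (length v) le , zx ∷ zr ∷ zv , there vis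

    guardTests-moderate : ∀ s {w} → All Sized s → Trimmed s → w ∈ guardTests s → Moderate (length s) w
    guardTests-moderate ((l , r) ∷ s) (z ∷ zs) t w∈ with ∈-++⁻ (separationTests l r s) w∈
    ... | inj₁ w∈₁ with ∈-map⁻ (λ x → x ∷ can r ∷ cans s) w∈₁
    ...   | x , x∈ , refl =
      small-prefix (length s) small-x (core-small z) (canons-small 0 s zs (cans∈ 0 s))
        (≤-trans (≤-reflexive (length-map (can ∘ proj₂) s)) (m≤m*n (length s) (suc (suc (length s)))))
        (canons-visible 0 l r s (t .proj₁) (t .proj₂) (cans∈ 0 s))
      where
      small-x : Small x
      small-x with ∈-++⁻ (dual² l r) x∈
      ... | inj₁ x∈₁ = dual²-small z x∈₁
      ... | inj₂ x∈₂ = dual¹-small z x∈₂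
    guardTests-moderate ((l , r) ∷ s) (z ∷ zs) t w∈ | inj₂ w∈₂ with ∈-++⁻ (absorptionTests l r s) w∈₂
    ... | inj₁ w∈₃ = absorption w∈₃
      where
      absorption : ∀ {w} → w ∈ absorptionTests l r s → Moderate (suc (length s)) w
      absorption w∈ with absorbs? r s
      ... | inj₂ (v , v∈ , _) with ∈-map⁻ (λ x → x ∷ can r ∷ v) w∈
      ...   | x , x∈ , refl =
        small-prefix (length s) (dual¹-small z x∈) (core-small z) (canons-small (suc (length s)) s zs v∈)
          (canons-length (suc (length s)) s v∈)
          (canons-visible (suc (length s)) l r s (t .proj₁) (t .proj₂) v∈)
    ... | inj₂ w∈₃ with ∈-map⁻ (can r ∷_) w∈₃
    ...   | v , v∈ , refl with guardTests-moderate s zs (t .proj₂) v∈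
    ...     | le , sm , vis = ≤-trans (s≤s le) (square-step (length s)) , core-small z ∷ sm , there vis

    tests-moderate : ∀ r s {w} → Sized (nothing , r) → All Sized s → Trimmed s → w ∈ tests r s →
                     Moderate (suc (length s)) w
    tests-moderate r [] z zs t (here refl) = s≤s z≤n , small-full ∷ [] , full-visible
    tests-moderate r [] z zs t (there (here refl)) =
      s≤s (s≤s z≤n) , core-small z ∷ small-full ∷ [] , there (full-visible)
    tests-moderate r [] z zs t (there (there w∈)) with ∈-map⁻ (λ x → x ∷ full ∷ []) w∈
    ... | x , x∈ , refl = s≤s (s≤s z≤n) , dual-small z x∈ ∷ small-full ∷ [] , there (full-visible)
    tests-moderate r s@(st ∷ s₁) z zs t w∈ = case w∈ of λ
      { (here refl) → le (length-map _ ŝ) (m≤square _) , canons-small 0 ŝ ẑ (cans∈ 0 ŝ) ,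
                      canons-visible⁺ 0 ŝ (s≤s z≤n) t̂ (cans∈ 0 ŝ)
      ; (there (here refl)) →
          ≤-trans (canons-length 1 ŝ (alternating∈ ŝ))
            (*-mono-≤ (n≤1+n (length ŝ)) (s≤s (s≤s (z≤n {length s})))) ,
          canons-small 1 ŝ ẑ (alternating∈ ŝ) , canons-visible⁺ 1 ŝ (s≤s z≤n) t̂ (alternating∈ ŝ)
      ; (there (there (here refl))) →
          le (length-map _ s) (≤-trans (n≤1+n _) (m≤square _)) , fulls-small s , full-visible
      ; (there (there (there w∈))) → case ∈-++⁻ (letterTests ŝ) w∈ of λ
          { (inj₁ w∈) → letterTests-moderate ŝ ẑ w∈ (s≤s (s≤s z≤n))
          ; (inj₂ w∈) → guardTests-moderate ŝ ẑ t̂ w∈ } }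
      where
      ŝ = (nothing , r) ∷ s
      ẑ : All Sized ŝ
      ẑ = z ∷ zs
      t̂ : Trimmed ŝ
      t̂ = trimmed-cons (nothing , r) s (s≤s z≤n) t
      le : ∀ {a b c} → a ≡ b → b ≤ c → a ≤ c
      le refl p = p

    letterTests-few : ∀ s → All Sized s → length (letterTests s) ≤ length s * Δ
    letterTests-few []            []       = z≤n
    letterTests-few ((_ , r) ∷ s) (z ∷ zs) = begin
      length (map (λ x → x ∷ fulls s) (dual r r) ++ map (full ∷_) (letterTests s))
        ≡⟨ trans (length-++ (map (λ x → x ∷ fulls s) (dual r r)))
             (cong₂ _+_ (length-map _ (dual r r)) (length-map _ (letterTests s))) ⟩
      length (dual r r) + length (letterTests s)  ≤⟨ +-mono-≤ (dual-few z) (letterTests-few s zs) ⟩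
      Δ + length s * Δ                            ∎
      where open ≤-Reasoning

    guardTests-few : ∀ s → All Sized s → length (guardTests s) ≤ length s * (3 * Δ)
    guardTests-few []            []       = z≤n
    guardTests-few ((l , r) ∷ s) (z ∷ zs) = begin
      length (separationTests l r s ++ absorptionTests l r s ++ map (can r ∷_) (guardTests s))
        ≡⟨ trans (length-++ (separationTests l r s)) (cong₂ _+_ (length-map _ (dual² l r ++ dual¹ l))
             (trans (length-++ (absorptionTests l r s)) (cong (length (absorptionTests l r s) +_) (length-map _ (guardTests s))))) ⟩
      length (dual² l r ++ dual¹ l) + (length (absorptionTests l r s) + length (guardTests s))
        ≤⟨ +-mono-≤ (≤-trans (≤-reflexive (length-++ (dual² l r))) (+-mono-≤ (dual²-few z) (dual¹-few z)))
             (+-mono-≤ absorption (guardTests-few s zs)) ⟩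
      Δ + Δ + (Δ + length s * (3 * Δ))
        ≡⟨ trans (sym (+-assoc (Δ + Δ) Δ _)) (cong (_+ length s * (3 * Δ))
             (trans (+-assoc Δ Δ Δ) (cong (λ x → Δ + (Δ + x)) (sym (+-identityʳ Δ))))) ⟩
      3 * Δ + length s * (3 * Δ)  ∎
      where
      open ≤-Reasoning
      absorption : length (absorptionTests l r s) ≤ Δ
      absorption with absorbs? r s
      ... | inj₁ _ = z≤n
      ... | inj₂ _ = ≤-trans (≤-reflexive (length-map _ (dual¹ l))) (dual¹-few z)

    -- Each step contributes one family of letter tests and up to three of guard tests, from
    -- `dual²`, from `dual¹`, and from absorption.
    tests-few : ∀ r s → Sized (nothing , r) → All Sized s → length (tests r s) ≤ 3 + suc (length s) * (4 * Δ)
    tests-few r [] z zs = s≤s (s≤s (m≤n⇒m≤1+n (begin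
      length (map (λ x → x ∷ full ∷ []) (dual r r)) ≡⟨ length-map _ (dual r r) ⟩
      length (dual r r)                            ≤⟨ dual-few z ⟩
      Δ                                            ≤⟨ m≤n*m Δ 4 ⟩
      4 * Δ                                        ≡⟨ +-identityʳ (4 * Δ) ⟨
      4 * Δ + 0                                    ∎)))
      where open ≤-Reasoning
    tests-few r s@(_ ∷ _) z zs = s≤s (s≤s (s≤s (begin
      length (letterTests ŝ ++ guardTests ŝ)            ≡⟨ length-++ (letterTests ŝ) ⟩
      length (letterTests ŝ) + length (guardTests ŝ)
        ≤⟨ +-mono-≤ (letterTests-few ŝ (z ∷ zs)) (guardTests-few ŝ (z ∷ zs)) ⟩
      length ŝ * Δ + length ŝ * (3 * Δ)                 ≡⟨ *-distribˡ-+ (length ŝ) Δ (3 * Δ) ⟨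
      length ŝ * (4 * Δ)                                ∎)))
      where
      open ≤-Reasoning
      ŝ = (nothing , r) ∷ s

-- Counting and searching in finite lists.

length-cartesianProduct : ∀ {A B : Set} (xs : List A) (ys : List B) →
                          length (cartesianProduct xs ys) ≡ length xs * length ys
length-cartesianProduct []       ys = refl
length-cartesianProduct (x ∷ xs) ys = trans (length-++ (map (x ,_) ys))
  (cong₂ _+_ (length-map (x ,_) ys) (length-cartesianProduct xs ys))

any-or-all : ∀ {A : Set} {P Q : A → Set} xs → (∀ {x} → x ∈ xs → P x ⊎ Q x) →
             ∃[ x ] (x ∈ xs × P x) ⊎ (∀ {x} → x ∈ xs → Q x)
any-or-all []       f = inj₂ λ ()
any-or-all (x ∷ xs) f with f (here refl) | any-or-all xs (f ∘ there)
... | inj₁ p | _                   = inj₁ (x , here refl , p)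
... | inj₂ q | inj₁ (y , y∈ , p)   = inj₁ (y , there y∈ , p)
... | inj₂ q | inj₂ qs             = inj₂ λ { (here refl) → q ; (there y∈) → qs y∈ }

sublists : ∀ {A : Set} → List A → List (List A)
sublists []       = [] ∷ []
sublists (x ∷ xs) = map (x ∷_) (sublists xs) ++ sublists xs

sublists-length : ∀ {A : Set} (xs : List A) → length (sublists xs) ≡ 2 ^ length xs
sublists-length []       = refl
sublists-length (x ∷ xs) = trans (length-++ (map (x ∷_) (sublists xs))) (cong₂ _+_
  (trans (length-map _ (sublists xs)) (sublists-length xs))
  (trans (sublists-length xs) (sym (+-identityʳ _))))

filter∈sublists : ∀ {A : Set} {P : A → Set} (P? : ∀ x → Dec (P x)) xs → filter P? xs ∈ sublists xs
filter∈sublists P? []       = here refl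
filter∈sublists P? (x ∷ xs) with does (P? x)
... | true  = ∈-++⁺ˡ (∈-map⁺ (x ∷_) (filter∈sublists P? xs))
... | false = ∈-++⁺ʳ (map (x ∷_) (sublists xs)) (filter∈sublists P? xs)

Iff : Set → Set → Set
Iff P Q = (P → Q) × (Q → P)

-- Pointed data instances.

module _ {S : Signature} where

  Sat : ∀ {L} → DataInstance S → Individual → Concept S L → Set
  Sat A a ⊤ᶜ       = ⊤
  Sat A a (atom B) = unary B a ∈ A
  Sat A a (c ∧ᶜ d) = Sat A a c × Sat A a d
  Sat A a (∃ᶜ R c) = ∃[ b ] (roleFact R a b ∈ A × Sat A b c)

  _≟ᶠ_ : DecidableEquality (Fact S)
  unary A a    ≟ᶠ unary B b    =
    map′ (λ { (refl , refl) → refl }) (λ { refl → refl , refl }) (A Fin.≟ B ×-dec a ≟ b)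
  binary P a b ≟ᶠ binary Q c d =
    map′ (λ { (refl , refl , refl) → refl }) (λ { refl → refl , refl , refl }) (P Fin.≟ Q ×-dec a ≟ c ×-dec b ≟ d)
  unary _ _    ≟ᶠ binary _ _ _ = no λ ()
  binary _ _ _ ≟ᶠ unary _ _    = no λ ()

  open DecMembership _≟ᶠ_ using () renaming (_∈?_ to _∈ᶠ?_)

  fact-ind : ∀ {φ a} {A : DataInstance S} → φ ∈ A → a ∈ factInd φ → a ∈ ind A
  fact-ind φ∈ a∈ = ∈-concatMap⁺ factInd (lose φ∈ a∈)

  role-ind : ∀ {L} (R : Role S L) {a b A} → roleFact R a b ∈ A → b ∈ ind A
  role-ind (name P) φ∈ = fact-ind φ∈ (there (here refl))
  role-ind (inv P)  φ∈ = fact-ind φ∈ (here refl)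

  role-indˡ : ∀ {L} (R : Role S L) {a b A} → roleFact R a b ∈ A → a ∈ ind A
  role-indˡ (name P) φ∈ = fact-ind φ∈ (here refl)
  role-indˡ (inv P)  φ∈ = fact-ind φ∈ (there (here refl))

  sat? : ∀ {L} A a (c : Concept S L) → Dec (Sat A a c)
  sat? A a ⊤ᶜ       = yes tt
  sat? A a (atom B) = unary B a ∈ᶠ? A
  sat? A a (c ∧ᶜ d) = sat? A a c ×-dec sat? A a d
  sat? A a (∃ᶜ R c) = map′
    (λ p → let b , _ , q = find p in b , q)
    (λ (b , φ∈ , p) → lose (role-ind R φ∈) (φ∈ , p))
    (Any.any? (λ b → roleFact R a b ∈ᶠ? A ×-dec sat? A b c) (ind A))

  concept-sat : ∀ {L} (c : Concept S L) D a ℓ → Iff (concept⊨ c D a ℓ) (Sat (D at-time ℓ) a c)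
  concept-sat ⊤ᶜ       D a ℓ = id , id
  concept-sat (atom A) D a ℓ = id , id
  concept-sat (c ∧ᶜ d) D a ℓ =
    (λ (p , q) → concept-sat c D a ℓ .proj₁ p , concept-sat d D a ℓ .proj₁ q) ,
    (λ (p , q) → concept-sat c D a ℓ .proj₂ p , concept-sat d D a ℓ .proj₂ q)
  concept-sat (∃ᶜ R c) D a ℓ =
    (λ (b , _ , φ∈ , p) → b , φ∈ , concept-sat c D b ℓ .proj₁ p) ,
    (λ (b , φ∈ , p) → b , role-ind R φ∈ , φ∈ , concept-sat c D b ℓ .proj₂ p)

  renameFact : (Individual → Individual) → Fact S → Fact S
  renameFact h (unary A a)    = unary A (h a)
  renameFact h (binary P a b) = binary P (h a) (h b)

  rename-role : ∀ {L} h (R : Role S L) a b → renameFact h (roleFact R a b) ≡ roleFact R (h a) (h b)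
  rename-role h (name P) a b = refl
  rename-role h (inv P)  a b = refl

  rename-∘ : ∀ {f g h : Individual → Individual} → (∀ a → h (g a) ≡ f a) →
             ∀ φ → renameFact h (renameFact g φ) ≡ renameFact f φ
  rename-∘ e (unary A a)    = cong (unary A) (e a)
  rename-∘ e (binary P a b) = cong₂ (binary P) (e a) (e b)

  Hom : (Individual → Individual) → DataInstance S → DataInstance S → Set
  Hom h A B = ∀ {φ} → φ ∈ A → renameFact h φ ∈ B

  hom-sat : ∀ {L h A B} (c : Concept S L) {a} → Hom h A B → Sat A a c → Sat B (h a) c
  hom-sat ⊤ᶜ       hom p = tt
  hom-sat (atom B) hom p = hom p
  hom-sat (c ∧ᶜ d) hom (p , q) = hom-sat c hom p , hom-sat d hom q
  hom-sat {h = h} {B = B} (∃ᶜ R c) {a} hom (b , φ∈ , p) =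
    h b , subst (_∈ B) (rename-role h R a b) (hom φ∈) , hom-sat c hom p

  double : ℕ → ℕ
  double zero    = zero
  double (suc n) = suc (suc (double n))

  -- Two copies of ℕ glued at 0.
  inˡ inʳ : Individual → Individual
  inˡ zero    = zero
  inˡ (suc n) = suc (double n)
  inʳ zero    = zero
  inʳ (suc n) = suc (suc (double n))

  glue : (f g : Individual → Individual) → Individual → Individual
  glue f g zero    = f zero
  glue f g (suc n) = go n (f ∘ suc) (g ∘ suc)
    where
    go : ℕ → (f g : ℕ → ℕ) → ℕ
    go zero          f g = f zero
    go (suc zero)    f g = g zero
    go (suc (suc n)) f g = go n (f ∘ suc) (g ∘ suc)

  glue-inˡ : ∀ f g a → glue f g (inˡ a) ≡ f a
  glue-inˡ f g zero          = refl
  glue-inˡ f g (suc zero)    = refl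
  glue-inˡ f g (suc (suc n)) = glue-inˡ (f ∘ suc) (g ∘ suc) (suc n)

  glue-inʳ : ∀ f g → f zero ≡ g zero → ∀ a → glue f g (inʳ a) ≡ g a
  glue-inʳ f g e zero          = e
  glue-inʳ f g e (suc n)       = go f g n
    where
    go : ∀ f g n → glue f g (inʳ (suc n)) ≡ g (suc n)
    go f g zero    = refl
    go f g (suc n) = go (f ∘ suc) (g ∘ suc) n

  -- The root is 0.
  tree : ∀ {L} → Concept S L → DataInstance S
  tree ⊤ᶜ       = []
  tree (atom A) = unary A 0 ∷ []
  tree (c ∧ᶜ d) = map (renameFact inˡ) (tree c) ++ map (renameFact inʳ) (tree d)
  tree (∃ᶜ R c) = roleFact R 0 1 ∷ map (renameFact suc) (tree c)

  tree-sat : ∀ {L} (c : Concept S L) → Sat (tree c) 0 c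
  tree-sat ⊤ᶜ       = tt
  tree-sat (atom A) = here refl
  tree-sat (c ∧ᶜ d) =
    hom-sat c (∈-++⁺ˡ ∘ ∈-map⁺ (renameFact inˡ)) (tree-sat c) ,
    hom-sat d (∈-++⁺ʳ _ ∘ ∈-map⁺ (renameFact inʳ)) (tree-sat d)
  tree-sat (∃ᶜ R c) = 1 , here refl , hom-sat c (there ∘ ∈-map⁺ (renameFact suc)) (tree-sat c)

  tree-hom : ∀ {L A} (c : Concept S L) {a} → Sat A a c → ∃[ h ] (h 0 ≡ a × Hom h (tree c) A)
  tree-hom ⊤ᶜ {a} p = (λ _ → a) , refl , λ ()
  tree-hom (atom B) {a} p = (λ _ → a) , refl , λ { (here refl) → p }
  tree-hom {A = A} (c ∧ᶜ d) (p , q) with tree-hom c p | tree-hom d q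
  ... | f , f0 , f-hom | g , g0 , g-hom = glue f g , f0 , hom
    where
    hom : Hom (glue f g) (tree (c ∧ᶜ d)) A
    hom φ∈ with ∈-++⁻ (map (renameFact inˡ) (tree c)) φ∈
    ... | inj₁ φ∈₁ with ∈-map⁻ (renameFact inˡ) φ∈₁
    ...   | ψ , ψ∈ , refl = subst (_∈ A) (sym (rename-∘ (glue-inˡ f g) ψ)) (f-hom ψ∈)
    hom φ∈ | inj₂ φ∈₂ with ∈-map⁻ (renameFact inʳ) φ∈₂
    ...   | ψ , ψ∈ , refl =
      subst (_∈ A) (sym (rename-∘ (glue-inʳ f g (trans f0 (sym g0))) ψ)) (g-hom ψ∈)
  tree-hom {A = A} (∃ᶜ R c) {a} (b , φ∈ , p) with tree-hom c p
  ... | f , refl , f-hom = h , refl , hom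
    where
    h : Individual → Individual
    h zero    = a
    h (suc n) = f n
    hom : Hom h (tree (∃ᶜ R c)) A
    hom (here refl) = subst (_∈ A) (sym (rename-role h R 0 1)) φ∈
    hom (there ψ∈) with ∈-map⁻ (renameFact suc) ψ∈
    ... | ψ , ψ∈ , refl = subst (_∈ A) (sym (rename-∘ {f} {suc} {h} (λ _ → refl) ψ)) (f-hom ψ∈)

  tree-least : ∀ {L A a} (c d : Concept S L) → Sat A a c → Sat (tree c) 0 d → Sat A a d
  tree-least c d p q with tree-hom c p
  ... | h , refl , hom = hom-sat d hom q

  tree-length : ∀ {L} (c : Concept S L) → length (tree c) ≤ conceptSize c
  tree-length ⊤ᶜ       = z≤n
  tree-length (atom A) = s≤s z≤n
  tree-length (c ∧ᶜ d) = begin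
    length (map (renameFact inˡ) (tree c) ++ map (renameFact inʳ) (tree d))
      ≡⟨ trans (length-++ (map (renameFact inˡ) (tree c))) (cong₂ _+_ (length-map _ (tree c)) (length-map _ (tree d))) ⟩
    length (tree c) + length (tree d)    ≤⟨ +-mono-≤ (tree-length c) (tree-length d) ⟩
    conceptSize c + conceptSize d        ≤⟨ n≤1+n _ ⟩
    1 + conceptSize c + conceptSize d    ∎
    where open ≤-Reasoning
  tree-length (∃ᶜ R c) =
    s≤s (m≤n⇒m≤1+n (≤-trans (≤-reflexive (length-map _ (tree c))) (tree-length c)))

  loops : DataInstance S
  loops = map (λ A → unary A 0) (allFin (#unary S)) ++ map (λ P → binary P 0 0) (allFin (#binary S))

  loops-sat : ∀ {L} (c : Concept S L) → Sat loops 0 c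
  loops-sat ⊤ᶜ       = tt
  loops-sat (atom A) = ∈-++⁺ˡ (∈-map⁺ (λ A → unary A 0) (∈-allFin A))
  loops-sat (c ∧ᶜ d) = loops-sat c , loops-sat d
  loops-sat (∃ᶜ R c) = 0 , loop R , loops-sat c
    where
    loop : ∀ {L} (R : Role S L) → roleFact R 0 0 ∈ loops
    loop (name P) = ∈-++⁺ʳ _ (∈-map⁺ (λ P → binary P 0 0) (∈-allFin P))
    loop (inv P)  = ∈-++⁺ʳ _ (∈-map⁺ (λ P → binary P 0 0) (∈-allFin P))

  loops-length : length loops ≡ #unary S + #binary S
  loops-length = trans (length-++ (map (λ A → unary A 0) (allFin (#unary S)))) (cong₂ _+_
    (trans (length-map _ (allFin (#unary S))) (length-tabulate {n = #unary S} id))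
    (trans (length-map _ (allFin (#binary S))) (length-tabulate {n = #binary S} id)))

  nontrivial-concept : ∀ L → ∃[ c ] ¬ Sat {L} [] 0 c
  nontrivial-concept L with #unary S in u | #binary S in b
  ... | suc _ | _     = atom (subst Fin (sym u) Fin.zero) , λ ()
  ... | zero  | suc _ = ∃ᶜ (name (subst Fin (sym b) Fin.zero)) ⊤ᶜ , λ ()
  ... | zero  | zero  = ⊥-elim (<-irrefl refl (subst₂ (λ u b → 0 < u + b) u b (nonempty S)))

  infix 4 _⇒ᶜ_
  _⇒ᶜ_ : ∀ {L} → Concept S L → Concept S L → Set
  c ⇒ᶜ d = ∀ A a → Sat A a c → Sat A a d

  -- Finite structures, and their presentation as data instances: the
  -- individual 0 is a copy of a chosen node.

  record Structure : Set₁ where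
    field
      Node  : Set
      nodes : List Node
      U     : Unary S → Node → Set
      U?    : ∀ A x → Dec (U A x)
      B     : Binary S → Node → Node → Set
      B?    : ∀ P x y → Dec (B P x y)

    RoleHolds : ∀ {L} → Role S L → Node → Node → Set
    RoleHolds (name P) x y = B P x y
    RoleHolds (inv P)  x y = B P y x

    Holds : ∀ {L} → Node → Concept S L → Set
    Holds x ⊤ᶜ       = ⊤
    Holds x (atom A) = U A x
    Holds x (c ∧ᶜ d) = Holds x c × Holds x d
    Holds x (∃ᶜ R c) = ∃[ y ] (y ∈ nodes × RoleHolds R x y × Holds y c)

    module Presentation (root : Node) where

      elements : List Node
      elements = root ∷ nodes

      Index : Set
      Index = Fin (length elements)

      element : Index → Node
      element = lookup elements

      unaries : List (Unary S × Index)
      unaries = filter (λ (A , i) → U? A (element i)) (cartesianProduct (allFin _) (allFin _))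

      binaries : List (Binary S × Index × Index)
      binaries = filter (λ (P , i , j) → B? P (element i) (element j))
        (cartesianProduct (allFin _) (cartesianProduct (allFin _) (allFin _)))

      unaryFact : Unary S × Index → Fact S
      unaryFact (A , i) = unary A (toℕ i)

      binaryFact : Binary S × Index × Index → Fact S
      binaryFact (P , i , j) = binary P (toℕ i) (toℕ j)

      presentation : DataInstance S
      presentation = map unaryFact unaries ++ map binaryFact binaries

      unary⁺ : ∀ {A} i → U A (element i) → unary A (toℕ i) ∈ presentation
      unary⁺ {A} i p = ∈-++⁺ˡ (∈-map⁺ unaryFact
        (∈-filter⁺ (λ (A , i) → U? A (element i)) (∈-cartesianProduct⁺ (∈-allFin A) (∈-allFin i)) p))

      unary⁻ : ∀ {A a} → unary A a ∈ presentation → ∃[ i ] (a ≡ toℕ i × U A (element i))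
      unary⁻ φ∈ with ∈-++⁻ (map unaryFact unaries) φ∈
      ... | inj₁ φ∈₁ with ∈-map⁻ unaryFact φ∈₁
      ...   | (A , i) , i∈ , refl = i , refl ,
        ∈-filter⁻ (λ (A , i) → U? A (element i)) {xs = cartesianProduct (allFin _) (allFin _)} i∈ .proj₂
      unary⁻ φ∈ | inj₂ φ∈₂ with ∈-map⁻ binaryFact φ∈₂
      ...   | _ , _ , ()

      binary⁺ : ∀ {P} i j → B P (element i) (element j) → binary P (toℕ i) (toℕ j) ∈ presentation
      binary⁺ {P} i j p = ∈-++⁺ʳ (map unaryFact unaries) (∈-map⁺ binaryFact
        (∈-filter⁺ (λ (P , i , j) → B? P (element i) (element j))
          (∈-cartesianProduct⁺ (∈-allFin P) (∈-cartesianProduct⁺ (∈-allFin i) (∈-allFin j))) p))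

      binary⁻ : ∀ {P a b} → binary P a b ∈ presentation →
                ∃[ i ] ∃[ j ] (a ≡ toℕ i × b ≡ toℕ j × B P (element i) (element j))
      binary⁻ φ∈ with ∈-++⁻ (map unaryFact unaries) φ∈
      ... | inj₁ φ∈₁ with ∈-map⁻ unaryFact φ∈₁
      ...   | _ , _ , ()
      binary⁻ φ∈ | inj₂ φ∈₂ with ∈-map⁻ binaryFact φ∈₂
      ...   | (P , i , j) , ij∈ , refl = i , j , refl , refl ,
        ∈-filter⁻ (λ (P , i , j) → B? P (element i) (element j))
          {xs = cartesianProduct (allFin _) (cartesianProduct (allFin _) (allFin _))} ij∈ .proj₂

      element∈ : root ∈ nodes → ∀ i → element i ∈ nodes
      element∈ root∈ Fin.zero    = root∈
      element∈ root∈ (Fin.suc i) = ∈-lookup i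

      role⁺ : ∀ {L} (R : Role S L) i j → RoleHolds R (element i) (element j) →
              roleFact R (toℕ i) (toℕ j) ∈ presentation
      role⁺ (name P) i j p = binary⁺ i j p
      role⁺ (inv P)  i j p = binary⁺ j i p

      role⁻ : ∀ {L} (R : Role S L) i {b} → roleFact R (toℕ i) b ∈ presentation →
              ∃[ j ] (b ≡ toℕ j × RoleHolds R (element i) (element j))
      role⁻ (name P) i φ∈ with binary⁻ φ∈
      ... | k , j , i≡k , b≡j , p rewrite Fin.toℕ-injective i≡k = j , b≡j , p
      role⁻ (inv P) i φ∈ with binary⁻ φ∈
      ... | j , k , b≡j , i≡k , p rewrite Fin.toℕ-injective i≡k = j , b≡j , p

      holds⇒sat : ∀ {L} (c : Concept S L) i → Holds (element i) c → Sat presentation (toℕ i) c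
      holds⇒sat ⊤ᶜ       i p = tt
      holds⇒sat (atom A) i p = unary⁺ i p
      holds⇒sat (c ∧ᶜ d) i (p , q) = holds⇒sat c i p , holds⇒sat d i q
      holds⇒sat (∃ᶜ R c) i (y , y∈ , r , p) =
        toℕ j , role⁺ R i j (subst (RoleHolds R (element i)) y≡ r) ,
        holds⇒sat c j (subst (λ y → Holds y c) y≡ p)
        where
        j  = Fin.suc (Any.index y∈)
        y≡ : y ≡ element j
        y≡ = Any.lookup-index y∈

      -- An existential may be witnessed by the copy 0 of the root, while `Holds` quantifies over
      -- `nodes`; membership of the root bridges the two.
      sat⇒holds : root ∈ nodes → ∀ {L} (c : Concept S L) i → Sat presentation (toℕ i) c → Holds (element i) c
      sat⇒holds root∈ ⊤ᶜ       i p = tt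
      sat⇒holds root∈ (atom A) i p with unary⁻ p
      ... | j , i≡j , q rewrite Fin.toℕ-injective i≡j = q
      sat⇒holds root∈ (c ∧ᶜ d) i (p , q) = sat⇒holds root∈ c i p , sat⇒holds root∈ d i q
      sat⇒holds root∈ (∃ᶜ R c) i (b , φ∈ , p) with role⁻ R i φ∈
      ... | j , refl , r = element j , element∈ root∈ j , r , sat⇒holds root∈ c j p

      presentation-length : length presentation ≤
        #unary S * suc (length nodes) + #binary S * (suc (length nodes) * suc (length nodes))
      presentation-length = begin
        length (map unaryFact unaries ++ map binaryFact binaries)
          ≡⟨ trans (length-++ (map unaryFact unaries)) (cong₂ _+_ (length-map _ unaries) (length-map _ binaries)) ⟩
        length unaries + length binaries
          ≤⟨ +-mono-≤ (length-filter (λ (A , i) → U? A (element i)) (cartesianProduct (allFin u) (allFin n)))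
               (length-filter (λ (P , i , j) → B? P (element i) (element j))
                 (cartesianProduct (allFin b) (cartesianProduct (allFin n) (allFin n)))) ⟩
        length (cartesianProduct (allFin u) (allFin n)) +
        length (cartesianProduct (allFin b) (cartesianProduct (allFin n) (allFin n)))
          ≡⟨ cong₂ _+_ (product u n) (trans (length-cartesianProduct (allFin b) _)
               (cong₂ _*_ (length-tabulate {n = b} id) (product n n))) ⟩
        u * n + b * (n * n) ∎
        where
        open ≤-Reasoning
        u = #unary S
        b = #binary S
        n = suc (length nodes)
        product : ∀ m n → length (cartesianProduct (allFin m) (allFin n)) ≡ m * n
        product m n = trans (length-cartesianProduct (allFin m) (allFin n))
          (cong₂ _*_ (length-tabulate {n = m} id) (length-tabulate {n = n} id))

  -- Products of structures.

  module _ where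

    open Structure

    _⊗_ : Structure → Structure → Structure
    M ⊗ N = record
      { Node  = Node M × Node N
      ; nodes = cartesianProduct (nodes M) (nodes N)
      ; U     = λ A (x , y) → U M A x × U N A y
      ; U?    = λ A (x , y) → U? M A x ×-dec U? N A y
      ; B     = λ P (x , y) (x′ , y′) → B M P x x′ × B N P y y′
      ; B?    = λ P (x , y) (x′ , y′) → B? M P x x′ ×-dec B? N P y y′
      }

    module _ (M N : Structure) where

      ⊗-roleˡ : ∀ {L} (R : Role S L) {x x′ y y′} → RoleHolds (M ⊗ N) R (x , y) (x′ , y′) → RoleHolds M R x x′
      ⊗-roleˡ (name P) (p , _) = p
      ⊗-roleˡ (inv P)  (p , _) = p

      ⊗-roleʳ : ∀ {L} (R : Role S L) {x x′ y y′} → RoleHolds (M ⊗ N) R (x , y) (x′ , y′) → RoleHolds N R y y′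
      ⊗-roleʳ (name P) (_ , q) = q
      ⊗-roleʳ (inv P)  (_ , q) = q

      ⊗-role : ∀ {L} (R : Role S L) {x x′ y y′} → RoleHolds M R x x′ → RoleHolds N R y y′ →
               RoleHolds (M ⊗ N) R (x , y) (x′ , y′)
      ⊗-role (name P) p q = p , q
      ⊗-role (inv P)  p q = p , q

      ⊗-holds : ∀ {L} (c : Concept S L) {x y} → Holds M x c → Holds N y c → Holds (M ⊗ N) (x , y) c
      ⊗-holds ⊤ᶜ       p q = tt
      ⊗-holds (atom A) p q = p , q
      ⊗-holds (c ∧ᶜ d) (p , p′) (q , q′) = ⊗-holds c p q , ⊗-holds d p′ q′
      ⊗-holds (∃ᶜ R c) (x , x∈ , r , p) (y , y∈ , r′ , q) =
        (x , y) , ∈-cartesianProduct⁺ x∈ y∈ , ⊗-role R r r′ , ⊗-holds c p q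

      ⊗-holdsˡ : ∀ {L} (c : Concept S L) {x y} → Holds (M ⊗ N) (x , y) c → Holds M x c
      ⊗-holdsˡ ⊤ᶜ       p = tt
      ⊗-holdsˡ (atom A) p = p .proj₁
      ⊗-holdsˡ (c ∧ᶜ d) (p , q) = ⊗-holdsˡ c p , ⊗-holdsˡ d q
      ⊗-holdsˡ (∃ᶜ R c) ((x , y) , xy∈ , r , p) =
        x , ∈-cartesianProduct⁻ (nodes M) (nodes N) xy∈ .proj₁ , ⊗-roleˡ R r , ⊗-holdsˡ c p

      ⊗-holdsʳ : ∀ {L} (c : Concept S L) {x y} → Holds (M ⊗ N) (x , y) c → Holds N y c
      ⊗-holdsʳ ⊤ᶜ       p = tt
      ⊗-holdsʳ (atom A) p = p .proj₂
      ⊗-holdsʳ (c ∧ᶜ d) (p , q) = ⊗-holdsʳ c p , ⊗-holdsʳ d q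
      ⊗-holdsʳ (∃ᶜ R c) ((x , y) , xy∈ , r , p) =
        y , ∈-cartesianProduct⁻ (nodes M) (nodes N) xy∈ .proj₂ , ⊗-roleʳ R r , ⊗-holdsʳ c p

  _≟ʳ_ : ∀ {L} → DecidableEquality (Role S L)
  name P ≟ʳ name Q = map′ (cong name) (λ { refl → refl }) (P Fin.≟ Q)
  inv P  ≟ʳ inv Q  = map′ (cong inv) (λ { refl → refl }) (P Fin.≟ Q)
  name _ ≟ʳ inv _  = no λ ()
  inv _  ≟ʳ name _ = no λ ()

  _≟ᶜ_ : ∀ {L} → DecidableEquality (Concept S L)
  ⊤ᶜ ≟ᶜ ⊤ᶜ = yes refl
  ⊤ᶜ ≟ᶜ atom _ = no λ ()
  ⊤ᶜ ≟ᶜ (_ ∧ᶜ _) = no λ ()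
  ⊤ᶜ ≟ᶜ ∃ᶜ _ _ = no λ ()
  atom _ ≟ᶜ ⊤ᶜ = no λ ()
  atom A ≟ᶜ atom B = map′ (cong atom) (λ { refl → refl }) (A Fin.≟ B)
  atom _ ≟ᶜ (_ ∧ᶜ _) = no λ ()
  atom _ ≟ᶜ ∃ᶜ _ _ = no λ ()
  (_ ∧ᶜ _) ≟ᶜ ⊤ᶜ = no λ ()
  (_ ∧ᶜ _) ≟ᶜ atom _ = no λ ()
  (c ∧ᶜ d) ≟ᶜ (c′ ∧ᶜ d′) =
    map′ (λ (p , q) → cong₂ _∧ᶜ_ p q) (λ { refl → refl , refl }) (c ≟ᶜ c′ ×-dec d ≟ᶜ d′)
  (_ ∧ᶜ _) ≟ᶜ ∃ᶜ _ _ = no λ ()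
  ∃ᶜ _ _ ≟ᶜ ⊤ᶜ = no λ ()
  ∃ᶜ _ _ ≟ᶜ atom _ = no λ ()
  ∃ᶜ _ _ ≟ᶜ (_ ∧ᶜ _) = no λ ()
  ∃ᶜ R c ≟ᶜ ∃ᶜ R′ c′ =
    map′ (λ (p , q) → cong₂ ∃ᶜ p q) (λ { refl → refl , refl }) (R ≟ʳ R′ ×-dec c ≟ᶜ c′)

  _∈ᶜ?_ : ∀ {L} (c : Concept S L) cs → Dec (c ∈ cs)
  _∈ᶜ?_ = DecMembership._∈?_ _≟ᶜ_

  -- A split partner of `c` alone: the concepts that hold at some root are exactly those that do not
  -- entail `c`.
  record Dual {L} (c : Concept S L) : Set₁ where
    field
      structure : Structure
    open Structure structure public
    field
      roots    : List Node
      roots⊆   : ∀ {x} → x ∈ roots → x ∈ nodes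
      sound    : ∀ {x} → x ∈ roots → ¬ Holds x c
      complete : ∀ d → d ⇒ᶜ c ⊎ ∃[ x ] (x ∈ roots × Holds x d)

  -- The conjuncts other than ⊤ᶜ of a concept, and of its subconcepts.

  conjuncts : ∀ {L} → Concept S L → List (Concept S L)
  conjuncts ⊤ᶜ         = []
  conjuncts (c ∧ᶜ d)   = conjuncts c ++ conjuncts d
  conjuncts c@(atom _) = c ∷ []
  conjuncts c@(∃ᶜ _ _) = c ∷ []

  subs : ∀ {L} → Concept S L → List (Concept S L)
  subs ⊤ᶜ         = []
  subs (c ∧ᶜ d)   = subs c ++ subs d
  subs c@(atom _) = c ∷ []
  subs c@(∃ᶜ _ d) = c ∷ subs d

  conjuncts⊆subs : ∀ {L} (c : Concept S L) {x} → x ∈ conjuncts c → x ∈ subs c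
  conjuncts⊆subs (atom A) x∈ = x∈
  conjuncts⊆subs (c ∧ᶜ d) x∈ with ∈-++⁻ (conjuncts c) x∈
  ... | inj₁ x∈c = ∈-++⁺ˡ (conjuncts⊆subs c x∈c)
  ... | inj₂ x∈d = ∈-++⁺ʳ (subs c) (conjuncts⊆subs d x∈d)
  conjuncts⊆subs (∃ᶜ R c) (here eq) = here eq

  subs-∃ : ∀ {L} (c : Concept S L) {R d x} → ∃ᶜ R d ∈ subs c → x ∈ subs d → x ∈ subs c
  subs-∃ (atom A) (here ()) x∈
  subs-∃ (c ∧ᶜ d) e∈ x∈ with ∈-++⁻ (subs c) e∈
  ... | inj₁ e∈c = ∈-++⁺ˡ (subs-∃ c e∈c x∈)
  ... | inj₂ e∈d = ∈-++⁺ʳ (subs c) (subs-∃ d e∈d x∈)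
  subs-∃ (∃ᶜ R c) (here refl) x∈ = there x∈
  subs-∃ (∃ᶜ R c) (there e∈)  x∈ = there (subs-∃ c e∈ x∈)

  subs-length : ∀ {L} (c : Concept S L) → length (subs c) ≤ conceptSize c
  subs-length ⊤ᶜ       = z≤n
  subs-length (atom A) = s≤s z≤n
  subs-length (c ∧ᶜ d) = m≤n⇒m≤1+n (≤-trans (≤-reflexive (length-++ (subs c))) (+-mono-≤ (subs-length c) (subs-length d)))
  subs-length (∃ᶜ R c) = s≤s (m≤n⇒m≤1+n (subs-length c))

  conjuncts-length : ∀ {L} (c : Concept S L) → length (conjuncts c) ≤ conceptSize c
  conjuncts-length ⊤ᶜ       = z≤n
  conjuncts-length (atom A) = s≤s z≤n
  conjuncts-length (c ∧ᶜ d) =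
    m≤n⇒m≤1+n (≤-trans (≤-reflexive (length-++ (conjuncts c))) (+-mono-≤ (conjuncts-length c) (conjuncts-length d)))
  conjuncts-length (∃ᶜ R c) = s≤s z≤n

  conjuncts-suffice : ∀ {L} {d : Concept S L} c → (∀ {x} → x ∈ conjuncts c → d ⇒ᶜ x) → d ⇒ᶜ c
  conjuncts-suffice ⊤ᶜ       f A a p = tt
  conjuncts-suffice (atom A) f = f (here refl)
  conjuncts-suffice (c ∧ᶜ e) f A a p =
    conjuncts-suffice c (λ x∈ → f (∈-++⁺ˡ x∈)) A a p , conjuncts-suffice e (λ x∈ → f (∈-++⁺ʳ (conjuncts c) x∈)) A a p
  conjuncts-suffice (∃ᶜ R c) f = f (here refl)

  -- Duals for EL.  The node atom A lacks just A, the P-successors of a node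
  -- ∃P.d are the conjuncts of d; all other edges lead to ⊤ᶜ, which
  -- satisfies every concept.

  module ELDual (c : Concept S EL) where

    successors : Binary S → Concept S EL → List (Concept S EL)
    successors P (∃ᶜ (name Q) d) = if does (P Fin.≟ Q) then conjuncts d else ⊤ᶜ ∷ []
    successors P _               = ⊤ᶜ ∷ []

    M : Structure
    M = record
      { Node  = Concept S EL
      ; nodes = ⊤ᶜ ∷ subs c
      ; U     = λ A x → ¬ x ≡ atom A
      ; U?    = λ A x → ¬? (x ≟ᶜ atom A)
      ; B     = λ P x y → y ∈ successors P x
      ; B?    = λ P x y → y ∈ᶜ? successors P x
      }

    open Structure M

    top-holds : ∀ (d : Concept S EL) → Holds ⊤ᶜ d
    top-holds ⊤ᶜ              = tt
    top-holds (atom A)        = λ ()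
    top-holds (d ∧ᶜ e)        = top-holds d , top-holds e
    top-holds (∃ᶜ (name P) d) = ⊤ᶜ , here refl , here refl , top-holds d

    Fails : Concept S EL → Set
    Fails d = ∀ {x} → x ∈ conjuncts d → ¬ Holds x d

    -- For an existential, the successors along its role are the conjuncts of its filler, and each
    -- of them refutes the filler by induction.
    fails : ∀ d → Fails d
    fails (atom A) (here refl) p = p refl
    fails (d ∧ᶜ e) x∈ (p , q) with ∈-++⁻ (conjuncts d) x∈
    ... | inj₁ x∈d = fails d x∈d p
    ... | inj₂ x∈e = fails e x∈e q
    fails (∃ᶜ (name P) d) (here refl) (y , _ , y∈ , p) with P Fin.≟ P
    ... | yes _ = fails d y∈ p
    ... | no n  = n refl

    -- The case that matters is `∃P.d` at the node `∃P.e`: if `d` holds at no conjunct of `e`, then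
    -- by induction `d` entails all of them, so `∃P.d` entails `∃P.e`. In the other existential
    -- cases the edge to `⊤ᶜ` provides the witness.
    dichotomy : ∀ (d : Concept S EL) {x} → x ∈ subs c → Holds x d ⊎ d ⇒ᶜ x
    dichotomy ⊤ᶜ       x∈ = inj₁ tt
    dichotomy (atom A) {x} x∈ with x ≟ᶜ atom A
    ... | yes refl = inj₂ λ _ _ → id
    ... | no n     = inj₁ n
    dichotomy (d ∧ᶜ e) x∈ with dichotomy d x∈ | dichotomy e x∈
    ... | inj₁ p | inj₁ q = inj₁ (p , q)
    ... | inj₂ p | _      = inj₂ λ A a (r , _) → p A a r
    ... | _      | inj₂ q = inj₂ λ A a (_ , r) → q A a r
    dichotomy (∃ᶜ (name P) d) {⊤ᶜ}     x∈ = inj₁ (⊤ᶜ , here refl , here refl , top-holds d)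
    dichotomy (∃ᶜ (name P) d) {atom A} x∈ = inj₁ (⊤ᶜ , here refl , here refl , top-holds d)
    dichotomy (∃ᶜ (name P) d) {_ ∧ᶜ _} x∈ = inj₁ (⊤ᶜ , here refl , here refl , top-holds d)
    dichotomy (∃ᶜ (name P) d) {∃ᶜ (name Q) e} x∈ with P Fin.≟ Q
    ... | no _ = inj₁ (⊤ᶜ , here refl , here refl , top-holds d)
    ... | yes refl with any-or-all (conjuncts e) (λ y∈ → dichotomy d (subs-∃ c x∈ (conjuncts⊆subs e y∈)))
    ...   | inj₁ (y , y∈ , p) = inj₁ (y , there (subs-∃ c x∈ (conjuncts⊆subs e y∈)) , y∈ , p)
    ...   | inj₂ f = inj₂ λ A a (b , φ∈ , p) → b , φ∈ , conjuncts-suffice e f A b p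

    dual : Dual c
    dual = record
      { structure = M
      ; roots     = conjuncts c
      ; roots⊆    = λ x∈ → there (conjuncts⊆subs c x∈)
      ; sound     = fails c
      ; complete  = λ d → case any-or-all (conjuncts c) (λ x∈ → dichotomy d (conjuncts⊆subs c x∈)) of λ
          { (inj₁ p) → inj₂ p
          ; (inj₂ f) → inj₁ (conjuncts-suffice c f) }
      }

  -- Duals for ELI.  The nodes are the types over c: sets of those atoms
  -- and existential subconcepts that may hold at an individual.

  module ELIDual (c : Concept S ELI) where

    Type : Set
    Type = List (Concept S ELI)

    Mem : Concept S ELI → Type → Set
    Mem ⊤ᶜ         t = ⊤
    Mem (d ∧ᶜ e)   t = Mem d t × Mem e t
    Mem d@(atom _) t = d ∈ t
    Mem d@(∃ᶜ _ _) t = d ∈ t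

    mem? : ∀ d t → Dec (Mem d t)
    mem? ⊤ᶜ         t = yes tt
    mem? (d ∧ᶜ e)   t = mem? d t ×-dec mem? e t
    mem? d@(atom _) t = d ∈ᶜ? t
    mem? d@(∃ᶜ _ _) t = d ∈ᶜ? t

    -- An edge must not create a witness for an existential of `c` that is missing from `t`. Hence a
    -- node satisfies no subconcept of `c` beyond those its type allows (`holds⇒mem`).
    Respects : Role S ELI → Type → Type → Concept S ELI → Set
    Respects R t t′ (∃ᶜ R′ d) = R ≡ R′ → Mem d t′ → ∃ᶜ R′ d ∈ t
    Respects R t t′ _         = ⊤

    respects? : ∀ R t t′ d → Dec (Respects R t t′ d)
    respects? R t t′ ⊤ᶜ        = yes tt
    respects? R t t′ (atom _)  = yes tt
    respects? R t t′ (_ ∧ᶜ _)  = yes tt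
    respects? R t t′ (∃ᶜ R′ d) = (R ≟ʳ R′) →-dec (mem? d t′ →-dec (∃ᶜ R′ d ∈ᶜ? t))

    Compatible : Role S ELI → Type → Type → Set
    Compatible R t t′ = All (Respects R t t′) (subs c)

    M : Structure
    M = record
      { Node  = Type
      ; nodes = sublists (subs c)
      ; U     = λ A t → atom A ∈ subs c → atom A ∈ t
      ; U?    = λ A t → (atom A ∈ᶜ? subs c) →-dec (atom A ∈ᶜ? t)
      ; B     = λ P t t′ → Compatible (name P) t t′ × Compatible (inv P) t′ t
      ; B?    = λ P t t′ → All.all? (respects? (name P) t t′) (subs c) ×-dec All.all? (respects? (inv P) t′ t) (subs c)
      }

    open Structure M

    compatible : ∀ (R : Role S ELI) {t t′} → RoleHolds R t t′ → Compatible R t t′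
    compatible (name P) = proj₁
    compatible (inv P)  = proj₂

    holds⇒mem : ∀ d {t} → (∀ {x} → x ∈ subs d → x ∈ subs c) → Holds t d → Mem d t
    holds⇒mem ⊤ᶜ       d⊆ p = tt
    holds⇒mem (atom A) d⊆ p = p (d⊆ (here refl))
    holds⇒mem (d ∧ᶜ e) d⊆ (p , q) = holds⇒mem d (d⊆ ∘ ∈-++⁺ˡ) p , holds⇒mem e (d⊆ ∘ ∈-++⁺ʳ (subs d)) q
    holds⇒mem (∃ᶜ R d) d⊆ (t′ , _ , r , p) =
      All.lookup (compatible R r) (d⊆ (here refl)) refl (holds⇒mem d (d⊆ ∘ there) p)

    module _ (A : DataInstance S) where

      typeOf : Individual → Type
      typeOf a = filter (sat? A a) (subs c)

      typeOf∈ : ∀ a → typeOf a ∈ nodes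
      typeOf∈ a = filter∈sublists (sat? A a) (subs c)

      mem-typeOf : ∀ d {a} → Mem d (typeOf a) → Sat A a d
      mem-typeOf ⊤ᶜ       p = tt
      mem-typeOf (d ∧ᶜ e) (p , q) = mem-typeOf d p , mem-typeOf e q
      mem-typeOf (atom B) {a} p = ∈-filter⁻ (sat? A a) {xs = subs c} p .proj₂
      mem-typeOf (∃ᶜ R d) {a} p = ∈-filter⁻ (sat? A a) {xs = subs c} p .proj₂

      role-compatible : ∀ (R : Role S ELI) {a b} → roleFact R a b ∈ A → Compatible R (typeOf a) (typeOf b)
      role-compatible R {a} {b} φ∈ = All.tabulate respects
        where
        respects : ∀ {d} → d ∈ subs c → Respects R (typeOf a) (typeOf b) d
        respects {⊤ᶜ}     d∈ = tt
        respects {atom _} d∈ = tt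
        respects {_ ∧ᶜ _} d∈ = tt
        respects {∃ᶜ _ d} d∈ refl p = ∈-filter⁺ (sat? A a) d∈ (b , φ∈ , mem-typeOf d p)

      -- `typeOf` is a homomorphism from `A` into `M`, and homomorphisms preserve all concepts, not
      -- just the subconcepts of `c`.
      sat⇒holds-typeOf : ∀ d {a} → Sat A a d → Holds (typeOf a) d
      sat⇒holds-typeOf ⊤ᶜ       p = tt
      sat⇒holds-typeOf (d ∧ᶜ e) (p , q) = sat⇒holds-typeOf d p , sat⇒holds-typeOf e q
      sat⇒holds-typeOf (atom B) {a} p = λ B∈ → ∈-filter⁺ (sat? A a) B∈ p
      sat⇒holds-typeOf (∃ᶜ R d) (b , φ∈ , p) = typeOf b , typeOf∈ b , roles R φ∈ , sat⇒holds-typeOf d p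
        where
        roles : ∀ (R : Role S ELI) {a b} → roleFact R a b ∈ A → RoleHolds R (typeOf a) (typeOf b)
        roles (name P) φ∈ = role-compatible (name P) φ∈ , role-compatible (inv P) φ∈
        roles (inv P)  φ∈ = role-compatible (name P) φ∈ , role-compatible (inv P) φ∈

    dual : Dual c
    dual = record
      { structure = M
      ; roots     = filter (λ t → ¬? (mem? c t)) nodes
      ; roots⊆    = λ t∈ → ∈-filter⁻ (λ t → ¬? (mem? c t)) t∈ .proj₁
      ; sound     = λ t∈ p → ∈-filter⁻ (λ t → ¬? (mem? c t)) {xs = nodes} t∈ .proj₂ (holds⇒mem c id p)
      ; complete  = complete
      }
      where
      complete : ∀ d → d ⇒ᶜ c ⊎ ∃[ t ] (t ∈ filter (λ t → ¬? (mem? c t)) nodes × Holds t d)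
      complete d with sat? (tree d) 0 c
      ... | yes p = inj₁ λ A a q → tree-least d c q p
      ... | no n  = inj₂ (typeOf (tree d) 0 ,
        ∈-filter⁺ (λ t → ¬? (mem? c t)) (typeOf∈ (tree d) 0) (n ∘ mem-typeOf (tree d) c) ,
        sat⇒holds-typeOf (tree d) d (tree-sat d))

-- From words back to queries and example sets.

module Characterisation {S : Signature} {L : Language} (dualOf : ∀ c → Dual {S} {L} c) where

  open Dual using (structure; roots; roots⊆; sound; complete; nodes)
  open Structure.Presentation

  sat-ind : ∀ {A : DataInstance S} {a} (c : Concept S L) → Sat A a c → a ∈ ind A ⊎ Sat {S} [] 0 c
  sat-ind ⊤ᶜ       p = inj₂ tt
  sat-ind (atom B) p = inj₁ (fact-ind p (here refl))
  sat-ind (c ∧ᶜ d) (p , q) with sat-ind c p | sat-ind d q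
  ... | inj₁ a∈ | _       = inj₁ a∈
  ... | inj₂ _  | inj₁ a∈ = inj₁ a∈
  ... | inj₂ p  | inj₂ q  = inj₂ (p , q)
  sat-ind (∃ᶜ R c) (b , φ∈ , _) = inj₁ (role-indˡ R φ∈)

  dualLetters : Concept S L → Concept S L → List (DataInstance S × Individual)
  dualLetters a b =
    map (λ xy → presentation (structure (dualOf a) ⊗ structure (dualOf b)) xy , 0)
        (cartesianProduct (roots (dualOf a)) (roots (dualOf b)))

  dual-view : ∀ a b {x} → x ∈ dualLetters a b →
    ∃[ y ] ∃[ z ] (y ∈ roots (dualOf a) × z ∈ roots (dualOf b) ×
                   x ≡ (presentation (structure (dualOf a) ⊗ structure (dualOf b)) (y , z) , 0))
  dual-view a b x∈ with ∈-map⁻ (λ xy → presentation (structure (dualOf a) ⊗ structure (dualOf b)) xy , 0) x∈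
  ... | (y , z) , yz∈ , eq with ∈-cartesianProduct⁻ (roots (dualOf a)) (roots (dualOf b)) yz∈
  ...   | y∈ , z∈ = y , z , y∈ , z∈ , eq

  dual-root : ∀ a b {y z} → y ∈ roots (dualOf a) → z ∈ roots (dualOf b) →
              (y , z) ∈ Structure.nodes (structure (dualOf a) ⊗ structure (dualOf b))
  dual-root a b y∈ z∈ = ∈-cartesianProduct⁺ (roots⊆ (dualOf a) y∈) (roots⊆ (dualOf b) z∈)

  alphabet : Alphabet
  alphabet = record
    { C = Concept S L
    ; Letter = DataInstance S × Individual
    ; _⊩_ = λ (A , a) c → Sat A a c
    ; _⊩?_ = λ (A , a) c → sat? A a c
    ; can = λ c → tree c , 0
    ; can-⊩ = tree-sat
    ; can-least = λ {c} {d} → tree-least c d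
    ; ε = [] , 0
    ; ε-least = λ {c} {(A , a)} → hom-sat {h = λ _ → a} c λ ()
    ; full = loops , 0
    ; full-⊩ = loops-sat
    ; nontrivial = nontrivial-concept L
    ; dual = dualLetters
    ; dual-⊮ˡ = λ {a} {b} → dual-⊮ˡ a b
    ; dual-⊮ʳ = λ {a} {b} → dual-⊮ʳ a b
    ; dual-complete = λ {a} {b} {c} → dual-complete a b c
    }
    where
    dual-⊮ˡ : ∀ a b {x} → x ∈ dualLetters a b → ¬ Sat (x .proj₁) (x .proj₂) a
    dual-⊮ˡ a b x∈ p with dual-view a b x∈
    ... | y , z , y∈ , z∈ , refl = sound (dualOf a) y∈
      (⊗-holdsˡ (structure (dualOf a)) (structure (dualOf b)) a (sat⇒holds _ (y , z) (dual-root a b y∈ z∈) a Fin.zero p))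
    dual-⊮ʳ : ∀ a b {x} → x ∈ dualLetters a b → ¬ Sat (x .proj₁) (x .proj₂) b
    dual-⊮ʳ a b x∈ p with dual-view a b x∈
    ... | y , z , y∈ , z∈ , refl = sound (dualOf b) z∈
      (⊗-holdsʳ (structure (dualOf a)) (structure (dualOf b)) b (sat⇒holds _ (y , z) (dual-root a b y∈ z∈) b Fin.zero p))
    dual-complete : ∀ a b c → ¬ Sat (tree c) 0 a → ¬ Sat (tree c) 0 b →
                    ∃[ x ] (x ∈ dualLetters a b × Sat (x .proj₁) (x .proj₂) c)
    dual-complete a b c m n with complete (dualOf a) c | complete (dualOf b) c
    ... | inj₁ p | _      = ⊥-elim (m (p (tree c) 0 (tree-sat c)))
    ... | _      | inj₁ q = ⊥-elim (n (q (tree c) 0 (tree-sat c)))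
    ... | inj₂ (y , y∈ , p) | inj₂ (z , z∈ , q) =
      _ , ∈-map⁺ _ (∈-cartesianProduct⁺ y∈ z∈) ,
      holds⇒sat (structure (dualOf a) ⊗ structure (dualOf b)) (y , z) c Fin.zero (⊗-holds (structure (dualOf a)) (structure (dualOf b)) c p q)

  open Alphabet alphabet using (Letter; _⊩_; can; full; dual)
  open Temporal alphabet

  guard : Guard S L → Maybe (Concept S L)
  guard ⊥ᵍ    = nothing
  guard ⌜ c ⌝ = just c

  steps : Query S L → List Step
  steps (core r)      = []
  steps (until r l q) = (guard l , first q) ∷ steps q

  word : List (DataInstance S) → Individual → ℕ → Word
  word As       a zero    = map (_, a) As
  word []       a (suc ℓ) = []
  word (_ ∷ As) a (suc ℓ) = word As a ℓ

  tl-word : ∀ As a ℓ → tl (word As a ℓ) ≡ word As a (suc ℓ)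
  tl-word []       a zero    = refl
  tl-word (A ∷ As) a zero    = refl
  tl-word []       a (suc ℓ) = refl
  tl-word (A ∷ As) a (suc ℓ) = tl-word As a ℓ

  sat-word : ∀ As a ℓ c → Iff (Sat (at As ℓ) a c) (hd (word As a ℓ) ⊩ c)
  sat-word []       a zero    c = hom-sat {h = λ _ → 0} c (λ ()) , hom-sat {h = λ _ → a} c (λ ())
  sat-word (A ∷ As) a zero    c = id , id
  sat-word []       a (suc ℓ) c = hom-sat {h = λ _ → 0} c (λ ()) , hom-sat {h = λ _ → a} c (λ ())
  sat-word (A ∷ As) a (suc ℓ) c = sat-word As a ℓ c

  module _ (D : TemporalInstance S) (a : Individual) where

    suffix : ℕ → Word
    suffix = word (toList D) a

    concept-suffix : ∀ c ℓ → Iff (concept⊨ c D a ℓ) (hd (suffix ℓ) ⊩ c)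
    concept-suffix c ℓ =
      sat-word (toList D) a ℓ c .proj₁ ∘ concept-sat c D a ℓ .proj₁ ,
      concept-sat c D a ℓ .proj₂ ∘ sat-word (toList D) a ℓ c .proj₂

    guard-suffix : ∀ l ℓ → Iff (guard⊨ l D a ℓ) (hd (suffix ℓ) ⊩ᵍ guard l)
    guard-suffix ⊥ᵍ    ℓ = id , id
    guard-suffix ⌜ c ⌝ ℓ = concept-suffix c ℓ

    until-extend : ∀ {l Q} w → hd w ⊩ᵍ l → Until l Q (tl w) → Until l Q w
    until-extend []      p q = q
    until-extend (y ∷ w) p q = inj₂ (p , q)

    -- Induction on the number `d` of skipped letters; the suffix begins at time `suc ℓ`, so the
    -- target lies at `d + suc ℓ`.
    until⁺ : ∀ l {Q} d ℓ → Q (suffix (d + suc ℓ)) →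
             (∀ k → ℓ < k → k < d + suc ℓ → guard⊨ l D a k) → Until (guard l) Q (suffix (suc ℓ))
    until⁺ l zero    ℓ q g = until-now (suffix (suc ℓ)) q
    until⁺ l {Q} (suc d) ℓ q g = until-extend (suffix (suc ℓ))
      (guard-suffix l (suc ℓ) .proj₁ (g (suc ℓ) ≤-refl (s≤s (m≤n+m (suc ℓ) d))))
      (subst (Until (guard l) Q) (sym (tl-word (toList D) a (suc ℓ)))
        (until⁺ l d (suc ℓ) (subst (Q ∘ suffix) (sym (+-suc d (suc ℓ))) q)
          λ k ℓ<k k<m → g k (<-trans (n<1+n ℓ) ℓ<k) (subst (k <_) (+-suc d (suc ℓ)) k<m)))

    until⁻ : ∀ l {Q} w ℓ → w ≡ suffix (suc ℓ) → Until (guard l) Q w →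
             ∃[ m ] (ℓ < m × Q (suffix m) × (∀ k → ℓ < k → k < m → guard⊨ l D a k))
    until⁻ l {Q} [] ℓ eq p =
      suc ℓ , ≤-refl , subst Q eq p , λ k ℓ<k k<m → ⊥-elim (<-irrefl refl (≤-trans ℓ<k (≤-pred k<m)))
    until⁻ l {Q} (y ∷ w) ℓ eq (inj₁ p) =
      suc ℓ , ≤-refl , subst Q eq p , λ k ℓ<k k<m → ⊥-elim (<-irrefl refl (≤-trans ℓ<k (≤-pred k<m)))
    until⁻ l {Q} (y ∷ w) ℓ eq (inj₂ (p , q))
      with until⁻ l w (suc ℓ) (trans (cong tl eq) (tl-word (toList D) a (suc ℓ))) q
    ... | m , ℓ<m , q′ , g = m , <-trans (n<1+n ℓ) ℓ<m , q′ , between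
      where
      between : ∀ k → ℓ < k → k < m → guard⊨ l D a k
      between k ℓ<k k<m with m≤n⇒m<n∨m≡n ℓ<k
      ... | inj₁ lt   = g k lt k<m
      ... | inj₂ refl = guard-suffix l (suc ℓ) .proj₂ (subst (λ w → hd w ⊩ᵍ guard l) eq p)

    query-suffix : ∀ q ℓ → Iff (query⊨ q D a ℓ) (Next (first q) (steps q) (suffix ℓ))
    query-suffix (core r) ℓ =
      (λ p → concept-suffix r ℓ .proj₁ p , tt) , (λ (p , _) → concept-suffix r ℓ .proj₂ p)
    query-suffix (until r l q) ℓ = to , from
      where
      to : query⊨ (until r l q) D a ℓ → Next r (steps (until r l q)) (suffix ℓ)
      to (p , m , ℓ<m , q′ , g) = concept-suffix r ℓ .proj₁ p ,
        subst (Tail (steps (until r l q))) (sym (tl-word (toList D) a ℓ))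
          (until⁺ l (m ∸ suc ℓ) ℓ
            (subst (Next (first q) (steps q) ∘ suffix) (sym (m∸n+n≡m ℓ<m)) (query-suffix q m .proj₁ q′))
            λ k ℓ<k k<m → g k ℓ<k (subst (k <_) (m∸n+n≡m ℓ<m) k<m))
      from : Next r (steps (until r l q)) (suffix ℓ) → query⊨ (until r l q) D a ℓ
      from (p , t) with until⁻ l (suffix (suc ℓ)) ℓ refl
                          (subst (Tail (steps (until r l q))) (tl-word (toList D) a ℓ) t)
      ... | m , ℓ<m , q′ , g = concept-suffix r ℓ .proj₂ p , m , ℓ<m , query-suffix q m .proj₂ q′ , g

  equivalent-queries : ∀ q q′ → (∀ w → Iff (Next (first q) (steps q) w) (Next (first q′) (steps q′) w)) → q ≣ q′
  equivalent-queries q q′ eq =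
    (λ D a ℓ p → query-suffix D a q′ ℓ .proj₂ (eq (suffix D a ℓ) .proj₁ (query-suffix D a q ℓ .proj₁ p))) ,
    (λ D a ℓ p → query-suffix D a q ℓ .proj₂ (eq (suffix D a ℓ) .proj₂ (query-suffix D a q′ ℓ .proj₁ p)))

  peerless-steps : ∀ q → 𝒫 S L q → Peerless (steps q)
  peerless-steps (core r)      p       = []
  peerless-steps (until r l q) (p , ps) = peer l p ∷ peerless-steps q ps
    where
    entails : ∀ c d → Sat (tree c) 0 d → core c ⊨ core d
    entails c d e D a ℓ p = concept-sat d D a ℓ .proj₂ (tree-least c d (concept-sat c D a ℓ .proj₁ p) e)
    peer : ∀ l → PeerlessStep l (first q) → Peer (guard l) (first q)
    peer ⊥ᵍ    p       = tt
    peer ⌜ c ⌝ (m , n) = m ∘ entails c (first q) , n ∘ entails (first q) c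

  Pointed : Word → Set
  Pointed = All λ x → x .proj₂ ≡ 0

  pointed-word : ∀ {w} → Pointed w → word (map proj₁ w) 0 0 ≡ w
  pointed-word []          = refl
  pointed-word (refl ∷ ps) = cong (_ ∷_) (pointed-word ps)

  visible-ind : ∀ {w} → Pointed w → Visible w → 0 ∈ concatMap ind (map proj₁ w)
  visible-ind {x ∷ w} (refl ∷ _) (here (c , p , n)) with sat-ind c p
  ... | inj₁ 0∈ = ∈-concatMap⁺ ind {xs = map proj₁ (x ∷ w)} (here 0∈)
  ... | inj₂ q  = ⊥-elim (n q)
  visible-ind {x ∷ w} (refl ∷ ps) (there v) with find (∈-concatMap⁻ ind {xs = map proj₁ w} (visible-ind ps v))
  ... | A , A∈ , 0∈ = ∈-concatMap⁺ ind {xs = map proj₁ (x ∷ w)} (there (lose A∈ 0∈))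

  toExample : ∀ w → Pointed w → Visible w → Example S
  toExample w@(x ∷ w′) ps v = example (x .proj₁ ∷⁺ map proj₁ w′) 0 (visible-ind ps v)

  satisfies-word : ∀ q w ps v → Iff (Satisfies q (toExample w ps v)) (Next (first q) (steps q) w)
  satisfies-word q w@(x ∷ w′) ps v =
    subst (Next (first q) (steps q)) (pointed-word ps) ∘ query-suffix (x .proj₁ ∷⁺ map proj₁ w′) 0 q 0 .proj₁ ,
    query-suffix (x .proj₁ ∷⁺ map proj₁ w′) 0 q 0 .proj₂ ∘ subst (Next (first q) (steps q)) (sym (pointed-word ps))

  satisfies? : ∀ (q : Query S L) e → Dec (Satisfies q e)
  satisfies? q e = map′ (query-suffix (instance-of e) (point e) q 0 .proj₂) (query-suffix (instance-of e) (point e) q 0 .proj₁)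
    (next? (first q) (steps q) (suffix (instance-of e) (point e) 0))

  sum-bound : ∀ {A : Set} (f : A → ℕ) b xs → (∀ {x} → x ∈ xs → f x ≤ b) → sum (map f xs) ≤ length xs * b
  sum-bound f b []       h = z≤n
  sum-bound f b (x ∷ xs) h = +-mono-≤ (h (here refl)) (sum-bound f b xs (h ∘ there))

  split : Query S L → List (Example S) → ExampleSet S
  split q es = examples (filter (satisfies? q) es) (filter (¬? ∘ satisfies? q) es)

  split-fits : ∀ q es → Fits q (split q es)
  split-fits q es = All.all-filter (satisfies? q) es , All.all-filter (¬? ∘ satisfies? q) es

  split-agree : ∀ (q q′ : Query S L) es → Fits q′ (split q es) → ∀ {e} → e ∈ es → Iff (Satisfies q e) (Satisfies q′ e)
  split-agree q q′ es (pos , neg) {e} e∈ =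
    (λ p → All.lookup pos (∈-filter⁺ (satisfies? q) e∈ p)) ,
    (λ p′ → decidable-stable (satisfies? q e) λ ¬p →
      All.lookup neg (∈-filter⁺ (¬? ∘ satisfies? q) e∈ ¬p) p′)

  split-size : ∀ q es b → (∀ {e} → e ∈ es → sizeT (instance-of e) ≤ b) → ∣ split q es ∣ᴱ ≤ 2 * (length es * b)
  split-size q es b h = begin
    ∣ split q es ∣ᴱ                                          ≤⟨ sum-bound _ b (pos ++ neg) bounded ⟩
    length (pos ++ neg) * b                                  ≡⟨ cong (_* b) (length-++ pos) ⟩
    (length pos + length neg) * b
      ≤⟨ *-monoˡ-≤ b (+-mono-≤ (length-filter (satisfies? q) es) (length-filter (¬? ∘ satisfies? q) es)) ⟩
    (length es + length es) * b                              ≡⟨ *-distribʳ-+ b (length es) (length es) ⟩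
    length es * b + length es * b                            ≡⟨ cong (length es * b +_) (+-identityʳ (length es * b)) ⟨
    2 * (length es * b)                                      ∎
    where
    open ≤-Reasoning
    pos = filter (satisfies? q) es
    neg = filter (¬? ∘ satisfies? q) es
    bounded : ∀ {e} → e ∈ pos ++ neg → sizeT (instance-of e) ≤ b
    bounded e∈ with ∈-++⁻ pos e∈
    ... | inj₁ e∈₁ = h (∈-filter⁻ (satisfies? q) e∈₁ .proj₁)
    ... | inj₂ e∈₂ = h (∈-filter⁻ (¬? ∘ satisfies? q) e∈₂ .proj₁)

  Testable : Word → Set
  Testable w = Pointed w × Visible w

  examplesOf : ∀ {ws} → All Testable ws → List (Example S)
  examplesOf {[]}     []             = []
  examplesOf {w ∷ ws} ((p , v) ∷ ts) = toExample w p v ∷ examplesOf ts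

  examplesOf⁺ : ∀ {w ws} (ts : All Testable ws) → w ∈ ws → ∃[ p ] ∃[ v ] toExample w p v ∈ examplesOf ts
  examplesOf⁺ ((p , v) ∷ ts) (here refl) = p , v , here refl
  examplesOf⁺ ((p , v) ∷ ts) (there w∈) with examplesOf⁺ ts w∈
  ... | p′ , v′ , e∈ = p′ , v′ , there e∈

  examplesOf⁻ : ∀ {e ws} (ts : All Testable ws) → e ∈ examplesOf ts →
                ∃[ w ] (w ∈ ws × ∃[ p ] ∃[ v ] e ≡ toExample w p v)
  examplesOf⁻ {ws = w ∷ _} ((p , v) ∷ ts) (here refl) = w , here refl , p , v , refl
  examplesOf⁻ (_ ∷ ts) (there e∈) with examplesOf⁻ ts e∈
  ... | w , w∈ , r = w , there w∈ , r

  examplesOf-length : ∀ {ws} (ts : All Testable ws) → length (examplesOf ts) ≡ length ws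
  examplesOf-length []       = refl
  examplesOf-length (_ ∷ ts) = cong suc (examplesOf-length ts)

  module _ (q : Query S L) (peerless : 𝒫 S L q) where

    open Trimming (trimming (steps q))

    q-tests : List Word
    q-tests = tests (first q) trim

    -- Both queries are compared through their trimmed tails: only after trimming do the accepted
    -- words determine the number of steps.
    unique : (ts : All Testable q-tests) → UniquelyCharacterises (split q (examplesOf ts)) q (𝒬 S L)
    unique ts = split-fits q (examplesOf ts) , λ q′ _ fits → equivalent-queries q q′ (same q′ fits)
      where
      same : ∀ (q′ : Query S L) → Fits q′ (split q (examplesOf ts)) →
             ∀ w → Iff (Next (first q) (steps q) w) (Next (first q′) (steps q′) w)
      same q′ fits w =
        (λ (p , t) → let p′ , t′ = characters w .proj₁ (p , trim-to (tl w) t) in p′ , T′.trim-from (tl w) t′) ,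
        (λ (p , t) → let p′ , t′ = characters w .proj₂ (p , T′.trim-to (tl w) t) in p′ , trim-from (tl w) t′)
        where
        module T′ = Trimming (trimming (steps q′))
        agree : AgreeOn q-tests ((nothing , first q) ∷ trim) ((nothing , first q′) ∷ T′.trim)
        agree {w} w∈ with examplesOf⁺ ts w∈
        ... | p , v , e∈ = to , from
          where
          e = toExample w p v
          iff = split-agree q q′ (examplesOf ts) fits e∈
          to : Tail ((nothing , first q) ∷ trim) w → Tail ((nothing , first q′) ∷ T′.trim) w
          to t with until-next w t
          ... | r , u with satisfies-word q′ w p v .proj₁
                             (iff .proj₁ (satisfies-word q w p v .proj₂ (r , trim-from (tl w) u)))
          ...   | r′ , u′ = until-now w (r′ , T′.trim-to (tl w) u′)
          from : Tail ((nothing , first q′) ∷ T′.trim) w → Tail ((nothing , first q) ∷ trim) w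
          from t with until-next w t
          ... | r , u with satisfies-word q w p v .proj₁
                             (iff .proj₂ (satisfies-word q′ w p v .proj₂ (r , T′.trim-from (tl w) u)))
          ...   | r′ , u′ = until-now w (r′ , trim-to (tl w) u′)
        characters = characterised (first q) trim (first q′) T′.trim
          (All.tabulate λ st∈ → All.lookup (peerless-steps q peerless) (trim-⊆ st∈))
          trimmed T′.trimmed agree

  -- Size of the characterising example set.

  module Bound (N ν : ℕ) (1≤ν : 1 ≤ ν)
    (nodes-few : ∀ c → conceptSize c ≤ N → length (nodes (dualOf c)) ≤ ν)
    (roots-few : ∀ c → conceptSize c ≤ N → length (roots (dualOf c)) ≤ ν) where

    -- `N` accounts for canonical letters. A product of two duals with at most `ν` nodes each has,
    -- with the copy of its root, at most 1 + ν² individuals, hence at most the square of that many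
    -- facts per predicate symbol.
    letterSize : ℕ
    letterSize = N + (#unary S + #binary S) * (suc (ν * ν) * suc (ν * ν))

    Small : Letter → Set
    Small (A , a) = a ≡ 0 × length A ≤ letterSize

    1≤ν² : 1 ≤ ν * ν
    1≤ν² = *-mono-≤ 1≤ν 1≤ν

    small-can : ∀ c → conceptSize c ≤ N → Small (can c)
    small-can c le = refl , ≤-trans (tree-length c) (≤-trans le (m≤m+n N _))

    small-full : Small full
    small-full = refl , (begin
      length (loops {S})                    ≡⟨ loops-length {S} ⟩
      #unary S + #binary S                  ≤⟨ m≤m*n (#unary S + #binary S) (suc (ν * ν) * suc (ν * ν)) ⟩
      (#unary S + #binary S) * (suc (ν * ν) * suc (ν * ν))  ≤⟨ m≤n+m _ N ⟩
      letterSize                            ∎)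
      where open ≤-Reasoning

    small-dual : ∀ a b → conceptSize a ≤ N → conceptSize b ≤ N → ∀ {x} → x ∈ dual a b → Small x
    small-dual a b a≤ b≤ x∈ with dual-view a b x∈
    ... | y , z , _ , _ , refl = refl , (begin
      length (presentation M (y , z))
        ≤⟨ presentation-length M (y , z) ⟩
      u * suc k + v * (suc k * suc k)
        ≤⟨ +-mono-≤ (*-monoʳ-≤ u (≤-trans k≤ (m≤m*n (suc (ν * ν)) (suc (ν * ν))))) (*-monoʳ-≤ v (*-mono-≤ k≤ k≤)) ⟩
      u * (suc (ν * ν) * suc (ν * ν)) + v * (suc (ν * ν) * suc (ν * ν))
        ≡⟨ *-distribʳ-+ (suc (ν * ν) * suc (ν * ν)) u v ⟨
      (u + v) * (suc (ν * ν) * suc (ν * ν))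
        ≤⟨ m≤n+m _ N ⟩
      letterSize ∎)
      where
      open ≤-Reasoning
      M = structure (dualOf a) ⊗ structure (dualOf b)
      u = #unary S
      v = #binary S
      k = length (Structure.nodes M)
      k≤ : suc k ≤ suc (ν * ν)
      k≤ = s≤s (≤-trans (≤-reflexive (length-cartesianProduct (nodes (dualOf a)) (nodes (dualOf b))))
                 (*-mono-≤ (nodes-few a a≤) (nodes-few b b≤)))

    few-dual : ∀ a b → conceptSize a ≤ N → conceptSize b ≤ N → length (dual a b) ≤ ν * ν
    few-dual a b a≤ b≤ = ≤-trans
      (≤-reflexive (trans (length-map _ (cartesianProduct (roots (dualOf a)) (roots (dualOf b))))
        (length-cartesianProduct (roots (dualOf a)) (roots (dualOf b)))))
      (*-mono-≤ (roots-few a a≤) (roots-few b b≤))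

    open Size Small small-full (ν * ν) 1≤ν²

    sized : ∀ l r → guardSize l ≤ N → conceptSize r ≤ N → Sized (guard l , r)
    sized ⊥ᵍ r l≤ r≤ = record
      { core-small  = small-can r r≤
      ; guard-small = λ ()
      ; dual-small  = small-dual r r r≤ r≤
      ; dual¹-small = λ { (here refl) → small-full }
      ; dual²-small = small-dual r r r≤ r≤
      ; dual-few    = few-dual r r r≤ r≤
      ; dual¹-few   = 1≤ν²
      ; dual²-few   = few-dual r r r≤ r≤
      }
    sized ⌜ l ⌝ r l≤ r≤ = record
      { core-small  = small-can r r≤
      ; guard-small = λ { refl → small-can l l≤ }
      ; dual-small  = small-dual r r r≤ r≤
      ; dual¹-small = small-dual l l l≤ l≤
      ; dual²-small = small-dual l r l≤ r≤
      ; dual-few    = few-dual r r r≤ r≤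
      ; dual¹-few   = few-dual l l l≤ l≤
      ; dual²-few   = few-dual l r l≤ r≤
      }

    1≤guardSize : ∀ (l : Guard S L) → 1 ≤ guardSize l
    1≤guardSize ⊥ᵍ             = ≤-refl
    1≤guardSize ⌜ ⊤ᶜ ⌝         = s≤s z≤n
    1≤guardSize ⌜ atom _ ⌝     = s≤s z≤n
    1≤guardSize ⌜ _ ∧ᶜ _ ⌝     = s≤s z≤n
    1≤guardSize ⌜ ∃ᶜ _ _ ⌝     = s≤s z≤n

    first-size : ∀ (q : Query S L) → conceptSize (first q) ≤ querySize q
    first-size (core r)      = ≤-refl
    first-size (until r l q) = ≤-trans (m≤n+m (conceptSize r) 2) (≤-trans (m≤m+n _ (guardSize l)) (m≤m+n _ (querySize q)))

    tail-size : ∀ r l (q : Query S L) → suc (querySize q) ≤ querySize (until r l q)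
    tail-size r l q = s≤s (m≤n⇒m≤1+n (m≤n+m (querySize q) (conceptSize r + guardSize l)))

    guard-size : ∀ r l (q : Query S L) → guardSize l ≤ querySize (until r l q)
    guard-size r l q = ≤-trans (m≤n+m (guardSize l) (2 + conceptSize r)) (m≤m+n _ (querySize q))

    sized-steps : ∀ (q : Query S L) → querySize q ≤ N → All Sized (steps q)
    sized-steps (core r)      le = []
    sized-steps (until r l q) le = sized l (first q) (≤-trans (guard-size r l q) le) (≤-trans (first-size q) le′) ∷
                                   sized-steps q le′
      where le′ = ≤-trans (n≤1+n _) (≤-trans (tail-size r l q) le)

    length-steps : ∀ (q : Query S L) → suc (length (steps q)) ≤ querySize q
    length-steps (core r)      = 1≤guardSize ⌜ r ⌝
    length-steps (until r l q) = ≤-trans (s≤s (length-steps q)) (tail-size r l q)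

    characterisable : ∀ q → 𝒫 S L q → querySize q ≤ N →
      ∃[ E ] (UniquelyCharacterises {S} E q (𝒬 S L) ×
              ∣ E ∣ᴱ ≤ 2 * ((3 + N * (4 * (ν * ν))) * (suc N * suc N * letterSize)))
    characterisable q peerless q≤N = split q (examplesOf ts) , unique q peerless ts , (begin
      ∣ split q (examplesOf ts) ∣ᴱ
        ≤⟨ split-size q (examplesOf ts) (suc N * suc N * letterSize) small ⟩
      2 * (length (examplesOf ts) * (suc N * suc N * letterSize))
        ≤⟨ *-monoʳ-≤ 2 (*-monoˡ-≤ (suc N * suc N * letterSize) few) ⟩
      2 * ((3 + N * (4 * (ν * ν))) * (suc N * suc N * letterSize)) ∎)
      where
      open ≤-Reasoning
      open Trimming (trimming (steps q))
      z : Sized (nothing , first q)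
      z = sized ⊥ᵍ (first q) (≤-trans (≤-trans (s≤s z≤n) (length-steps q)) q≤N) (≤-trans (first-size q) q≤N)
      zs : All Sized trim
      zs = All.tabulate λ st∈ → All.lookup (sized-steps q q≤N) (trim-⊆ st∈)
      m≤N : suc (length trim) ≤ N
      m≤N = ≤-trans (s≤s trim-length) (≤-trans (length-steps q) q≤N)
      moderate : ∀ {w} → w ∈ q-tests q peerless → Moderate (suc (length trim)) w
      moderate = tests-moderate (first q) trim z zs trimmed
      ts : All Testable (q-tests q peerless)
      ts = All.tabulate λ w∈ → All.map proj₁ (moderate w∈ .proj₂ .proj₁) , moderate w∈ .proj₂ .proj₂
      few : length (examplesOf ts) ≤ 3 + N * (4 * (ν * ν))
      few = ≤-trans (≤-reflexive (examplesOf-length ts))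
        (≤-trans (tests-few (first q) trim z zs) (s≤s (s≤s (s≤s (*-monoˡ-≤ (4 * (ν * ν)) m≤N)))))
      word-size : ∀ w p v → sizeT (instance-of (toExample w p v)) ≡ sum (map (length ∘ proj₁) w)
      word-size (x ∷ w) p v = cong (λ ns → length (x .proj₁) + sum ns) (sym (map-∘ w))
      small : ∀ {e} → e ∈ examplesOf ts → sizeT (instance-of e) ≤ suc N * suc N * letterSize
      small e∈ with examplesOf⁻ ts e∈
      ... | w , w∈ , p , v , refl with moderate w∈
      ...   | len , sm , _ = begin
        sizeT (instance-of (toExample w p v))  ≡⟨ word-size w p v ⟩
        sum (map (length ∘ proj₁) w)           ≤⟨ sum-bound _ letterSize w (λ x∈ → All.lookup sm x∈ .proj₂) ⟩
        length w * letterSize                  ≤⟨ *-monoˡ-≤ letterSize (≤-trans len (*-mono-≤ (s≤s m≤N) (s≤s m≤N))) ⟩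
        suc N * suc N * letterSize             ∎

-- The upper bounds for EL and ELI.

1≤querySize : ∀ {S L} (q : Query S L) → 1 ≤ querySize q
1≤querySize (core ⊤ᶜ)       = s≤s z≤n
1≤querySize (core (atom _)) = s≤s z≤n
1≤querySize (core (_ ∧ᶜ _)) = s≤s z≤n
1≤querySize (core (∃ᶜ _ _)) = s≤s z≤n
1≤querySize (until _ _ _)   = s≤s z≤n

suc≤2* : ∀ {n} → 1 ≤ n → suc n ≤ 2 * n
suc≤2* {n} 1≤n = ≤-trans (+-monoˡ-≤ n 1≤n) (≤-reflexive (cong (n +_) (sym (+-identityʳ n))))

-- The factor 56 is 2 · 7 · 4: the 2 covers positive and negative examples, 7 = 3 + 4 bounds the
-- number of tests, and 4 comes from N + 1 ≤ 2N, squared. In the same way 4 · U comes from 1 + ν² ≤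
-- 2ν².
coefficient : Signature → ℕ
coefficient S = 56 * (1 + 4 * (#unary S + #binary S))

simplify-bound : ∀ S N ν → 1 ≤ N → 1 ≤ ν →
  2 * ((3 + N * (4 * (ν * ν))) *
       (suc N * suc N * (N + (#unary S + #binary S) * (suc (ν * ν) * suc (ν * ν))))) ≤
  coefficient S * (N ^ 4 * ν ^ 6)
simplify-bound S N ν 1≤N 1≤ν = begin
  2 * ((3 + N * (4 * (ν * ν))) * (suc N * suc N * (N + U * (suc (ν * ν) * suc (ν * ν)))))
    ≤⟨ *-monoʳ-≤ 2 (*-mono-≤ (+-monoˡ-≤ (N * (4 * (ν * ν))) (*-monoʳ-≤ 3 (*-mono-≤ 1≤N 1≤ν²)))
         (*-mono-≤ (*-mono-≤ (suc≤2* 1≤N) (suc≤2* 1≤N))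
           (+-mono-≤ (m≤m*n N _ {{>-nonZero 1≤ν⁴}})
             (≤-trans (*-monoʳ-≤ U (*-mono-≤ (suc≤2* 1≤ν²) (suc≤2* 1≤ν²))) (m≤n*m _ N {{>-nonZero 1≤N}}))))) ⟩
  2 * ((3 * (N * (ν * ν)) + N * (4 * (ν * ν))) *
       (2 * N * (2 * N) * (N * (ν * ν * (ν * ν)) + N * (U * (2 * (ν * ν) * (2 * (ν * ν)))))))
    ≡⟨ solve 3 (λ N ν U →
         con 2 :* ((con 3 :* (N :* (ν :* ν)) :+ N :* (con 4 :* (ν :* ν))) :*
           (con 2 :* N :* (con 2 :* N) :* (N :* (ν :* ν :* (ν :* ν)) :+
             N :* (U :* (con 2 :* (ν :* ν) :* (con 2 :* (ν :* ν))))))) :=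
         con 56 :* (con 1 :+ con 4 :* U) :* (N :^ 4 :* ν :^ 6)) refl N ν U ⟩
  coefficient S * (N ^ 4 * ν ^ 6) ∎
  where
  open ≤-Reasoning
  open +-*-Solver
  U = #unary S + #binary S
  1≤ν² : 1 ≤ ν * ν
  1≤ν² = *-mono-≤ 1≤ν 1≤ν
  1≤ν⁴ : 1 ≤ ν * ν * (ν * ν)
  1≤ν⁴ = *-mono-≤ 1≤ν² 1≤ν²

eval-monomial : ∀ d c x → eval (replicate d 0 ++ c ∷ []) x ≡ c * x ^ d
eval-monomial zero    c x = trans (cong (c +_) (*-zeroʳ x)) (trans (+-identityʳ c) (sym (*-identityʳ c)))
eval-monomial (suc d) c x = trans (cong (x *_) (eval-monomial d c x)) (begin
  x * (c * x ^ d)   ≡⟨ *-assoc x c (x ^ d) ⟨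
  x * c * x ^ d     ≡⟨ cong (_* x ^ d) (*-comm x c) ⟩
  c * x * x ^ d     ≡⟨ *-assoc c x (x ^ d) ⟩
  c * (x * x ^ d)   ∎)
  where open ≡-Reasoning

EL-polynomial : ∀ S → PolynomiallyCharacterisable (𝒫 S EL) (𝒬 S EL)
-- With ν = 2N the bound N⁴ν⁶ becomes 2⁶N¹⁰.
EL-polynomial S = replicate 10 0 ++ 64 * K ∷ [] , λ q peerless →
  let N   = querySize q
      1≤N = 1≤querySize q
      nodes-few : ∀ (c : Concept S EL) → conceptSize c ≤ N → suc (length (subs c)) ≤ 2 * N
      nodes-few c c≤N = ≤-trans (s≤s (≤-trans (subs-length c) c≤N)) (suc≤2* 1≤N)
      roots-few : ∀ (c : Concept S EL) → conceptSize c ≤ N → length (conjuncts c) ≤ 2 * N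
      roots-few c c≤N = ≤-trans (≤-trans (conjuncts-length c) c≤N) (m≤m+n N (N + 0))
      E , unique , size = Characterisation.Bound.characterisable ELDual.dual N (2 * N)
        (≤-trans 1≤N (m≤m+n N (N + 0))) nodes-few roots-few q peerless ≤-refl
  in E , unique , (begin
    ∣ E ∣ᴱ                                       ≤⟨ size ⟩
    _                                            ≤⟨ simplify-bound S N (2 * N) 1≤N (≤-trans 1≤N (m≤m+n N (N + 0))) ⟩
    K * (N ^ 4 * (2 * N) ^ 6)
      ≡⟨ solve 2 (λ K N → K :* (N :^ 4 :* (con 2 :* N) :^ 6) := con 64 :* K :* N :^ 10) refl K N ⟩
    64 * K * N ^ 10                              ≡⟨ eval-monomial 10 (64 * K) N ⟨
    eval (replicate 10 0 ++ 64 * K ∷ []) N       ∎)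
  where
  open ≤-Reasoning
  open +-*-Solver
  K = coefficient S

n<2^n : ∀ n → n < 2 ^ n
n<2^n zero    = s≤s z≤n
n<2^n (suc n) =
  ≤-trans (+-mono-≤ (m^n>0 2 n) (n<2^n n)) (≤-reflexive (cong (2 ^ n +_) (sym (+-identityʳ (2 ^ n)))))

n≤2^n : ∀ n → n ≤ 2 ^ n
n≤2^n n = <⇒≤ (n<2^n n)

ELI-exponential : ∀ S → ExponentiallyCharacterisable (𝒫 S ELI) (𝒬 S ELI)
-- With ν = 2^N and N ≤ 2^N the bound N⁴ν⁶ is at most 2^(10N), and K ≤ 2^K.
ELI-exponential S = K ∷ 10 ∷ [] , λ q peerless →
  let N = querySize q
      nodes-few : ∀ (c : Concept S ELI) → conceptSize c ≤ N → length (sublists (subs c)) ≤ 2 ^ N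
      nodes-few c c≤N = ≤-trans (≤-reflexive (sublists-length (subs c)))
        (^-monoʳ-≤ 2 (≤-trans (subs-length c) c≤N))
      roots-few : ∀ (c : Concept S ELI) → conceptSize c ≤ N → length (Dual.roots (ELIDual.dual c)) ≤ 2 ^ N
      roots-few c c≤N = ≤-trans (length-filter (λ t → ¬? (ELIDual.mem? c c t)) (sublists (subs c))) (nodes-few c c≤N)
      E , unique , size = Characterisation.Bound.characterisable ELIDual.dual N (2 ^ N)
        (m^n>0 2 N) nodes-few roots-few q peerless ≤-refl
  in E , unique , (begin
    ∣ E ∣ᴱ                                  ≤⟨ size ⟩
    _                                       ≤⟨ simplify-bound S N (2 ^ N) (1≤querySize q) (m^n>0 2 N) ⟩
    K * (N ^ 4 * (2 ^ N) ^ 6)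
      ≤⟨ *-mono-≤ (n≤2^n K) (*-monoˡ-≤ ((2 ^ N) ^ 6) (^-monoˡ-≤ 4 (n≤2^n N))) ⟩
    2 ^ K * ((2 ^ N) ^ 4 * (2 ^ N) ^ 6)     ≡⟨ cong (2 ^ K *_) (^-distribˡ-+-* (2 ^ N) 4 6) ⟨
    2 ^ K * (2 ^ N) ^ 10                    ≡⟨ cong (2 ^ K *_) (^-*-assoc 2 N 10) ⟩
    2 ^ K * 2 ^ (N * 10)                    ≡⟨ ^-distribˡ-+-* 2 K (N * 10) ⟨
    2 ^ (K + N * 10)                        ≡⟨ cong (λ x → 2 ^ (K + N * (10 + x))) (*-zeroʳ N) ⟨
    2 ^ eval (K ∷ 10 ∷ []) N                ∎)
  where
  open ≤-Reasoning
  K = coefficient S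

-- The lower bound for ELI.

finToFun-injective : ∀ {m n} {X Y : Fin (m ^ n)} →
                     (∀ i → Fin.finToFun {m} {n} X i ≡ Fin.finToFun {m} {n} Y i) → X ≡ Y
finToFun-injective {m} {n} {X} {Y} e =
  trans (sym (Fin.funToFin-finToFin {n} {m} X)) (trans (funToFin-cong e) (Fin.funToFin-finToFin {n} {m} Y))
  where
  funToFin-cong : ∀ {n} {f g : Fin n → Fin m} → (∀ i → f i ≡ g i) → Fin.funToFin f ≡ Fin.funToFin g
  funToFin-cong {zero}  e = refl
  funToFin-cong {suc n} e = cong₂ Fin.combine (e Fin.zero) (funToFin-cong (e ∘ Fin.suc))

module LowerBound {S : Signature} (P : Binary S) (n : ℕ) where

  Conceptᴵ : Set
  Conceptᴵ = Concept S ELI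

  ∃↑ ∃↓ : Conceptᴵ → Conceptᴵ
  ∃↑ = ∃ᶜ (name P)
  ∃↓ = ∃ᶜ (inv P)

  ⋀ : ∀ {A : Set} → List A → (A → Conceptᴵ) → Conceptᴵ
  ⋀ []       c = ⊤ᶜ
  ⋀ (x ∷ xs) c = c x ∧ᶜ ⋀ xs c

  Sat-⋀⁻ : ∀ {I : Set} {A a c} (xs : List I) → Sat {S} A a (⋀ xs c) → ∀ {x} → x ∈ xs → Sat A a (c x)
  Sat-⋀⁻ (x ∷ xs) (p , q) (here refl) = p
  Sat-⋀⁻ (x ∷ xs) (p , q) (there x∈)  = Sat-⋀⁻ xs q x∈

  Sat-⋀⁺ : ∀ {I : Set} {A a c} (xs : List I) → (∀ {x} → x ∈ xs → Sat A a (c x)) → Sat {S} A a (⋀ xs c)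
  Sat-⋀⁺ []       f = tt
  Sat-⋀⁺ (x ∷ xs) f = f (here refl) , Sat-⋀⁺ xs (f ∘ there)

  up down : ℕ → Conceptᴵ
  up zero      = ⊤ᶜ
  up (suc k)   = ∃↑ (up k)
  down zero    = ⊤ᶜ
  down (suc k) = ∃↓ (down k)

  -- The tags are pairwise incomparable: a longer path upwards is paid for by
  -- a shorter path downwards.
  tag : Fin n → Conceptᴵ
  tag i = ∃↓ (up (3 + toℕ i) ∧ᶜ down (n ∸ toℕ i))

  full-fork r : Conceptᴵ
  full-fork = ∃↑ (⋀ (allFin n) (λ i → ∃↓ (tag i)))
  r         = ∃↑ full-fork

  bit : Fin (2 ^ n) → Fin n → Fin 2
  bit = Fin.finToFun {2} {n}

  other : Fin n → Fin n → Conceptᴵ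
  other i j with i Fin.≟ j
  ... | yes _ = ⊤ᶜ
  ... | no _  = ∃↓ (tag j)

  -- Where full-fork fails, excluded i refutes tag i.
  excluded : Fin n → Conceptᴵ
  excluded i = ∃↑ (⋀ (allFin n) (other i))

  literal : Fin 2 → Fin n → Conceptᴵ
  literal Fin.zero    i = excluded i
  literal (Fin.suc _) i = tag i

  subset : Fin (2 ^ n) → Conceptᴵ
  subset X = ⋀ (allFin n) (λ i → literal (bit X i) i)

  -- It has 2ⁿ conjuncts, which is harmless: the bound is measured against the size of `q`, and `q`
  -- contains only `r`.
  l : Conceptᴵ
  l = ⋀ (allFin (2 ^ n)) (λ X → ∃↑ (subset X))

  module _ {A : DataInstance S} {a : Individual} (sat-l : Sat A a l) (unsat-r : ¬ Sat A a r) where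

    representative : ∀ X → ∃[ x ] (binary P a x ∈ A × Sat A x (subset X))
    representative X = Sat-⋀⁻ (allFin (2 ^ n)) sat-l (∈-allFin X)

    -- The witness `y` of `excluded i` has predecessors with all the other tags, and `x` itself is a
    -- predecessor of `y` with `tag i`. Together they complete a full fork, which makes `r` true at
    -- `a`.
    excluded-tag : ∀ {x} i → binary P a x ∈ A → Sat A x (excluded i) → ¬ Sat A x (tag i)
    excluded-tag {x} i x∈ (y , y∈ , p) q = unsat-r (x , x∈ , y , y∈ , Sat-⋀⁺ (allFin n) λ {j} _ → all j)
      where
      all : ∀ j → Sat A y (∃↓ (tag j))
      all j with i Fin.≟ j | Sat-⋀⁻ (allFin n) p (∈-allFin j)
      ... | yes refl | _ = x , y∈ , q
      ... | no _     | s = s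

    literal-agree : ∀ {x} i b b′ → binary P a x ∈ A → Sat A x (literal b i) → Sat A x (literal b′ i) → b ≡ b′
    literal-agree i Fin.zero               Fin.zero               x∈ p q = refl
    literal-agree i Fin.zero               (Fin.suc _)            x∈ p q = ⊥-elim (excluded-tag i x∈ p q)
    literal-agree i (Fin.suc _)            Fin.zero               x∈ p q = ⊥-elim (excluded-tag i x∈ q p)
    literal-agree i (Fin.suc Fin.zero)     (Fin.suc Fin.zero)     x∈ p q = refl

    -- Distinct sets have distinct representatives: a shared one would satisfy both `tag i` and
    -- `excluded i` at an `i` where the sets differ.
    many-facts : 2 ^ n ≤ length A
    many-facts = Fin.injective⇒≤ {f = index} injective
      where
      index : Fin (2 ^ n) → Fin (length A)
      index X = Any.index (representative X .proj₂ .proj₁)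
      binary-injective : ∀ {x y} → binary {S} P a x ≡ binary P a y → x ≡ y
      binary-injective refl = refl
      injective : ∀ {X Y} → index X ≡ index Y → X ≡ Y
      injective {X} {Y} eq with representative X | representative Y
      ... | x , x∈ , p | y , y∈ , q
        with binary-injective (trans (Any.lookup-index x∈) (trans (cong (lookup A) eq) (sym (Any.lookup-index y∈))))
      ...   | refl = finToFun-injective {2} {n} λ i → literal-agree i (bit X i) (bit Y i) x∈
        (Sat-⋀⁻ (allFin n) p (∈-allFin i)) (Sat-⋀⁻ (allFin n) q (∈-allFin i))

  -- A model of l and not r.  Every set X lies above root, and above the
  -- tagged i with i in X; the singleton sets below fork i are the
  -- witnesses for the tags other than i.

  data Node : Set where
    root                : Node
    set                 : Fin (2 ^ n) → Node
    fork                : Fin n → Node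
    tagged              : Fin n → Node
    above               : Fin (3 + n) → Node
    below               : Fin n → Node

  edge : Node → Node → Bool
  edge root       (set X)    = true
  edge (set X)    (fork i)   = ⌊ bit X i Fin.≟ Fin.zero ⌋
  edge (tagged i) (set X)    = ⌊ bit X i Fin.≟ Fin.suc Fin.zero ⌋
  edge (tagged i) (above j)  = ⌊ toℕ j ≟ 2 + toℕ i ⌋
  edge (above j)  (above k)  = ⌊ toℕ j ≟ suc (toℕ k) ⌋
  edge (below j)  (below k)  = ⌊ toℕ k ≟ suc (toℕ j) ⌋
  edge (below j)  (tagged i) = ⌊ suc (toℕ j + toℕ i) ≟ n ⌋
  edge _          _          = false

  M : Structure {S}
  M = record
    { Node  = Node
    ; nodes = root ∷ map set (allFin _) ++ map fork (allFin _) ++ map tagged (allFin _) ++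
              map above (allFin _) ++ map below (allFin _)
    ; U     = λ _ _ → ⊥
    ; U?    = λ _ _ → no λ ()
    ; B     = λ Q x y → Q ≡ P × T (edge x y)
    ; B?    = λ Q x y → Q Fin.≟ P ×-dec T? (edge x y)
    }

  open Structure M hiding (Node)

  node∈ : ∀ x → x ∈ nodes
  node∈ root       = here refl
  node∈ (set X)    = there (∈-++⁺ˡ (∈-map⁺ set (∈-allFin X)))
  node∈ (fork i)   = there (∈-++⁺ʳ (map set (allFin _)) (∈-++⁺ˡ (∈-map⁺ fork (∈-allFin i))))
  node∈ (tagged i) = there (∈-++⁺ʳ (map set (allFin _)) (∈-++⁺ʳ (map fork (allFin _))
    (∈-++⁺ˡ (∈-map⁺ tagged (∈-allFin i)))))
  node∈ (above i)  = there (∈-++⁺ʳ (map set (allFin _)) (∈-++⁺ʳ (map fork (allFin _))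
    (∈-++⁺ʳ (map tagged (allFin _)) (∈-++⁺ˡ (∈-map⁺ above (∈-allFin i))))))
  node∈ (below i)  = there (∈-++⁺ʳ (map set (allFin _)) (∈-++⁺ʳ (map fork (allFin _))
    (∈-++⁺ʳ (map tagged (allFin _)) (∈-++⁺ʳ (map above (allFin _)) (∈-map⁺ below (∈-allFin i))))))

  ∃↑⁺ : ∀ x c y → T (edge x y) → Holds y c → Holds x (∃↑ c)
  ∃↑⁺ x c y e p = y , node∈ y , (refl , e) , p

  ∃↓⁺ : ∀ x c y → T (edge y x) → Holds y c → Holds x (∃↓ c)
  ∃↓⁺ x c y e p = y , node∈ y , (refl , e) , p

  Holds-⋀⁻ : ∀ {I : Set} x c (is : List I) → Holds x (⋀ is c) → ∀ {i} → i ∈ is → Holds x (c i)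
  Holds-⋀⁻ x c (_ ∷ is) (p , q) (here refl) = p
  Holds-⋀⁻ x c (_ ∷ is) (p , q) (there i∈)  = Holds-⋀⁻ x c is q i∈

  Holds-⋀⁺ : ∀ {I : Set} x c (is : List I) → (∀ i → Holds x (c i)) → Holds x (⋀ is c)
  Holds-⋀⁺ x c []       f = tt
  Holds-⋀⁺ x c (i ∷ is) f = f i , Holds-⋀⁺ x c is f

  up-set : ∀ X k → Holds (set X) (up k) → k ≤ 1
  up-set X zero          p = z≤n
  up-set X (suc zero)    p = s≤s z≤n
  up-set X (suc (suc k)) (fork i , _ , _ , root       , _ , (_ , ()) , _)
  up-set X (suc (suc k)) (fork i , _ , _ , set _      , _ , (_ , ()) , _)
  up-set X (suc (suc k)) (fork i , _ , _ , fork _     , _ , (_ , ()) , _)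
  up-set X (suc (suc k)) (fork i , _ , _ , tagged _   , _ , (_ , ()) , _)
  up-set X (suc (suc k)) (fork i , _ , _ , above _    , _ , (_ , ()) , _)
  up-set X (suc (suc k)) (fork i , _ , _ , below _    , _ , (_ , ()) , _)

  -- This explains the offset 3 in `tag`: the root is a predecessor of every set and must not
  -- witness any tag.
  up-root : ∀ k → Holds root (up k) → k ≤ 2
  up-root zero    p = z≤n
  up-root (suc k) (set X , _ , _ , p) = s≤s (up-set X k p)

  up-above : ∀ j k → Holds (above j) (up k) → k ≤ toℕ j
  up-above j zero    p = z≤n
  up-above j (suc k) (above j′ , _ , (_ , e) , p) =
    ≤-trans (s≤s (up-above j′ k p)) (≤-reflexive (sym (toWitness e)))

  up-tagged : ∀ i k → Holds (tagged i) (up k) → k ≤ 3 + toℕ i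
  up-tagged i zero    p = z≤n
  up-tagged i (suc k) (set X , _ , _ , p) = s≤s (≤-trans (up-set X k p) (s≤s z≤n))
  up-tagged i (suc k) (above j , _ , (_ , e) , p) =
    s≤s (≤-trans (up-above j k p) (≤-reflexive (toWitness e)))

  down-below : ∀ j k → Holds (below j) (down k) → k ≤ toℕ j
  down-below j zero    p = z≤n
  down-below j (suc k) (below j′ , _ , (_ , e) , p) =
    ≤-trans (s≤s (down-below j′ k p)) (≤-reflexive (sym (toWitness e)))

  down-tagged : ∀ i k → Holds (tagged i) (down k) → k + toℕ i ≤ n
  down-tagged i zero    p = Fin.toℕ≤n i
  down-tagged i (suc k) (below j , _ , (_ , e) , p) =
    ≤-trans (s≤s (+-monoˡ-≤ (toℕ i) (down-below j k p))) (≤-reflexive (toWitness e))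

  above-up : ∀ k (k< : k < 3 + n) → Holds (above (Fin.fromℕ< k<)) (up k)
  above-up zero    k<  = tt
  above-up (suc k) k<  = ∃↑⁺ (above (Fin.fromℕ< k<)) (up k) (above (Fin.fromℕ< k<′))
    (fromWitness (trans (Fin.toℕ-fromℕ< k<) (cong suc (sym (Fin.toℕ-fromℕ< k<′))))) (above-up k k<′)
    where k<′ = <-trans (n<1+n k) k<

  below-down : ∀ k (k< : k < n) → Holds (below (Fin.fromℕ< k<)) (down k)
  below-down zero    k<  = tt
  below-down (suc k) k<  = ∃↓⁺ (below (Fin.fromℕ< k<)) (down k) (below (Fin.fromℕ< k<′))
    (fromWitness (trans (Fin.toℕ-fromℕ< k<) (cong suc (sym (Fin.toℕ-fromℕ< k<′))))) (below-down k k<′)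
    where k<′ = <-trans (n<1+n k) k<

  tagged-up : ∀ i → Holds (tagged i) (up (3 + toℕ i))
  tagged-up i = ∃↑⁺ (tagged i) (up (2 + toℕ i)) (above (Fin.fromℕ< k<)) (fromWitness (Fin.toℕ-fromℕ< k<)) (above-up (2 + toℕ i) k<)
    where
    k< : 2 + toℕ i < 3 + n
    k< = s≤s (s≤s (s≤s (Fin.toℕ≤n i)))

  tagged-down : ∀ i → Holds (tagged i) (down (n ∸ toℕ i))
  tagged-down i with n ∸ toℕ i in eq
  ... | zero  = tt
  ... | suc k = ∃↓⁺ (tagged i) (down k) (below (Fin.fromℕ< k<)) (fromWitness (trans (cong (λ j → suc (j + toℕ i)) (Fin.toℕ-fromℕ< k<)) sum≡))
                  (below-down k k<)
    where
    sum≡ : suc k + toℕ i ≡ n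
    sum≡ = trans (cong (_+ toℕ i) (sym eq)) (m∸n+n≡m (Fin.toℕ≤n i))
    k< : k < n
    k< = ≤-trans (m≤m+n (suc k) (toℕ i)) (≤-reflexive sum≡)

  tag⁺ : ∀ X i → bit X i ≡ Fin.suc Fin.zero → Holds (set X) (tag i)
  tag⁺ X i eq = ∃↓⁺ (set X) (up (3 + toℕ i) ∧ᶜ down (n ∸ toℕ i)) (tagged i) (fromWitness eq) (tagged-up i , tagged-down i)

  -- For a witness `tagged j`, the way up forces i ≤ j and the way down forces j ≤ i.
  tag⁻ : ∀ X i → Holds (set X) (tag i) → bit X i ≡ Fin.suc Fin.zero
  tag⁻ X i (root , _ , _ , p , _) with up-root (3 + toℕ i) p
  ... | s≤s (s≤s ())
  tag⁻ X i (tagged j , _ , (_ , e) , p , q) = subst (λ j → bit X j ≡ Fin.suc Fin.zero) (sym i≡j) (toWitness e)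
    where
    i≤j : toℕ i ≤ toℕ j
    i≤j = ≤-pred (≤-pred (≤-pred (up-tagged j (3 + toℕ i) p)))
    j≤i : toℕ j ≤ toℕ i
    j≤i = +-cancelˡ-≤ (n ∸ toℕ i) _ _ (≤-trans (down-tagged j (n ∸ toℕ i) q) (≤-reflexive (sym (m∸n+n≡m (Fin.toℕ≤n i)))))
    i≡j : i ≡ j
    i≡j = Fin.toℕ-injective (≤-antisym i≤j j≤i)

  singleton : Fin n → Fin n → Fin 2
  singleton j i with i Fin.≟ j
  ... | yes _ = Fin.suc Fin.zero
  ... | no _  = Fin.zero

  holds-subset : ∀ X → Holds (set X) (subset X)
  holds-subset X = Holds-⋀⁺ (set X) (λ i → literal (bit X i) i) (allFin n) λ i → lit i (bit X i) refl
    where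
    lit : ∀ i b → bit X i ≡ b → Holds (set X) (literal b i)
    lit i (Fin.suc Fin.zero) eq = tag⁺ X i eq
    lit i Fin.zero eq = ∃↑⁺ (set X) (⋀ (allFin n) (other i)) (fork i) (fromWitness eq)
                          (Holds-⋀⁺ (fork i) (other i) (allFin n) others)
      where
      others : ∀ j → Holds (fork i) (other i j)
      others j with i Fin.≟ j
      ... | yes _  = tt
      ... | no i≢j = ∃↓⁺ (fork i) (tag j) (set Y) (fromWitness (trans (Fin.finToFun-funToFin (singleton j) i) off))
                       (tag⁺ Y j (trans (Fin.finToFun-funToFin (singleton j) j) on))
        where
        Y = Fin.funToFin (singleton j)
        off : singleton j i ≡ Fin.zero
        off with i Fin.≟ j
        ... | yes i≡j = ⊥-elim (i≢j i≡j)
        ... | no _    = refl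
        on : singleton j j ≡ Fin.suc Fin.zero
        on with j Fin.≟ j
        ... | yes _ = refl
        ... | no ≢  = ⊥-elim (≢ refl)

  holds-l : Holds root l
  holds-l = Holds-⋀⁺ root (∃↑ ∘ subset) (allFin (2 ^ n)) λ X → ∃↑⁺ root (subset X) (set X) tt (holds-subset X)

  -- All predecessors of `fork i` are sets without `i`, and these do not satisfy `tag i`.
  ¬holds-r : ¬ Holds root r
  ¬holds-r (set X , _ , _ , fork i , _ , _ , p) with Holds-⋀⁻ (fork i) (∃↓ ∘ tag) (allFin n) p (∈-allFin i)
  ... | set Y , _ , (_ , e) , q with trans (sym (toWitness e)) (tag⁻ Y i q)
  ...   | ()

  -- Negative examples that every characterisation of ○r contains.

  open Presentation root

  q q′ : Query S ELI
  q  = until ⊤ᶜ ⊥ᵍ (core r)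
  q′ = until ⊤ᶜ ⌜ l ⌝ (core r)

  -- The separating instance has the model of `l` without `r` at time 1 and the tree of `r` at time
  -- 2; individual 0 is the root of both.
  q′⊭q : ¬ q′ ⊨ q
  q′⊭q h with h D 0 0 (tt , 2 , s≤s z≤n , concept-sat r D 0 2 .proj₂ (tree-sat r) , guards)
    where
    D : TemporalInstance S
    D = [] ∷⁺ presentation ∷ tree r ∷ []
    guards : ∀ k → 0 < k → k < 2 → concept⊨ l D 0 k
    guards (suc zero) _ _ = concept-sat l D 0 1 .proj₂ (holds⇒sat l Fin.zero holds-l)
    guards (suc (suc k)) _ (s≤s (s≤s ()))
  ... | _ , suc zero , _ , p , _ = ¬holds-r (sat⇒holds (node∈ root) r Fin.zero (concept-sat r D 0 1 .proj₁ p))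
    where
    D : TemporalInstance S
    D = [] ∷⁺ presentation ∷ tree r ∷ []
  ... | _ , suc (suc m) , _ , _ , g = g 1 (s≤s z≤n) (s≤s (s≤s z≤n))

  at-length : ∀ (As : List (DataInstance S)) ℓ → length (at As ℓ) ≤ sum (map length As)
  at-length []       ℓ       = z≤n
  at-length (A ∷ As) zero    = m≤m+n (length A) _
  at-length (A ∷ As) (suc ℓ) = ≤-trans (at-length As ℓ) (m≤n+m _ (length A))

  q⇒q′ : ∀ {e} → Satisfies q e → Satisfies q′ e
  q⇒q′ (_ , m , 0<m , p , g) = tt , m , 0<m , p , λ k 0<k k<m → ⊥-elim (g k 0<k k<m)

  -- A target at time 1 would make `q` true. A later one forces `l` at time 1, where `r` fails
  -- because `q` does, so `many-facts` applies.
  q′⇒large : ∀ {e} → ¬ Satisfies q e → Satisfies q′ e → 2 ^ n ≤ sizeT (instance-of e)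
  q′⇒large {e} ¬q (_ , suc zero , 0<m , p , g) =
    ⊥-elim (¬q (tt , 1 , 0<m , p , λ k 0<k k<1 → <-irrefl refl (≤-trans 0<k (≤-pred k<1))))
  q′⇒large {e} ¬q (_ , suc (suc m) , 0<m , p , g) = ≤-trans
    (many-facts (concept-sat l D a 1 .proj₁ (g 1 (s≤s z≤n) (s≤s (s≤s z≤n))))
      λ s → ¬q (tt , 1 , s≤s z≤n , concept-sat r D a 1 .proj₂ s ,
                λ k 0<k k<1 → <-irrefl refl (≤-trans 0<k (≤-pred k<1))))
    (at-length (toList D) 1)
    where
    D = instance-of e
    a = point e

  sum-member : ∀ {A : Set} (f : A → ℕ) {x} xs → x ∈ xs → f x ≤ sum (map f xs)
  sum-member f (x ∷ xs) (here refl) = m≤m+n (f x) _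
  sum-member f (y ∷ xs) (there x∈)  = ≤-trans (sum-member f xs x∈) (m≤n+m _ (f y))

  lower-bound : ∀ E → UniquelyCharacterises E q (𝒬 S ELI) → 2 ^ n ≤ ∣ E ∣ᴱ
  lower-bound E ((pos , neg) , unique) with 2 ^ n ≤? ∣ E ∣ᴱ
  ... | yes le = le
  ... | no ≰   = ⊥-elim (q′⊭q (unique q′ tt
    ( All.map (λ {e} → q⇒q′ {e}) pos
    , All.tabulate λ {e} e∈ s → ≰ (≤-trans (q′⇒large {e} (All.lookup neg e∈) s)
        (sum-member (sizeT ∘ instance-of) (positive E ++ negative E) (∈-++⁺ʳ (positive E) e∈)))) .proj₂))

  -- A quadratic bound on the size of `q`.

  ⋀-size : ∀ {I : Set} {c : I → Conceptᴵ} b (is : List I) → (∀ i → conceptSize (c i) ≤ b) →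
           conceptSize (⋀ is c) ≤ 1 + length is * suc b
  ⋀-size b []       h = ≤-refl
  ⋀-size {c = c} b (i ∷ is) h = s≤s (begin
    conceptSize (c i) + conceptSize (⋀ is c)  ≤⟨ +-mono-≤ (h i) (⋀-size b is h) ⟩
    b + (1 + length is * suc b)               ≡⟨ +-suc b (length is * suc b) ⟩
    suc b + length is * suc b                 ∎)
    where open ≤-Reasoning

  up-size : ∀ k → conceptSize (up k) ≡ 1 + k * 2
  up-size zero    = refl
  up-size (suc k) = trans (cong (2 +_) (up-size k)) refl

  down-size : ∀ k → conceptSize (down k) ≡ 1 + k * 2
  down-size zero    = refl
  down-size (suc k) = cong (2 +_) (down-size k)

  tag-size : ∀ i → conceptSize (tag i) ≤ 11 + n * 2
  tag-size i = ≤-reflexive (begin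
    3 + conceptSize (up (3 + toℕ i)) + conceptSize (down (n ∸ toℕ i))
      ≡⟨ cong₂ (λ a b → 3 + a + b) (up-size (3 + toℕ i)) (down-size (n ∸ toℕ i)) ⟩
    10 + toℕ i * 2 + (1 + (n ∸ toℕ i) * 2)
      ≡⟨ solve 2 (λ i j → con 10 :+ i :* con 2 :+ (con 1 :+ j :* con 2) := con 11 :+ (j :+ i) :* con 2) refl
           (toℕ i) (n ∸ toℕ i) ⟩
    11 + (n ∸ toℕ i + toℕ i) * 2
      ≡⟨ cong (λ n → 11 + n * 2) (m∸n+n≡m (Fin.toℕ≤n i)) ⟩
    11 + n * 2 ∎)
    where
    open ≡-Reasoning
    open +-*-Solver

  q-size : querySize q ≤ 9 + n * (14 + n * 2)
  q-size = begin
    8 + conceptSize (⋀ (allFin n) (λ i → ∃↓ (tag i)))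
      ≤⟨ +-monoʳ-≤ 8 (⋀-size (13 + n * 2) (allFin n) (λ i → +-monoʳ-≤ 2 (tag-size i))) ⟩
    9 + length (allFin n) * (14 + n * 2)
      ≡⟨ cong (λ m → 9 + m * (14 + n * 2)) (length-tabulate {n = n} id) ⟩
    9 + n * (14 + n * 2) ∎
    where open ≤-Reasoning

-- Polynomials grow more slowly than 2 ^ n.

eval-mono : ∀ f {x y} → x ≤ y → eval f x ≤ eval f y
eval-mono []      x≤y = z≤n
eval-mono (c ∷ f) x≤y = +-monoʳ-≤ c (*-mono-≤ x≤y (eval-mono f x≤y))

eval-bound : ∀ f → ∃[ a ] ∃[ d ] (∀ x → 1 ≤ x → eval f x ≤ a * x ^ d)
eval-bound []      = 0 , 0 , λ _ _ → z≤n
eval-bound (c ∷ f) with eval-bound f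
... | a , d , h = c + a , suc d , λ x 1≤x → begin
  c + x * eval f x                ≤⟨ +-mono-≤ (m≤m*n c (x ^ suc d) {{>-nonZero (m^n>0 x {{>-nonZero 1≤x}} (suc d))}})
                                       (*-monoʳ-≤ x (h x 1≤x)) ⟩
  c * x ^ suc d + x * (a * x ^ d) ≡⟨ solve 4 (λ c x a y → c :* (x :* y) :+ x :* (a :* y) := (c :+ a) :* (x :* y))
                                       refl c x a (x ^ d) ⟩
  (c + a) * x ^ suc d             ∎
  where
  open ≤-Reasoning
  open +-*-Solver

-- The witness 2p splits 2^(2p) into two factors above p; with p = α + 2β the linear side stays
-- below (p + 1)².
linear<exponential : ∀ α β → ∃[ m ] α + m * β < 2 ^ m
linear<exponential α β = 2 * p , (begin-strict
  α + 2 * p * β                        ≡⟨ solve 3 (λ α β p → α :+ con 2 :* p :* β := α :+ p :* (con 2 :* β)) refl α β p ⟩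
  α + p * (2 * β)                      ≤⟨ +-mono-≤ (m≤m+n α (2 * β)) (*-monoʳ-≤ p (m≤n+m (2 * β) α)) ⟩
  p + p * p                            <⟨ s≤s (m≤n+m (p + p * p) p) ⟩
  suc (p + (p + p * p))                ≡⟨ solve 1 (λ p → con 1 :+ (p :+ (p :+ p :* p)) := (con 1 :+ p) :* (con 1 :+ p)) refl p ⟩
  suc p * suc p                        ≤⟨ *-mono-≤ (n<2^n p) (n<2^n p) ⟩
  2 ^ p * 2 ^ p                        ≡⟨ ^-distribˡ-+-* 2 p p ⟨
  2 ^ (p + p)                          ≡⟨ cong (λ x → 2 ^ (p + x)) (+-identityʳ p) ⟨
  2 ^ (2 * p)                          ∎)
  where
  open ≤-Reasoning
  open +-*-Solver
  p = α + 2 * β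

-- Taking for `n` a power 2^m turns the claim into a comparison of exponents: linear in `m` on the
-- left, 2^m on the right.
polynomial<exponential : ∀ f → ∃[ n ] eval f (9 + n * (14 + n * 2)) < 2 ^ n
polynomial<exponential f with eval-bound f
... | a , d , h with linear<exponential (a + 5 * d) (2 * d)
...   | m , lt = n , (begin-strict
  eval f (9 + n * (14 + n * 2))  ≤⟨ eval-mono f quadratic ⟩
  eval f (2 ^ (5 + 2 * m))       ≤⟨ h (2 ^ (5 + 2 * m)) (m^n>0 2 (5 + 2 * m)) ⟩
  a * (2 ^ (5 + 2 * m)) ^ d      ≤⟨ *-monoˡ-≤ ((2 ^ (5 + 2 * m)) ^ d) (n≤2^n a) ⟩
  2 ^ a * (2 ^ (5 + 2 * m)) ^ d  ≡⟨ cong (2 ^ a *_) (^-*-assoc 2 (5 + 2 * m) d) ⟩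
  2 ^ a * 2 ^ ((5 + 2 * m) * d)  ≡⟨ ^-distribˡ-+-* 2 a ((5 + 2 * m) * d) ⟨
  2 ^ (a + (5 + 2 * m) * d)      ≡⟨ cong (2 ^_) (solve 3 (λ a d m →
                                      a :+ (con 5 :+ con 2 :* m) :* d := a :+ con 5 :* d :+ m :* (con 2 :* d)) refl a d m) ⟩
  2 ^ (a + 5 * d + m * (2 * d))  <⟨ ^-monoʳ-< 2 (s≤s (s≤s z≤n)) lt ⟩
  2 ^ n                          ∎)
  where
  open ≤-Reasoning
  open +-*-Solver
  n = 2 ^ m
  1≤n : 1 ≤ n
  1≤n = m^n>0 2 m
  quadratic : 9 + n * (14 + n * 2) ≤ 2 ^ (5 + 2 * m)
  quadratic = begin
    9 + n * (14 + n * 2)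
      ≤⟨ +-mono-≤ (*-monoʳ-≤ 9 (*-mono-≤ 1≤n 1≤n)) (*-monoʳ-≤ n (+-monoˡ-≤ (n * 2) (*-monoʳ-≤ 14 1≤n))) ⟩
    9 * (n * n) + n * (14 * n + n * 2)
      -- Rounding 25n² up to 32n² makes the bound a power of two.
      ≤⟨ m≤m+n _ (7 * (n * n)) ⟩
    9 * (n * n) + n * (14 * n + n * 2) + 7 * (n * n)
      ≡⟨ solve 1 (λ n → con 9 :* (n :* n) :+ n :* (con 14 :* n :+ n :* con 2) :+ con 7 :* (n :* n) :=
                        con 32 :* (n :* n)) refl n ⟩
    32 * (n * n)             ≡⟨ cong (32 *_) (^-distribˡ-+-* 2 m m) ⟨
    32 * 2 ^ (m + m)         ≡⟨ cong (λ x → 32 * 2 ^ (m + x)) (+-identityʳ m) ⟨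
    2 ^ 5 * 2 ^ (2 * m)      ≡⟨ ^-distribˡ-+-* 2 5 (2 * m) ⟨
    2 ^ (5 + 2 * m)          ∎

ELI-not-polynomial : ∀ S → HasBinary S → ¬ PolynomiallyCharacterisable (𝒫 S ELI) (𝒬 S ELI)
ELI-not-polynomial S hasBinary (f , characterisable) = refute (polynomial<exponential f)
  where
  refute : ¬ (∃[ n ] eval f (9 + n * (14 + n * 2)) < 2 ^ n)
  refute (n , lt) = <⇒≱ lt (begin
    2 ^ n                          ≤⟨ lower-bound E unique ⟩
    ∣ E ∣ᴱ                         ≤⟨ small ⟩
    eval f (querySize q)           ≤⟨ eval-mono f q-size ⟩
    eval f (9 + n * (14 + n * 2))  ∎)
    where
    open ≤-Reasoning
    open LowerBound (Fin.fromℕ< hasBinary) n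
    characterisation : ∃[ E ] (UniquelyCharacterises {S} E q (𝒬 S ELI) × ∣ E ∣ᴱ ≤ eval f (querySize q))
    characterisation = characterisable q (tt , tt)
    E : ExampleSet S
    E = characterisation .proj₁
    unique : UniquelyCharacterises E q (𝒬 S ELI)
    unique = characterisation .proj₂ .proj₁
    small : ∣ E ∣ᴱ ≤ eval f (querySize q)
    small = characterisation .proj₂ .proj₂

theorem28 : (S : Signature) →
  PolynomiallyCharacterisable (𝒫 S EL) (𝒬 S EL)
  × ExponentiallyCharacterisable (𝒫 S ELI) (𝒬 S ELI)
  × (HasBinary S → ¬ PolynomiallyCharacterisable (𝒫 S ELI) (𝒬 S ELI))
theorem28 S = EL-polynomial S , ELI-exponential S , ELI-not-polynomial S
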